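{- Let $r\ge 0$ be an integer. The mod-2 homology functor $F:=H_1(-;\mathbb F_2):\mathcal M(r,\mathbb F_2)\to \mathcal G\ell(r,\mathbb F_2)$ induces a homotopy equivalence on classifying spaces $$F_*: B\mathcal M(r,\mathbb F_2)\simeq B\mathcal G\ell(r,\mathbb F_2)\simeq BGL(r,\mathbb F_2).$$
   Context: Matroids have finite ground sets (loops and parallel elements are allowed). A morphism of matroids $(E_1,M_1)\to(E_2,M_2)$ is an injective map $f:E_1\to E_2$ such that a subset of $E_1$ is independent if and only if its image in $E_2$ is independent. A representation of a matroid on $E$ over a field $K$ is a map $\rho:E\to V$ to a $K$-vector space such that a subset of $E$ is independent iff $\rho$ maps it injectively onto a linearly independent set, and such that $\rho(E)$ spans $V$. A matroid is binary if it has a representation over $\mathbb F_2$. $\mathcal M(r,\mathbb F_2)$ is the category whose objects are the binary matroids of rank $r$ and whose morphisms are the injective maps $f:E_1\to E_2$ of ground sets such that a subset of $E_1$ is independent if and only if its image in $E_2$ is independent. For a matroid $M$ on $E$, $H_1(M)$ is the abelian group generated by the elements of $E$ modulo the relations $\sum_{e\in C}e=0$ for all circuits $C$ of $M$, and $H_1(M;\mathbb F_2):=H_1(M)\otimes\mathbb F_2$. For binary $M$ of rank $r$, $H_1(M;\mathbb F_2)\cong\mathbb F_2^r$, and a morphism between binary matroids of rank $r$ induces an isomorphism on $H_1(-;\mathbb F_2)$. $\mathcal G\ell(r,\mathbb F_2)$ is the category whose objects are the $\mathbb F_2$-vector spaces isomorphic to $\mathbb F_2^r$ and whose morphisms are the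 linear isomorphisms. $B\mathcal C$ denotes the classifying space (geometric realization of the nerve) of a category $\mathcal C$; all categories here are taken to be small (replaced by equivalent small categories). -}

module Defs where

open import Algebra.Bundles using (CommutativeMonoid; AbelianGroup; Group; CommutativeRing)
open import Algebra.Module.Bundles using (Module)
open import Algebra.Module.Structures using (IsLeftModule)
open import Algebra.Module.Structures.Biased using (IsModuleFromLeft)
open import Algebra.Module.Morphism.Structures using (module ModuleMorphisms)
import Algebra.Module.Morphism.Construct.Composition as CompM
import Algebra.Module.Morphism.Construct.Identity as IdM
open import Data.Bool.Base using (Bool; true; false; if_then_else_; _xor_; _∧_)
import Data.Bool.Properties as Boolₚ
open import Data.Empty using (⊥-elim)
open import Data.Fin.Base using (Fin; zero; suc) renaming (_≤_ to _≤ᶠ_)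
import Data.Fin.Properties as Finₚ
open import Data.Fin.Subset
  using (Subset; _∈_; _∉_; _⊆_; _⊂_; _∪_; _-_; ⁅_⁆; ∣_∣)
  renaming (⊥ to ∅)
import Data.Fin.Subset.Properties as Subₚ
open import Data.Nat.Base as ℕ using (ℕ; zero; suc)
import Data.Nat.Properties as ℕₚ
open import Data.Nat.Induction using (<-wellFounded)
open import Data.Product.Base using (Σ; ∃; _×_; _,_; proj₁; proj₂)
open import Data.Rational.Base as ℚ using (ℚ; 0ℚ; 1ℚ)
import Data.Rational.Properties as ℚₚ
open import Data.Sum.Base as Sum using (_⊎_; inj₁; inj₂)
open import Data.Unit.Polymorphic.Base using (⊤; tt)
open import Data.Vec.Base using ([]; _∷_; here; there; lookup; tabulate)
import Data.Vec.Functional as Vector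
import Data.Vec.Properties as Vecₚ
open import Function.Base using (_∘_; id)
open import Function.Bundles using (_⇔_; mk⇔; Equivalence)
open import Function.Definitions using (Injective)
open import Induction.WellFounded using (Acc; acc)
open import Level using (Level; _⊔_; 0ℓ) renaming (suc to lsuc)
open import Relation.Binary.Bundles using (Setoid)
open import Relation.Binary.Core using (Rel)
open import Relation.Binary.Definitions using (_Respects_)
import Relation.Binary.Definitions as RB
open import Relation.Binary.Structures using (IsEquivalence)
open import Relation.Binary.Construct.Closure.Equivalence using (EqClosure)
import Relation.Binary.Construct.Closure.Equivalence as EqC
open import Relation.Binary.PropositionalEquality as ≡
  using (_≡_; _≢_; _≗_; refl; sym; trans; cong; cong₂; subst)
open import Relation.Nullary using (¬_; Dec; yes; no; does; _×-dec_; ¬?; contradiction)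
open import Relation.Nullary.Decidable using (decidable-stable; dec-true; dec-false)
open import Relation.Unary using (Pred; Decidable; _≐_; _∩_)

1ℓ : Level
1ℓ = lsuc 0ℓ

record Category (o ℓ e : Level) : Set (lsuc (o ⊔ ℓ ⊔ e)) where
  infix  4 _≈_
  infixr 9 _∙_
  field
    Obj : Set o
    Hom : Obj → Obj → Set ℓ
    _≈_ : ∀ {A B} → Rel (Hom A B) e
    idₕ : ∀ {A} → Hom A A
    _∙_ : ∀ {A B C} → Hom B C → Hom A B → Hom A C
    ≈-equiv   : ∀ {A B} → IsEquivalence (_≈_ {A} {B})
    ∙-cong    : ∀ {A B C} {g g′ : Hom B C} {f f′ : Hom A B} →
                g ≈ g′ → f ≈ f′ → g ∙ f ≈ g′ ∙ f′
    identityˡ : ∀ {A B} (f : Hom A B) → idₕ ∙ f ≈ f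
    identityʳ : ∀ {A B} (f : Hom A B) → f ∙ idₕ ≈ f
    assoc     : ∀ {A B C D} (h : Hom C D) (g : Hom B C) (f : Hom A B) →
                (h ∙ g) ∙ f ≈ h ∙ (g ∙ f)

  module ≈ {A} {B} = IsEquivalence (≈-equiv {A} {B})

  -- Equality of arrows whose endpoints are not definitionally the same;
  -- an inhabitant forces the endpoints to be propositionally equal.
  infix 4 _≋_
  data _≋_ {A B : Obj} (f : Hom A B) :
           ∀ {A′ B′ : Obj} → Hom A′ B′ → Set (o ⊔ ℓ ⊔ e) where
    ≈⇒≋ : {g : Hom A B} → f ≈ g → f ≋ g

  ≋-refl : ∀ {A B} {f : Hom A B} → f ≋ f
  ≋-refl = ≈⇒≋ ≈.refl

  ≋-sym : ∀ {A B A′ B′} {f : Hom A B} {g : Hom A′ B′} → f ≋ g → g ≋ f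
  ≋-sym (≈⇒≋ p) = ≈⇒≋ (≈.sym p)

  ≋-trans : ∀ {A B A′ B′ A″ B″}
            {f : Hom A B} {g : Hom A′ B′} {h : Hom A″ B″} →
            f ≋ g → g ≋ h → f ≋ h
  ≋-trans (≈⇒≋ p) (≈⇒≋ q) = ≈⇒≋ (≈.trans p q)

record Functor {o ℓ e o′ ℓ′ e′} (C : Category o ℓ e) (D : Category o′ ℓ′ e′)
               : Set (o ⊔ ℓ ⊔ e ⊔ o′ ⊔ ℓ′ ⊔ e′) where
  private
    module C = Category C
    module D = Category D
  field
    F₀     : C.Obj → D.Obj
    F₁     : ∀ {A B} → C.Hom A B → D.Hom (F₀ A) (F₀ B)
    F-cong : ∀ {A B} {f g : C.Hom A B} → f C.≈ g → F₁ f D.≈ F₁ g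
    F-id   : ∀ {A} → F₁ (C.idₕ {A}) D.≈ D.idₕ
    F-∙    : ∀ {A B E} (g : C.Hom B E) (f : C.Hom A B) →
             F₁ (g C.∙ f) D.≈ F₁ g D.∙ F₁ f

  F-≋ : ∀ {A B A′ B′} {f : C.Hom A B} {g : C.Hom A′ B′} →
        f C.≋ g → F₁ f D.≋ F₁ g
  F-≋ (C.≈⇒≋ p) = D.≈⇒≋ (F-cong p)

infixr 9 _∘F_
_∘F_ : ∀ {o ℓ e o′ ℓ′ e′ o″ ℓ″ e″}
       {C : Category o ℓ e} {D : Category o′ ℓ′ e′} {E : Category o″ ℓ″ e″} →
       Functor D E → Functor C D → Functor C E
_∘F_ {E = E} G F = record
  { F₀     = G.F₀ ∘ F.F₀
  ; F₁     = G.F₁ ∘ F.F₁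
  ; F-cong = G.F-cong ∘ F.F-cong
  ; F-id   = E.≈.trans (G.F-cong F.F-id) G.F-id
  ; F-∙    = λ g f → E.≈.trans (G.F-cong (F.F-∙ g f)) (G.F-∙ (F.F₁ g) (F.F₁ f))
  }
  where
  module E = Category E
  module F = Functor F
  module G = Functor G

oneObject : Group 0ℓ 0ℓ → Category 1ℓ 0ℓ 0ℓ
oneObject G = record
  { Obj       = ⊤
  ; Hom       = λ _ _ → G.Carrier
  ; _≈_       = G._≈_
  ; idₕ       = G.ε
  ; _∙_       = G._∙_
  ; ≈-equiv   = G.isEquivalence
  ; ∙-cong    = G.∙-cong
  ; identityˡ = G.identityˡ
  ; identityʳ = G.identityʳ
  ; assoc     = G.assoc
  }
  where module G = Group G

Ordinal : ℕ → Category 0ℓ 0ℓ 0ℓ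
Ordinal n = record
  { Obj       = Fin (suc n)
  ; Hom       = _≤ᶠ_
  ; _≈_       = λ _ _ → ⊤
  ; idₕ       = Finₚ.≤-refl
  ; _∙_       = λ q p → Finₚ.≤-trans p q
  ; ≈-equiv   = _
  ; ∙-cong    = _
  ; identityˡ = _
  ; identityʳ = _
  ; assoc     = _
  }

record _→Δ_ (m n : ℕ) : Set where
  field
    app  : Fin (suc m) → Fin (suc n)
    mono : ∀ {i j} → i ≤ᶠ j → app i ≤ᶠ app j

open _→Δ_ public

idΔ : ∀ {n} → n →Δ n
idΔ = record { app = id ; mono = id }

infixr 9 _∘Δ_
_∘Δ_ : ∀ {l m n} → m →Δ n → l →Δ m → l →Δ n
ψ ∘Δ φ = record { app = app ψ ∘ app φ ; mono = mono ψ ∘ mono φ }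

⌜_⌝ : ∀ {m n} → m →Δ n → Functor (Ordinal m) (Ordinal n)
⌜ θ ⌝ = record
  { F₀ = app θ ; F₁ = mono θ ; F-cong = _ ; F-id = _ ; F-∙ = _ }

record SimplicialSet : Set (lsuc 1ℓ) where
  field
    simplices : ℕ → Setoid 1ℓ 1ℓ
  module S n = Setoid (simplices n)
  field
    act      : ∀ {m n} → m →Δ n → S.Carrier n → S.Carrier m
    act-cong : ∀ {m n} {θ θ′ : m →Δ n} {x y} → app θ ≗ app θ′ →
               S._≈_ n x y → S._≈_ m (act θ x) (act θ′ y)
    act-id   : ∀ {n} x → S._≈_ n (act idΔ x) x
    act-∘    : ∀ {l m n} (ψ : m →Δ n) (φ : l →Δ m) x →
               S._≈_ l (act (ψ ∘Δ φ) x) (act φ (act ψ x))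

record SimplicialMap (X Y : SimplicialSet) : Set 1ℓ where
  private
    module X = SimplicialSet X
    module Y = SimplicialSet Y
  field
    map     : ∀ {n} → X.S.Carrier n → Y.S.Carrier n
    map-cong : ∀ {n x y} → X.S._≈_ n x y → Y.S._≈_ n (map x) (map y)
    natural : ∀ {m n} (θ : m →Δ n) x →
              Y.S._≈_ m (map (X.act θ x)) (Y.act θ (map x))

-- An n-simplex of the nerve is a functor from {0 < ⋯ < n}, i.e. a string of
-- n composable arrows together with all its composites.  Two such functors
-- are equal when they agree on arrows (hence on objects, via identities).
module _ (C : Category 1ℓ 0ℓ 0ℓ) where
  private
    module C = Category C

  _≈ᶠ_ : ∀ {n} → Rel (Functor (Ordinal n) C) 1ℓ
  σ ≈ᶠ τ = ∀ {i j} (p : i ≤ᶠ j) → Functor.F₁ σ p C.≋ Functor.F₁ τ p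

  private
    F₁-app : ∀ {n} (σ : Functor (Ordinal n) C) {i j i′ j′}
             (p : i ≤ᶠ j) (p′ : i′ ≤ᶠ j′) → i ≡ i′ → j ≡ j′ →
             Functor.F₁ σ p C.≋ Functor.F₁ σ p′
    F₁-app σ p p′ refl refl = C.≈⇒≋ (Functor.F-cong σ _)

  Nerve : SimplicialSet
  Nerve = record
    { simplices = λ n → record
      { Carrier       = Functor (Ordinal n) C
      ; _≈_           = _≈ᶠ_
      ; isEquivalence = record
        { refl  = λ _ → C.≋-refl
        ; sym   = λ eq p → C.≋-sym (eq p)
        ; trans = λ eq eq′ p → C.≋-trans (eq p) (eq′ p)
        }
      }
    ; act      = λ θ σ → σ ∘F ⌜ θ ⌝
    ; act-cong = λ {_} {_} {θ} {θ′} {σ} {τ} θ≗θ′ σ≈τ {i} {j} p → C.≋-trans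
        (σ≈τ (mono θ p))
        (F₁-app τ (mono θ p) (mono θ′ p) (θ≗θ′ i) (θ≗θ′ j))
    ; act-id   = λ _ _ → C.≋-refl
    ; act-∘    = λ _ _ _ _ → C.≋-refl
    }

nerveMap : {C D : Category 1ℓ 0ℓ 0ℓ} → Functor C D →
           SimplicialMap (Nerve C) (Nerve D)
nerveMap {D = D} F = record
  { map      = F ∘F_
  ; map-cong = λ σ≈τ p → Functor.F-≋ F (σ≈τ p)
  ; natural  = λ _ _ _ → Category.≋-refl D
  }

-- A real number is a Dedekind cut, given by its lower set: a proper,
-- inhabited, downward closed set of rationals without a greatest element.
record ℝ : Set₁ where
  no-eta-equality
  field
    Below     : Pred ℚ 0ℓ
    inhabited : ∃ λ p → Below p
    proper    : ∃ λ p → ¬ Below p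
    down      : ∀ {p q} → p ℚ.< q → Below q → Below p
    rounded   : ∀ {p} → Below p → ∃ λ q → p ℚ.< q × Below q

open ℝ public

infix 4 _≤ʳ_ _≈ʳ_ _<ʳ_
infixl 6 _+ʳ_

record _≤ʳ_ (x y : ℝ) : Set where
  constructor ≤ʳ⁺
  field
    ≤ʳ⁻ : ∀ {q} → Below x q → Below y q

open _≤ʳ_ public

record _<ʳ_ (x y : ℝ) : Set where
  constructor <ʳ⁺
  field
    between : ∃ λ q → ¬ Below x q × Below y q

open _<ʳ_ public

_≈ʳ_ : Rel ℝ 0ℓ
x ≈ʳ y = x ≤ʳ y × y ≤ʳ x

≤ʳ-refl : ∀ {x} → x ≤ʳ x
≤ʳ-refl = ≤ʳ⁺ id

≤ʳ-trans : ∀ {x y z} → x ≤ʳ y → y ≤ʳ z → x ≤ʳ z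
≤ʳ-trans p q = ≤ʳ⁺ (≤ʳ⁻ q ∘ ≤ʳ⁻ p)

≈ʳ-isEquivalence : IsEquivalence _≈ʳ_
≈ʳ-isEquivalence = record
  { refl  = ≤ʳ-refl , ≤ʳ-refl
  ; sym   = λ (p , q) → q , p
  ; trans = λ (p , q) (p′ , q′) → ≤ʳ-trans p p′ , ≤ʳ-trans q′ q
  }

fromℚ : ℚ → ℝ
Below     (fromℚ q)     = ℚ._< q
inhabited (fromℚ q)     = q ℚ.- 1ℚ
                        , subst (q ℚ.- 1ℚ ℚ.<_) (ℚₚ.+-identityʳ q)
                                (ℚₚ.+-monoʳ-< q (ℚₚ.negative⁻¹ (ℚ.- 1ℚ)))
proper    (fromℚ q)     = q , ℚₚ.<-irrefl refl
down      (fromℚ q)     = ℚₚ.<-trans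
rounded   (fromℚ q) p<q = let (m , p<m , m<q) = ℚₚ.<-dense p<q in m , p<m , m<q

0ʳ 1ʳ : ℝ
0ʳ = fromℚ 0ℚ
1ʳ = fromℚ 1ℚ

private
  shift : ∀ p q → p ℚ.+ (q ℚ.- p) ≡ q
  shift p q = trans (cong (p ℚ.+_) (ℚₚ.+-comm q (ℚ.- p)))
              (trans (sym (ℚₚ.+-assoc p (ℚ.- p) q))
              (trans (cong (ℚ._+ q) (ℚₚ.+-inverseʳ p)) (ℚₚ.+-identityˡ q)))

  diff<0 : ∀ {p q} → p ℚ.< q → p ℚ.- q ℚ.< 0ℚ
  diff<0 {p} {q} p<q =
    subst (p ℚ.- q ℚ.<_) (ℚₚ.+-inverseʳ q) (ℚₚ.+-monoˡ-< (ℚ.- q) p<q)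

  +neg< : ∀ p {q} → q ℚ.< 0ℚ → p ℚ.+ q ℚ.< p
  +neg< p {q} q<0 = subst (p ℚ.+ q ℚ.<_) (ℚₚ.+-identityʳ p) (ℚₚ.+-monoʳ-< p q<0)

  Below⇒< : ∀ (x : ℝ) {p q} → Below x p → ¬ Below x q → p ℚ.< q
  Below⇒< x {p} {q} b ¬b with ℚₚ.<-cmp p q
  ... | RB.tri< p<q _ _  = p<q
  ... | RB.tri≈ _ refl _ = ⊥-elim (¬b b)
  ... | RB.tri> _ _ q<p  = ⊥-elim (¬b (down x q<p b))

_+ʳ_ : ℝ → ℝ → ℝ
Below (x +ʳ y) s = ∃ λ p → ∃ λ q → Below x p × Below y q × s ≡ p ℚ.+ q
inhabited (x +ʳ y) =
  let (p , bp) = inhabited x ; (q , bq) = inhabited y in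
  p ℚ.+ q , p , q , bp , bq , refl
proper (x +ʳ y) =
  let (u , ¬u) = proper x ; (v , ¬v) = proper y in
  u ℚ.+ v , λ (p , q , bp , bq , eq) →
  ℚₚ.<-irrefl (sym eq) (ℚₚ.+-mono-< (Below⇒< x bp ¬u) (Below⇒< y bq ¬v))
down (x +ʳ y) {s} s<t (p , q , bp , bq , refl) =
  p ℚ.+ (s ℚ.- (p ℚ.+ q)) , q , down x (+neg< p (diff<0 s<t)) bp , bq
  , sym (trans (ℚₚ.+-comm _ q)
        (trans (sym (ℚₚ.+-assoc q p _))
        (trans (cong (ℚ._+ (s ℚ.- (p ℚ.+ q))) (ℚₚ.+-comm q p))
               (shift (p ℚ.+ q) s))))
rounded (x +ʳ y) (p , q , bp , bq , refl) =
  let (p′ , p<p′ , bp′) = rounded x bp in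
  p′ ℚ.+ q , ℚₚ.+-monoˡ-< q p<p′ , p′ , q , bp′ , bq , refl

+ʳ-mono : ∀ {x x′ y y′} → x ≤ʳ x′ → y ≤ʳ y′ → x +ʳ y ≤ʳ x′ +ʳ y′
+ʳ-mono x≤ y≤ = ≤ʳ⁺ λ (p , q , bp , bq , eq) → p , q , ≤ʳ⁻ x≤ bp , ≤ʳ⁻ y≤ bq , eq

private
  +ʳ-comm≤ : ∀ x y → x +ʳ y ≤ʳ y +ʳ x
  +ʳ-comm≤ x y = ≤ʳ⁺ λ (p , q , bp , bq , eq) →
    q , p , bq , bp , trans eq (ℚₚ.+-comm p q)

  +ʳ-identityˡ : ∀ x → 0ʳ +ʳ x ≈ʳ x
  +ʳ-identityˡ x =
      ≤ʳ⁺ (λ { (p , q , p<0 , bq , refl) →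
           down x (subst (ℚ._< q) (ℚₚ.+-comm q p) (+neg< q p<0)) bq })
    , ≤ʳ⁺ (λ {s} bs → let (t , s<t , bt) = rounded x bs in
         s ℚ.- t , t , diff<0 s<t , bt
         , sym (trans (ℚₚ.+-comm (s ℚ.- t) t) (shift t s)))

+ʳ-commutativeMonoid : CommutativeMonoid 1ℓ 0ℓ
+ʳ-commutativeMonoid = record
  { Carrier = ℝ
  ; _≈_     = _≈ʳ_
  ; _∙_     = _+ʳ_
  ; ε       = 0ʳ
  ; isCommutativeMonoid = record
    { isMonoid = record
      { isSemigroup = record
        { isMagma = record
          { isEquivalence = ≈ʳ-isEquivalence
          ; ∙-cong = λ (p , p′) (q , q′) → +ʳ-mono p q , +ʳ-mono p′ q′
          }
        ; assoc = λ x y z →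
              ≤ʳ⁺ (λ { (_ , r , (p , q , bp , bq , refl) , br , eq) →
                   p , q ℚ.+ r , bp , (q , r , bq , br , refl)
                   , trans eq (ℚₚ.+-assoc p q r) })
            , ≤ʳ⁺ (λ { (p , _ , bp , (q , r , bq , br , refl) , eq) →
                   p ℚ.+ q , r , (p , q , bp , bq , refl) , br
                   , trans eq (sym (ℚₚ.+-assoc p q r)) })
        }
      ; identity = +ʳ-identityˡ
                 , λ x → IsEquivalence.trans ≈ʳ-isEquivalence
                           (+ʳ-comm≤ x 0ʳ , +ʳ-comm≤ 0ʳ x) (+ʳ-identityˡ x)
      }
    ; comm = λ x y → +ʳ-comm≤ x y , +ʳ-comm≤ y x
    }
  }

module ∑ʳ where
  open CommutativeMonoid +ʳ-commutativeMonoid public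
  open import Algebra.Properties.CommutativeMonoid.Sum +ʳ-commutativeMonoid public

module SumLemmas {c ℓ} (M : CommutativeMonoid c ℓ) where
  private module M = CommutativeMonoid M
  open M using (Carrier; _≈_; ε) renaming (_∙_ to _+_)
  open import Algebra.Properties.CommutativeMonoid.Sum M public

  sum-ε : ∀ {n} (f : Fin n → Carrier) → (∀ i → f i ≈ ε) → sum f ≈ ε
  sum-ε {zero}  f f≈ε = M.refl
  sum-ε {suc n} f f≈ε =
    M.trans (M.∙-cong (f≈ε zero) (sum-ε (f ∘ suc) (f≈ε ∘ suc))) (M.identityˡ ε)

  sum-single : ∀ {n} (f : Fin n → Carrier) i → (∀ j → j ≢ i → f j ≈ ε) →
               sum f ≈ f i
  sum-single {suc n} f zero off = M.trans
    (M.∙-cong M.refl (sum-ε (f ∘ suc) (λ j → off (suc j) λ ())))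
    (M.identityʳ _)
  sum-single {suc n} f (suc i) off = M.trans
    (M.∙-cong (off zero λ ())
              (sum-single (f ∘ suc) i λ j j≢i → off (suc j) (j≢i ∘ Finₚ.suc-injective)))
    (M.identityˡ _)

  ↦-≡ : ∀ {n} {i j : Fin n} {x} → i ≡ j → (if does (i Finₚ.≟ j) then x else ε) ≡ x
  ↦-≡ {i = i} {j} {x} eq rewrite dec-true (i Finₚ.≟ j) eq = refl

  ↦-≢ : ∀ {n} {i j : Fin n} {x} → i ≢ j → (if does (i Finₚ.≟ j) then x else ε) ≡ ε
  ↦-≢ {i = i} {j} {x} neq rewrite dec-false (i Finₚ.≟ j) neq = refl

  sum-↦ : ∀ {n} (i : Fin n) (x : Carrier) →
          sum (λ j → if does (i Finₚ.≟ j) then x else ε) ≈ x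
  sum-↦ i x = M.trans
    (sum-single _ i λ j j≢i → M.reflexive (↦-≢ (j≢i ∘ sym)))
    (M.reflexive (↦-≡ {i = i} refl))

-- Points live in Set₁, so given excluded middle the predicates and index types in
-- Set₁ account for all subsets and all unions.
record Space (e o : Level) : Set (lsuc (lsuc 1ℓ ⊔ e ⊔ o)) where
  field
    setoid : Setoid 1ℓ e
  open Setoid setoid public renaming (Carrier to Point)
  field
    Open      : Pred (Pred Point 1ℓ) o
    open-resp : ∀ {U} → Open U → U Respects _≈_
    open-≐    : ∀ {U V} → U ≐ V → Open U → Open V
    open-⊤    : Open (λ _ → ⊤)
    open-∩    : ∀ {U V} → Open U → Open V → Open (U ∩ V)
    open-⋃    : {J : Set₁} (U : J → Pred Point 1ℓ) → (∀ j → Open (U j)) →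
                Open (λ x → ∃ λ j → U j x)

record Continuous {e o e′ o′} (X : Space e o) (Y : Space e′ o′)
                  : Set (lsuc 1ℓ ⊔ e ⊔ o ⊔ e′ ⊔ o′) where
  private
    module X = Space X
    module Y = Space Y
  field
    to       : X.Point → Y.Point
    to-cong  : ∀ {x y} → x X.≈ y → to x Y.≈ to y
    preimage : ∀ {U} → Y.Open U → X.Open (U ∘ to)

open Continuous public using (to)

idᶜ : ∀ {e o} {X : Space e o} → Continuous X X
idᶜ = record { to = id ; to-cong = id ; preimage = id }

infixr 9 _∘ᶜ_
_∘ᶜ_ : ∀ {e o e′ o′ e″ o″} {X : Space e o} {Y : Space e′ o′} {Z : Space e″ o″} →
       Continuous Y Z → Continuous X Y → Continuous X Z
g ∘ᶜ f = record
  { to       = G.to ∘ F.to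
  ; to-cong  = G.to-cong ∘ F.to-cong
  ; preimage = F.preimage ∘ G.preimage
  }
  where
  module F = Continuous f
  module G = Continuous g

infixr 2 _×ₜ_
_×ₜ_ : ∀ {e o e′ o′} → Space e o → Space e′ o′ → Space (e ⊔ e′) (lsuc 1ℓ ⊔ o ⊔ o′)
_×ₜ_ {e} {o} {e′} {o′} X Y = record
  { setoid = record
    { Carrier       = X.Point × Y.Point
    ; _≈_           = λ (x , y) (x′ , y′) → x X.≈ x′ × y Y.≈ y′
    ; isEquivalence = record
      { refl  = X.refl , Y.refl
      ; sym   = λ (p , q) → X.sym p , Y.sym q
      ; trans = λ (p , q) (p′ , q′) → X.trans p p′ , Y.trans q q′
      }
    }
  ; Open      = λ U → ∀ x y → U (x , y) → Rectangle U x y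
  ; open-resp = λ oU {(x , y)} {(x′ , y′)} (x≈x′ , y≈y′) u →
      let (V , W , oV , oW , v , w , sub) = oU x y u in
      sub x′ y′ (X.open-resp oV x≈x′ v) (Y.open-resp oW y≈y′ w)
  ; open-≐    = λ (U⊆V , V⊆U) oU x y v →
      let (V , W , oV , oW , v , w , sub) = oU x y (V⊆U v) in
      V , W , oV , oW , v , w , λ x′ y′ v′ w′ → U⊆V (sub x′ y′ v′ w′)
  ; open-⊤    = λ x y _ →
      (λ _ → ⊤) , (λ _ → ⊤) , X.open-⊤ , Y.open-⊤ , tt , tt , λ _ _ _ _ → tt
  ; open-∩    = λ oU oU′ x y (u , u′) →
      let (V  , W  , oV  , oW  , v  , w  , sub ) = oU  x y u
          (V′ , W′ , oV′ , oW′ , v′ , w′ , sub′) = oU′ x y u′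
      in  V ∩ V′ , W ∩ W′ , X.open-∩ oV oV′ , Y.open-∩ oW oW′
          , (v , v′) , (w , w′)
          , λ a b (p , p′) (q , q′) → sub a b p q , sub′ a b p′ q′
  ; open-⋃    = λ U oU x y (j , u) →
      let (V , W , oV , oW , v , w , sub) = oU j x y u in
      V , W , oV , oW , v , w , λ x′ y′ v′ w′ → j , sub x′ y′ v′ w′
  }
  where
  module X = Space X
  module Y = Space Y
  Rectangle : Pred (X.Point × Y.Point) 1ℓ → X.Point → Y.Point →
              Set (lsuc 1ℓ ⊔ o ⊔ o′)
  Rectangle U x y = ∃ λ (V : Pred X.Point 1ℓ) → ∃ λ (W : Pred Y.Point 1ℓ) →
    X.Open V × Y.Open W × V x × W y × (∀ x′ y′ → V x′ → W y′ → U (x′ , y′))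

-- The set A with the topology of a subspace of ℝⁿ, via its coordinate
-- functions: open boxes with rational corners form a basis.
record Box (n : ℕ) : Set where
  field
    lower upper : Fin n → ℚ

_∈ᴮ_ : ∀ {n} → (Fin n → ℝ) → Box n → Set
x ∈ᴮ b = ∀ i → fromℚ (Box.lower b i) <ʳ x i × x i <ʳ fromℚ (Box.upper b i)

module _ {n : ℕ} (A : Setoid 1ℓ 0ℓ)
         (coords : Setoid.Carrier A → Fin n → ℝ)
         (coords-cong : ∀ {x y} → Setoid._≈_ A x y → ∀ i → coords x i ≈ʳ coords y i)
         where
  open Setoid A using (_≈_)

  private
    ∈ᴮ-resp : ∀ b x y → x ≈ y → coords x ∈ᴮ b → coords y ∈ᴮ b
    ∈ᴮ-resp b x y x≈y x∈b i = lo (proj₁ (x∈b i)) , hi (proj₂ (x∈b i))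
      where
      lo : fromℚ (Box.lower b i) <ʳ coords x i → fromℚ (Box.lower b i) <ʳ coords y i
      lo (<ʳ⁺ (p , p≮ , p∈x)) = <ʳ⁺ (p , p≮ , ≤ʳ⁻ (proj₁ (coords-cong x≈y i)) p∈x)
      hi : coords x i <ʳ fromℚ (Box.upper b i) → coords y i <ʳ fromℚ (Box.upper b i)
      hi (<ʳ⁺ (q , q∉x , q<)) = <ʳ⁺ (q , q∉x ∘ ≤ʳ⁻ (proj₂ (coords-cong x≈y i)) , q<)

    below : (x : ℝ) → ∃ λ p → fromℚ p <ʳ x
    below x = let (p , p∈x) = inhabited x in p , <ʳ⁺ (p , ℚₚ.<-irrefl refl , p∈x)

    above : (x : ℝ) → ∃ λ q → x <ʳ fromℚ q
    above x = let (q , q∉x) = proper x in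
      q ℚ.+ 1ℚ , <ʳ⁺ (q , q∉x , subst (ℚ._< q ℚ.+ 1ℚ) (ℚₚ.+-identityʳ q)
                                      (ℚₚ.+-monoʳ-< q (ℚₚ.positive⁻¹ 1ℚ)))

    meet : Box n → Box n → Box n
    meet b c = record
      { lower = λ i → Box.lower b i ℚ.⊔ Box.lower c i
      ; upper = λ i → Box.upper b i ℚ.⊓ Box.upper c i
      }

    meet⁺ : ∀ b c x → x ∈ᴮ b → x ∈ᴮ c → x ∈ᴮ meet b c
    meet⁺ b c x x∈b x∈c i =
        lo (ℚₚ.⊔-sel (Box.lower b i) _) (proj₁ (x∈b i)) (proj₁ (x∈c i))
      , hi (ℚₚ.⊓-sel (Box.upper b i) _) (proj₂ (x∈b i)) (proj₂ (x∈c i))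
      where
      lo : ∀ {l l′ m} → m ≡ l ⊎ m ≡ l′ → fromℚ l <ʳ x i → fromℚ l′ <ʳ x i → fromℚ m <ʳ x i
      lo (inj₁ refl) l l′ = l
      lo (inj₂ refl) l l′ = l′
      hi : ∀ {u u′ m} → m ≡ u ⊎ m ≡ u′ → x i <ʳ fromℚ u → x i <ʳ fromℚ u′ → x i <ʳ fromℚ m
      hi (inj₁ refl) u u′ = u
      hi (inj₂ refl) u u′ = u′

    meet⁻ : ∀ b c x → x ∈ᴮ meet b c → x ∈ᴮ b × x ∈ᴮ c
    meet⁻ b c x x∈ =
        (λ i → lo (ℚₚ.p≤p⊔q (Box.lower b i) _) (proj₁ (x∈ i))
             , hi (ℚₚ.p⊓q≤p (Box.upper b i) _) (proj₂ (x∈ i)))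
      , (λ i → lo (ℚₚ.p≤q⊔p (Box.lower b i) _) (proj₁ (x∈ i))
             , hi (ℚₚ.p⊓q≤q (Box.upper b i) _) (proj₂ (x∈ i)))
      where
      lo : ∀ {l m i} → l ℚ.≤ m → fromℚ m <ʳ x i → fromℚ l <ʳ x i
      lo l≤m (<ʳ⁺ (p , p≮ , p∈)) = <ʳ⁺ (p , (λ p<l → p≮ (ℚₚ.<-≤-trans p<l l≤m)) , p∈)
      hi : ∀ {u m i} → m ℚ.≤ u → x i <ʳ fromℚ m → x i <ʳ fromℚ u
      hi m≤u (<ʳ⁺ (q , q∉ , q<)) = <ʳ⁺ (q , q∉ , ℚₚ.<-≤-trans q< m≤u)

  subspace : Space 0ℓ 1ℓ
  subspace = record
    { setoid    = A
    ; Open      = λ U → ∀ x → U x →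
                  ∃ λ b → coords x ∈ᴮ b × (∀ y → coords y ∈ᴮ b → U y)
    ; open-resp = λ oU {x} {y} x≈y u →
        let (b , x∈b , sub) = oU x u in sub y (∈ᴮ-resp b x y x≈y x∈b)
    ; open-≐    = λ (U⊆V , V⊆U) oU x v →
        let (b , x∈b , sub) = oU x (V⊆U v) in b , x∈b , λ y → U⊆V ∘ sub y
    ; open-⊤    = λ x _ →
        record { lower = λ i → proj₁ (below (coords x i))
               ; upper = λ i → proj₁ (above (coords x i)) }
        , (λ i → proj₂ (below (coords x i)) , proj₂ (above (coords x i)))
        , λ _ _ → tt
    ; open-∩    = λ oU oV x (u , v) →
        let (b , x∈b , sub) = oU x u ; (c , x∈c , sub′) = oV x v in
        meet b c , meet⁺ b c (coords x) x∈b x∈c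
        , λ y y∈ → let (y∈b , y∈c) = meet⁻ b c (coords y) y∈ in sub y y∈b , sub′ y y∈c
    ; open-⋃    = λ U oU x (j , u) →
        let (b , x∈b , sub) = oU j x u in b , x∈b , λ y y∈b → j , sub y y∈b
    }

record UnitPoint : Set₁ where
  constructor unitPoint
  field
    value : ℝ
    0≤    : 0ʳ ≤ʳ value
    ≤1    : value ≤ʳ 1ʳ

open UnitPoint public using (value)

𝕀 : Space 0ℓ 1ℓ
𝕀 = subspace {1}
  (record { Carrier       = UnitPoint
          ; _≈_           = λ s t → value s ≈ʳ value t
          ; isEquivalence = record
            { refl = ∑ʳ.refl ; sym = ∑ʳ.sym ; trans = ∑ʳ.trans } })
  (λ t _ → value t) (λ eq _ → eq)

private
  0≤1 : 0ʳ ≤ʳ 1ʳ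
  0≤1 = ≤ʳ⁺ λ q<0 → ℚₚ.<-trans q<0 (ℚₚ.positive⁻¹ 1ℚ)

0ᴵ 1ᴵ : UnitPoint
0ᴵ = unitPoint 0ʳ ≤ʳ-refl 0≤1
1ᴵ = unitPoint 1ʳ 0≤1 ≤ʳ-refl

record Homotopy {e o e′ o′} {X : Space e o} {Y : Space e′ o′}
                (f g : Continuous X Y) : Set (lsuc 1ℓ ⊔ e ⊔ o ⊔ e′ ⊔ o′) where
  field
    H   : Continuous (X ×ₜ 𝕀) Y
    at0 : ∀ x → Space._≈_ Y (to H (x , 0ᴵ)) (to f x)
    at1 : ∀ x → Space._≈_ Y (to H (x , 1ᴵ)) (to g x)

record IsHomotopyEquivalence {e o e′ o′} {X : Space e o} {Y : Space e′ o′}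
                             (f : Continuous X Y)
                             : Set (lsuc 1ℓ ⊔ e ⊔ o ⊔ e′ ⊔ o′) where
  field
    g   : Continuous Y X
    g∘f : Homotopy (g ∘ᶜ f) idᶜ
    f∘g : Homotopy (f ∘ᶜ g) idᶜ

record SimplexPoint (n : ℕ) : Set₁ where
  field
    coord    : Fin (suc n) → ℝ
    coord≥0  : ∀ i → 0ʳ ≤ʳ coord i
    coord-∑  : ∑ʳ.sum coord ≈ʳ 1ʳ

open SimplexPoint public using (coord)

Δᵗ : ℕ → Space 0ℓ 1ℓ
Δᵗ n = subspace
  (record { Carrier       = SimplexPoint n
          ; _≈_           = λ s t → ∀ i → coord s i ≈ʳ coord t i
          ; isEquivalence = record
            { refl  = λ _ → ∑ʳ.refl
            ; sym   = λ eq i → ∑ʳ.sym (eq i)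
            ; trans = λ eq eq′ i → ∑ʳ.trans (eq i) (eq′ i) } })
  coord id

private
  module Σʳ = SumLemmas +ʳ-commutativeMonoid

  sum≥0 : ∀ {n} (f : Fin n → ℝ) → (∀ i → 0ʳ ≤ʳ f i) → 0ʳ ≤ʳ ∑ʳ.sum f
  sum≥0 {zero}  f f≥0 = ≤ʳ-refl
  sum≥0 {suc n} f f≥0 = ≤ʳ-trans (proj₂ (+ʳ-identityˡ 0ʳ))
    (+ʳ-mono (f≥0 zero) (sum≥0 (f ∘ suc) (f≥0 ∘ suc)))

-- The affine map sending vertex i to vertex θ i.
push : ∀ {m n} → m →Δ n → SimplexPoint m → SimplexPoint n
push {m} {n} θ t = record
  { coord   = λ j → ∑ʳ.sum λ i → part i j
  ; coord≥0 = λ j → sum≥0 _ λ i → part≥0 i j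
  ; coord-∑ = ∑ʳ.trans (∑ʳ.sym (∑ʳ.∑-comm part))
             (∑ʳ.trans (∑ʳ.sum-cong-≋ λ i → Σʳ.sum-↦ (app θ i) (coord t i))
                       (SimplexPoint.coord-∑ t))
  }
  where
  part : Fin (suc m) → Fin (suc n) → ℝ
  part i j = if does (app θ i Finₚ.≟ j) then coord t i else 0ʳ
  part≥0 : ∀ i j → 0ʳ ≤ʳ part i j
  part≥0 i j with does (app θ i Finₚ.≟ j)
  ... | true  = SimplexPoint.coord≥0 t i
  ... | false = ≤ʳ-refl

module Realization (X : SimplicialSet) where
  open SimplicialSet X

  Cell : Set₁
  Cell = Σ ℕ λ n → S.Carrier n × SimplexPoint n

  data Glue : Rel Cell 1ℓ where
    glue : ∀ {m n} (θ : m →Δ n) x t → Glue (m , act θ x , t) (n , x , push θ t)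
    same : ∀ {n x y s t} → S._≈_ n x y → Space._≈_ (Δᵗ n) s t →
           Glue (n , x , s) (n , y , t)

  -- The quotient topology: a subset is open when it is saturated and its
  -- preimage in each {x} × Δⁿ is open.
  ∣_∣ˢ : Space 1ℓ 1ℓ
  ∣_∣ˢ = record
    { setoid    = EqC.setoid Glue
    ; Open      = λ U → U Respects EqClosure Glue
                      × (∀ {n} x → Space.Open (Δᵗ n) λ t → U (n , x , t))
    ; open-resp = proj₁
    ; open-≐    = λ (U⊆V , V⊆U) (resp , oU) →
        (λ eq → U⊆V ∘ resp eq ∘ V⊆U)
        , λ {n} x → Space.open-≐ (Δᵗ n) (U⊆V , V⊆U) (oU x)
    ; open-⊤    = _ , λ {n} x → Space.open-⊤ (Δᵗ n)
    ; open-∩    = λ (resp , oU) (resp′ , oV) →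
        (λ eq (u , v) → resp eq u , resp′ eq v)
        , λ {n} x → Space.open-∩ (Δᵗ n) (oU x) (oV x)
    ; open-⋃    = λ U oU →
        (λ eq (j , u) → j , proj₁ (oU j) eq u)
        , λ {n} x → Space.open-⋃ (Δᵗ n) _ λ j → proj₂ (oU j) x
    }

open Realization public using (∣_∣ˢ)

realize : ∀ {X Y} → SimplicialMap X Y → Continuous ∣ X ∣ˢ ∣ Y ∣ˢ
realize {X} {Y} f = record
  { to       = cell
  ; to-cong  = cell-cong
  ; preimage = λ (resp , oU) →
      (λ eq → resp (cell-cong eq)) , λ x → oU (F.map x)
  }
  where
  module X = Realization X
  module Y = Realization Y
  module F = SimplicialMap f

  cell : X.Cell → Y.Cell
  cell (n , x , t) = n , F.map x , t

  glue⇒ : ∀ {c d} → X.Glue c d → EqClosure Y.Glue (cell c) (cell d)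
  glue⇒ (X.glue {m} {n} θ x t) =
    EqC.transitive Y.Glue
      (EqC.return (Y.same (F.natural θ x)
                          (Space.refl (Δᵗ m) {t})))
      (EqC.return (Y.glue θ (F.map x) t))
  glue⇒ (X.same {s = s} {t} x≈y s≈t) = EqC.return (Y.same {s = s} {t} (F.map-cong x≈y) s≈t)

  cell-cong : ∀ {c d} → EqClosure X.Glue c d → EqClosure Y.Glue (cell c) (cell d)
  cell-cong = EqC.gfold (EqC.isEquivalence Y.Glue) cell glue⇒

B : Category 1ℓ 0ℓ 0ℓ → Space 1ℓ 1ℓ
B C = ∣ Nerve C ∣ˢ

B₁ : {C D : Category 1ℓ 0ℓ 0ℓ} → Functor C D → Continuous (B C) (B D)
B₁ F = realize (nerveMap F)

𝔽₂ = Boolₚ.xor-∧-commutativeRing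

VectorSpace : Set₁
VectorSpace = Module 𝔽₂ 0ℓ 0ℓ

module Lin (V : VectorSpace) where
  open Module V public
  module ∑ = SumLemmas +ᴹ-commutativeMonoid

  comb : ∀ {n} → (Fin n → Bool) → (Fin n → Carrierᴹ) → Carrierᴹ
  comb c v = ∑.sum λ i → c i *ₗ v i

  LinearlyIndependent : Pred (Pred Carrierᴹ 0ℓ) 0ℓ
  LinearlyIndependent P =
    ∀ {k} (v : Fin k → Carrierᴹ) → (∀ i → P (v i)) → Injective _≡_ _≈ᴹ_ v →
    ∀ c → comb c v ≈ᴹ 0ᴹ → ∀ i → c i ≡ false

  Spans : Pred (Pred Carrierᴹ 0ℓ) 0ℓ
  Spans P = ∀ v → ∃ λ k → ∃ λ (u : Fin k → Carrierᴹ) → ∃ λ c →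
            (∀ i → P (u i)) × comb c u ≈ᴹ v

𝔽₂^ : ℕ → VectorSpace
𝔽₂^ r = record
  { Carrierᴹ = Fin r → Bool
  ; _≈ᴹ_     = _≗_
  ; _+ᴹ_     = λ c d i → c i xor d i
  ; _*ₗ_     = λ a c i → a ∧ c i
  ; _*ᵣ_     = λ c a i → a ∧ c i
  ; 0ᴹ       = λ _ → false
  ; -ᴹ_      = id
  ; isModule = IsModuleFromLeft.isModule record { isLeftModule = isLeft }
  }
  where
  isLeft : IsLeftModule _ _ _ _ _ _
  isLeft = record
    { isLeftSemimodule = record
      { +ᴹ-isCommutativeMonoid = record
        { isMonoid = record
          { isSemigroup = record
            { isMagma = record
              { isEquivalence = record
                { refl  = λ _ → refl
                ; sym   = λ p i → sym (p i)
                ; trans = λ p q i → trans (p i) (q i)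
                }
              ; ∙-cong = λ p q i → cong₂ _xor_ (p i) (q i)
              }
            ; assoc = λ a b c i → Boolₚ.xor-assoc (a i) (b i) (c i)
            }
          ; identity = (λ _ _ → refl) , λ c i → Boolₚ.xor-identityʳ (c i)
          }
        ; comm = λ c d i → Boolₚ.xor-comm (c i) (d i)
        }
      ; isPreleftSemimodule = record
        { *ₗ-cong      = λ p q i → cong₂ _∧_ p (q i)
        ; *ₗ-zeroˡ     = λ _ _ → refl
        ; *ₗ-distribʳ  = λ c a b i → Boolₚ.∧-distribʳ-xor (c i) a b
        ; *ₗ-identityˡ = λ _ _ → refl
        ; *ₗ-assoc     = λ a b c i → Boolₚ.∧-assoc a b (c i)
        ; *ₗ-zeroʳ     = λ a _ → Boolₚ.∧-zeroʳ a
        ; *ₗ-distribˡ  = λ a c d i → Boolₚ.∧-distribˡ-xor a (c i) (d i)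
        }
      }
    ; -ᴹ‿cong    = id
    ; -ᴹ‿inverse = (λ c i → Boolₚ.xor-same (c i)) , λ c i → Boolₚ.xor-same (c i)
    }

record _≅_ (V W : VectorSpace) : Set where
  private
    module V = Module V
    module W = Module W
  open ModuleMorphisms V.rawModule W.rawModule
  field
    to    : V.Carrierᴹ → W.Carrierᴹ
    isIso : IsModuleIsomorphism to
  open IsModuleIsomorphism isIso public
    using (injective; surjective; ⟦⟧-cong; +ᴹ-homo; *ₗ-homo; *ᵣ-homo; 0ᴹ-homo; -ᴹ-homo)

module _ {V W : VectorSpace} where
  private
    module V = Module V
    module W = Module W
    open import Algebra.Properties.AbelianGroup W.+ᴹ-abelianGroup
      using (identityˡ-unique; inverseˡ-unique)

  mk≅ : (f : V.Carrierᴹ → W.Carrierᴹ) →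
        (∀ {x y} → x V.≈ᴹ y → f x W.≈ᴹ f y) →
        (∀ x y → f (x V.+ᴹ y) W.≈ᴹ f x W.+ᴹ f y) →
        (∀ a x → f (a V.*ₗ x) W.≈ᴹ a W.*ₗ f x) →
        (∀ x → f x W.≈ᴹ W.0ᴹ → x V.≈ᴹ V.0ᴹ) →
        (∀ y → ∃ λ x → f x W.≈ᴹ y) →
        V ≅ W
  mk≅ f f-cong f-+ f-* f-ker f-sur = record
    { to    = f
    ; isIso = record
      { isModuleMonomorphism = record
        { isModuleHomomorphism = record
          { isBimoduleHomomorphism = record
            { +ᴹ-isGroupHomomorphism = record
              { isMonoidHomomorphism = record
                { isMagmaHomomorphism = record
                  { isRelHomomorphism = record { cong = f-cong }
                  ; homo              = f-+
                  }
                ; ε-homo = f-0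
                }
              ; ⁻¹-homo = f-neg
              }
            ; *ₗ-homo = f-*
            ; *ᵣ-homo = λ a x → W.≈ᴹ-trans (f-cong (V.≈ᴹ-sym (V.*ₗ-*ᵣ-coincident a x)))
                        (W.≈ᴹ-trans (f-* a x) (W.*ₗ-*ᵣ-coincident a (f x)))
            }
          }
        ; injective = f-inj
        }
      ; surjective = λ y → let (x , fx≈y) = f-sur y in
                     x , λ z≈x → W.≈ᴹ-trans (f-cong z≈x) fx≈y
      }
    }
    where
    f-0 : f V.0ᴹ W.≈ᴹ W.0ᴹ
    f-0 = identityˡ-unique _ _
      (W.≈ᴹ-trans (W.≈ᴹ-sym (f-+ V.0ᴹ V.0ᴹ)) (f-cong (V.+ᴹ-identityˡ V.0ᴹ)))
    f-neg : ∀ x → f (V.-ᴹ x) W.≈ᴹ W.-ᴹ f x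
    f-neg x = inverseˡ-unique _ _
      (W.≈ᴹ-trans (W.≈ᴹ-sym (f-+ (V.-ᴹ x) x))
      (W.≈ᴹ-trans (f-cong (V.-ᴹ‿inverseˡ x)) f-0))
    f-inj : Injective V._≈ᴹ_ W._≈ᴹ_ f
    f-inj {x} {y} fx≈fy = V.≈ᴹ-trans (V.≈ᴹ-sym (V.+ᴹ-identityʳ x))
      (V.≈ᴹ-trans (V.+ᴹ-congˡ (V.≈ᴹ-sym (V.-ᴹ‿inverseˡ y)))
      (V.≈ᴹ-trans (V.≈ᴹ-sym (V.+ᴹ-assoc x (V.-ᴹ y) y))
      (V.≈ᴹ-trans (V.+ᴹ-congʳ (f-ker _
        (W.≈ᴹ-trans (f-+ x (V.-ᴹ y))
        (W.≈ᴹ-trans (W.+ᴹ-cong fx≈fy (f-neg y)) (W.-ᴹ‿inverseʳ (f y))))))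
      (V.+ᴹ-identityˡ y))))

≅-refl : ∀ {V} → V ≅ V
≅-refl {V} = record
  { to = id ; isIso = IdM.isModuleIsomorphism rawModule ≈ᴹ-refl }
  where open Module V

infixr 9 _∘≅_
_∘≅_ : ∀ {U V W} → V ≅ W → U ≅ V → U ≅ W
_∘≅_ {U} {V} {W} g f = record
  { to    = _≅_.to g ∘ _≅_.to f
  ; isIso = CompM.isModuleIsomorphism (Module.≈ᴹ-trans W) (_≅_.isIso f) (_≅_.isIso g)
  }

≅-sym : ∀ {V W} → V ≅ W → W ≅ V
≅-sym {V} {W} f = mk≅ g
  (λ {x} {y} x≈y → F.injective (W.≈ᴹ-trans (f∘g x) (W.≈ᴹ-trans x≈y (W.≈ᴹ-sym (f∘g y)))))
  (λ x y → F.injective (W.≈ᴹ-trans (f∘g _) (W.≈ᴹ-sym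
    (W.≈ᴹ-trans (F.+ᴹ-homo _ _) (W.+ᴹ-cong (f∘g x) (f∘g y))))))
  (λ a x → F.injective (W.≈ᴹ-trans (f∘g _) (W.≈ᴹ-sym
    (W.≈ᴹ-trans (F.*ₗ-homo a _) (W.*ₗ-congˡ (f∘g x))))))
  (λ x gx≈0 → W.≈ᴹ-trans (W.≈ᴹ-sym (f∘g x)) (W.≈ᴹ-trans (F.⟦⟧-cong gx≈0) F.0ᴹ-homo))
  (λ y → F.to y , F.injective (f∘g (F.to y)))
  where
  module V = Module V
  module W = Module W
  module F = _≅_ f
  g : W.Carrierᴹ → V.Carrierᴹ
  g y = proj₁ (F.surjective y)
  f∘g : ∀ y → F.to (g y) W.≈ᴹ y
  f∘g y = proj₂ (F.surjective y) V.≈ᴹ-refl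

_≈ˡ_ : ∀ {V W} → Rel (V ≅ W) 0ℓ
_≈ˡ_ {W = W} f g = ∀ x → _≅_.to f x ≈ᴹ _≅_.to g x where open Module W

𝒢ℓ : ℕ → Category 1ℓ 0ℓ 0ℓ
𝒢ℓ r = record
  { Obj       = ∃ λ V → 𝔽₂^ r ≅ V
  ; Hom       = λ (V , _) (W , _) → V ≅ W
  ; _≈_       = _≈ˡ_
  ; idₕ       = ≅-refl
  ; _∙_       = _∘≅_
  ; ≈-equiv   = λ {_} {(W , _)} → let open Module W in record
    { refl  = λ _ → ≈ᴹ-refl
    ; sym   = λ p x → ≈ᴹ-sym (p x)
    ; trans = λ p q x → ≈ᴹ-trans (p x) (q x)
    }
  ; ∙-cong    = λ {_} {_} {(W , _)} {g} {_} {_} {f′} p q x →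
      Module.≈ᴹ-trans W (_≅_.⟦⟧-cong g (q x)) (p (_≅_.to f′ x))
  ; identityˡ = λ {_} {(W , _)} _ _ → Module.≈ᴹ-refl W
  ; identityʳ = λ {_} {(W , _)} _ _ → Module.≈ᴹ-refl W
  ; assoc     = λ {_} {_} {_} {(W , _)} _ _ _ _ → Module.≈ᴹ-refl W
  }

GL : ℕ → Group 0ℓ 0ℓ
GL r = record
  { Carrier = 𝔽₂^ r ≅ 𝔽₂^ r
  ; _≈_     = _≈ˡ_
  ; _∙_     = _∘≅_
  ; ε       = ≅-refl
  ; _⁻¹     = ≅-sym
  ; isGroup = record
    { isMonoid = record
      { isSemigroup = record
        { isMagma = record
          { isEquivalence = C.≈-equiv {𝔽₂ʳ} {𝔽₂ʳ}
          ; ∙-cong        = λ {g} {g′} {f} {f′} →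
              C.∙-cong {𝔽₂ʳ} {𝔽₂ʳ} {𝔽₂ʳ} {g} {g′} {f} {f′}
          }
        ; assoc = C.assoc {𝔽₂ʳ} {𝔽₂ʳ} {𝔽₂ʳ} {𝔽₂ʳ}
        }
      ; identity = C.identityˡ {𝔽₂ʳ} {𝔽₂ʳ} , C.identityʳ {𝔽₂ʳ} {𝔽₂ʳ}
      }
    ; inverse = (λ f x → _≅_.injective f (f∘f⁻¹ f (_≅_.to f x))) , f∘f⁻¹
    ; ⁻¹-cong = λ {f} {g} f≈g x → _≅_.injective f λ i →
        trans (f∘f⁻¹ f x i)
        (sym (trans (f≈g (_≅_.to (≅-sym g) x) i) (f∘f⁻¹ g x i)))
    }
  }
  where
  module C = Category (𝒢ℓ r)
  𝔽₂ʳ : C.Obj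
  𝔽₂ʳ = 𝔽₂^ r , ≅-refl
  f∘f⁻¹ : ∀ (f : 𝔽₂^ r ≅ 𝔽₂^ r) x → _≅_.to f (_≅_.to (≅-sym f) x) ≗ x
  f∘f⁻¹ f x = proj₂ (_≅_.surjective f x) λ _ → refl

GL↪𝒢ℓ : ∀ r → Functor (oneObject (GL r)) (𝒢ℓ r)
GL↪𝒢ℓ r = record
  { F₀     = λ _ → 𝔽₂^ r , ≅-refl
  ; F₁     = id
  ; F-cong = id
  ; F-id   = λ _ _ → refl
  ; F-∙    = λ _ _ _ _ → refl
  }

-- Every finite ground set is in bijection with some Fin n.  Classically indep?
-- is no restriction; it lets H₁(M; 𝔽₂) be computed without excluded middle.
record Matroid (n : ℕ) : Set₁ where
  field
    Indep      : Pred (Subset n) 0ℓ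
    indep?     : Decidable Indep
    ∅-indep    : Indep ∅
    hereditary : ∀ {S T} → T ⊆ S → Indep S → Indep T
    augment    : ∀ {S T} → Indep S → Indep T → ∣ S ∣ ℕ.< ∣ T ∣ →
                 ∃ λ e → e ∈ T × e ∉ S × Indep (S ∪ ⁅ e ⁆)

  Circuit : Pred (Subset n) 0ℓ
  Circuit C = ¬ Indep C × (∀ {D} → D ⊂ C → Indep D)

  HasRank : ℕ → Set
  HasRank r = (∃ λ I → Indep I × ∣ I ∣ ≡ r) × (∀ {I} → Indep I → ∣ I ∣ ℕ.≤ r)

record Representation {n} (M : Matroid n) : Set₁ where
  open Matroid M
  field
    V    : VectorSpace
    -- As for indep?, automatic classically.
    _≟ᴹ_ : RB.Decidable (Module._≈ᴹ_ V)
  open Lin V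
  field
    ρ : Fin n → Carrierᴹ

  Image : Subset n → Pred Carrierᴹ 0ℓ
  Image S v = ∃ λ e → e ∈ S × ρ e ≈ᴹ v

  InjectiveOn : Subset n → Set
  InjectiveOn S = ∀ {e e′} → e ∈ S → e′ ∈ S → ρ e ≈ᴹ ρ e′ → e ≡ e′

  field
    indep⇔ : ∀ S → Indep S ⇔ (InjectiveOn S × LinearlyIndependent (Image S))
    spans  : Spans (λ v → ∃ λ e → ρ e ≈ᴹ v)

infix 8 _[_]
_[_] : ∀ {m n} → (Fin m → Fin n) → Subset m → Subset n
f [ S ] = tabulate λ j → does (Finₚ.any? λ i → (i Subₚ.∈? S) ×-dec (f i Finₚ.≟ j))

record _↪_ {m n} (M : Matroid m) (N : Matroid n) : Set where
  private
    module M = Matroid M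
    module N = Matroid N
  field
    fun       : Fin m → Fin n
    injective : Injective _≡_ _≡_ fun
    indep⇔    : ∀ S → M.Indep S ⇔ N.Indep (fun [ S ])

open _↪_ public using (fun)

private
  bool∈ : ∀ {n} {S : Subset n} {i} → lookup S i ≡ true → i ∈ S
  bool∈ {S = S} {i} eq = Vecₚ.lookup⇒[]= i S eq

  ∈bool : ∀ {n} {S : Subset n} {i} → i ∈ S → lookup S i ≡ true
  ∈bool = Vecₚ.[]=⇒lookup

  ∉bool : ∀ {n} {S : Subset n} {i} → i ∉ S → lookup S i ≡ false
  ∉bool {S = S} {i} i∉S with lookup S i in eq
  ... | true  = contradiction (bool∈ eq) i∉S
  ... | false = refl

  bool∉ : ∀ {n} {S : Subset n} {i} → lookup S i ≡ false → i ∉ S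
  bool∉ eq i∈S with () ← trans (sym (∈bool i∈S)) eq

  ext⊆ : ∀ {n} {S T : Subset n} → S ⊆ T → T ⊆ S → S ≡ T
  ext⊆ = Subₚ.⊆-antisym

module _ {m n} (f : Fin m → Fin n) where

  ∈-image⁻ : ∀ S {j} → j ∈ f [ S ] → ∃ λ i → i ∈ S × f i ≡ j
  ∈-image⁻ S {j} j∈ with Finₚ.any? (λ i → (i Subₚ.∈? S) ×-dec (f i Finₚ.≟ j)) in eq
  ... | yes p = p
  ... | no  _ with () ← trans (sym (∈bool j∈))
                        (trans (Vecₚ.lookup∘tabulate _ j) (cong does eq))

  ∈-image⁺ : ∀ {S i} → i ∈ S → f i ∈ f [ S ]
  ∈-image⁺ {S} {i} i∈S = bool∈ (trans (Vecₚ.lookup∘tabulate _ (f i))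
    (dec-true (Finₚ.any? λ k → (k Subₚ.∈? S) ×-dec (f k Finₚ.≟ f i)) (i , i∈S , refl)))

image-id : ∀ {n} (S : Subset n) → id [ S ] ≡ S
image-id S = ext⊆
  (λ j∈ → let (_ , i∈S , eq) = ∈-image⁻ id S j∈ in subst (_∈ S) eq i∈S)
  (∈-image⁺ id)

image-∘ : ∀ {l m n} (g : Fin m → Fin n) (f : Fin l → Fin m) S →
          (g ∘ f) [ S ] ≡ g [ f [ S ] ]
image-∘ g f S = ext⊆
  (λ k∈ → let (_ , i∈S , eq) = ∈-image⁻ (g ∘ f) S k∈ in
    subst (_∈ _) eq (∈-image⁺ g (∈-image⁺ f i∈S)))
  (λ k∈ → let (_ , j∈ , eq) = ∈-image⁻ g (f [ S ]) k∈
              (_ , i∈S , eq′) = ∈-image⁻ f S j∈ in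
    subst (_∈ _) (trans (cong g eq′) eq) (∈-image⁺ (g ∘ f) i∈S))

↪-id : ∀ {n} {M : Matroid n} → M ↪ M
↪-id {M = M} = record
  { fun       = id
  ; injective = id
  ; indep⇔    = λ S → mk⇔ (subst Indep (sym (image-id S))) (subst Indep (image-id S))
  }
  where open Matroid M

infixr 9 _∘↪_
_∘↪_ : ∀ {l m n} {L : Matroid l} {M : Matroid m} {N : Matroid n} →
       M ↪ N → L ↪ M → L ↪ N
_∘↪_ {N = N} g f = record
  { fun       = G.fun ∘ F.fun
  ; injective = F.injective ∘ G.injective
  ; indep⇔    = λ S →
      let module f⇔ = Equivalence (F.indep⇔ S)
          module g⇔ = Equivalence (G.indep⇔ (F.fun [ S ]))
          eq = image-∘ G.fun F.fun S
      in  mk⇔ (subst Indep (sym eq) ∘ g⇔.to ∘ f⇔.to)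
              (f⇔.from ∘ g⇔.from ∘ subst Indep eq)
  }
  where
  open Matroid N
  module F = _↪_ f
  module G = _↪_ g

record BinaryMatroid (r : ℕ) : Set₁ where
  field
    size    : ℕ
    matroid : Matroid size
    binary  : Representation matroid
    rank    : Matroid.HasRank matroid r

ℳ : ℕ → Category 1ℓ 0ℓ 0ℓ
ℳ r = record
  { Obj       = BinaryMatroid r
  ; Hom       = λ M N → matroid M ↪ matroid N
  ; _≈_       = λ f g → fun f ≗ fun g
  ; idₕ       = ↪-id
  ; _∙_       = _∘↪_
  ; ≈-equiv   = record
    { refl  = λ _ → refl
    ; sym   = λ p x → sym (p x)
    ; trans = λ p q x → trans (p x) (q x)
    }
  ; ∙-cong    = λ {_} {_} {_} {g} {_} {_} {f′} p q x →
      trans (cong (fun g) (q x)) (p (fun f′ x))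
  ; identityˡ = λ _ _ → refl
  ; identityʳ = λ _ _ → refl
  ; assoc     = λ _ _ _ _ → refl
  }
  where open BinaryMatroid

infixl 6 _⊞_
data Word (X : Set) : Set where
  gen : X → Word X
  _⊞_ : Word X → Word X → Word X
  𝟘   : Word X
  ⊟_  : Word X → Word X

data Rewrite {X : Set} (R : Rel (Word X) 0ℓ) : Rel (Word X) 0ℓ where
  rel       : ∀ {u v} → R u v → Rewrite R u v
  ~-refl    : ∀ {u} → Rewrite R u u
  ~-sym     : ∀ {u v} → Rewrite R u v → Rewrite R v u
  ~-trans   : ∀ {u v w} → Rewrite R u v → Rewrite R v w → Rewrite R u w
  ⊞-cong    : ∀ {u u′ v v′} → Rewrite R u u′ → Rewrite R v v′ →
              Rewrite R (u ⊞ v) (u′ ⊞ v′)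
  ⊟-cong    : ∀ {u v} → Rewrite R u v → Rewrite R (⊟ u) (⊟ v)
  ⊞-assoc   : ∀ u v w → Rewrite R ((u ⊞ v) ⊞ w) (u ⊞ (v ⊞ w))
  ⊞-comm    : ∀ u v → Rewrite R (u ⊞ v) (v ⊞ u)
  ⊞-idˡ     : ∀ u → Rewrite R (𝟘 ⊞ u) u
  ⊟-inverse : ∀ u → Rewrite R ((⊟ u) ⊞ u) 𝟘

⟨_∣_⟩ : (X : Set) → Rel (Word X) 0ℓ → AbelianGroup 0ℓ 0ℓ
⟨ X ∣ R ⟩ = record
  { Carrier = Word X
  ; _≈_     = Rewrite R
  ; _∙_     = _⊞_
  ; ε       = 𝟘
  ; _⁻¹     = ⊟_
  ; isAbelianGroup = record
    { isGroup = record
      { isMonoid = record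
        { isSemigroup = record
          { isMagma = record
            { isEquivalence = record
              { refl = ~-refl ; sym = ~-sym ; trans = ~-trans }
            ; ∙-cong        = ⊞-cong
            }
          ; assoc = ⊞-assoc
          }
        ; identity = ⊞-idˡ , λ u → ~-trans (⊞-comm u 𝟘) (⊞-idˡ u)
        }
      ; inverse = ⊟-inverse , λ u → ~-trans (⊞-comm u (⊟ u)) (⊟-inverse u)
      ; ⁻¹-cong = ⊟-cong
      }
    ; comm = ⊞-comm
    }
  }

module Extend {X : Set} (A : AbelianGroup 0ℓ 0ℓ) (f : X → AbelianGroup.Carrier A) where
  private module A = AbelianGroup A
  open A using (Carrier; _≈_; _∙_; _⁻¹; ε)

  extend : Word X → Carrier
  extend (gen x) = f x
  extend (u ⊞ v) = extend u ∙ extend v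
  extend 𝟘       = ε
  extend (⊟ u)   = extend u ⁻¹

  module _ {R : Rel (Word X) 0ℓ} (resp : ∀ {u v} → R u v → extend u ≈ extend v) where
    extend-cong : ∀ {u v} → Rewrite R u v → extend u ≈ extend v
    extend-cong (rel r)         = resp r
    extend-cong ~-refl          = A.refl
    extend-cong (~-sym p)       = A.sym (extend-cong p)
    extend-cong (~-trans p q)   = A.trans (extend-cong p) (extend-cong q)
    extend-cong (⊞-cong p q)    = A.∙-cong (extend-cong p) (extend-cong q)
    extend-cong (⊟-cong p)      = A.⁻¹-cong (extend-cong p)
    extend-cong (⊞-assoc u v w) = A.assoc _ _ _
    extend-cong (⊞-comm u v)    = A.comm _ _
    extend-cong (⊞-idˡ u)       = A.identityˡ _
    extend-cong (⊟-inverse u)   = A.inverseˡ _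

-- The tensor product over ℤ; the pure tensor a ⊗ b is gen (a , b).
module _ (A : AbelianGroup 0ℓ 0ℓ) where
  private module A = AbelianGroup A

  data Bilinear : Rel (Word (A.Carrier × Bool)) 0ℓ where
    ⊗-cong : ∀ {a a′ b} → a A.≈ a′ → Bilinear (gen (a , b)) (gen (a′ , b))
    ⊗-+ˡ   : ∀ a a′ b → Bilinear (gen (a A.∙ a′ , b)) (gen (a , b) ⊞ gen (a′ , b))
    ⊗-+ʳ   : ∀ a b b′ → Bilinear (gen (a , b xor b′)) (gen (a , b) ⊞ gen (a , b′))

  Tensor : AbelianGroup 0ℓ 0ℓ
  Tensor = ⟨ A.Carrier × Bool ∣ Bilinear ⟩

  private
    module T = AbelianGroup Tensor
    open import Algebra.Properties.AbelianGroup Tensor using (identityʳ-unique; ⁻¹-∙-comm; ε⁻¹≈ε)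
    scale₀ : Bool → A.Carrier × Bool → T.Carrier
    scale₀ c (a , b) = gen (a , c ∧ b)

    scale : Bool → T.Carrier → T.Carrier
    scale c = Extend.extend Tensor (scale₀ c)

    scale-resp : ∀ c {u v} → Bilinear u v → scale c u T.≈ scale c v
    scale-resp c (⊗-cong a≈a′)   = rel (⊗-cong a≈a′)
    scale-resp c (⊗-+ˡ a a′ b)   = rel (⊗-+ˡ a a′ (c ∧ b))
    scale-resp c (⊗-+ʳ a b b′) rewrite Boolₚ.∧-distribˡ-xor c b b′ =
      rel (⊗-+ʳ a (c ∧ b) (c ∧ b′))

    scale-cong : ∀ c {u v} → u T.≈ v → scale c u T.≈ scale c v
    scale-cong c = Extend.extend-cong Tensor (scale₀ c) (scale-resp c)

  ⊗-0ʳ : ∀ a → gen (a , false) T.≈ 𝟘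
  ⊗-0ʳ a = identityʳ-unique _ _ (~-sym (rel (⊗-+ʳ a false false)))

  ⊗-0ˡ : ∀ b → gen (A.ε , b) T.≈ 𝟘
  ⊗-0ˡ b = identityʳ-unique _ _
    (~-trans (~-sym (rel (⊗-+ˡ A.ε A.ε b))) (rel (⊗-cong (A.identityˡ A.ε))))

  private
    interchange : ∀ a b c d → (a T.∙ b) T.∙ (c T.∙ d) T.≈ (a T.∙ c) T.∙ (b T.∙ d)
    interchange = medial
      where open import Algebra.Properties.CommutativeSemigroup T.commutativeSemigroup
              renaming (interchange to medial)

    scale-0 : ∀ u → scale false u T.≈ 𝟘
    scale-0 (gen (a , b)) = ⊗-0ʳ a
    scale-0 (u ⊞ v)       = ~-trans (⊞-cong (scale-0 u) (scale-0 v)) (⊞-idˡ 𝟘)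
    scale-0 𝟘             = ~-refl
    scale-0 (⊟ u)         = ~-trans (⊟-cong (scale-0 u)) ε⁻¹≈ε

    scale-1 : ∀ u → scale true u T.≈ u
    scale-1 (gen x) = ~-refl
    scale-1 (u ⊞ v) = ⊞-cong (scale-1 u) (scale-1 v)
    scale-1 𝟘       = ~-refl
    scale-1 (⊟ u)   = ⊟-cong (scale-1 u)

    scale-+ : ∀ u c d → scale (c xor d) u T.≈ scale c u T.∙ scale d u
    scale-+ (gen (a , b)) c d rewrite Boolₚ.∧-distribʳ-xor b c d = rel (⊗-+ʳ a (c ∧ b) (d ∧ b))
    scale-+ (u ⊞ v) c d = ~-trans (⊞-cong (scale-+ u c d) (scale-+ v c d))
                                  (interchange _ _ _ _)
    scale-+ 𝟘       c d = ~-sym (⊞-idˡ 𝟘)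
    scale-+ (⊟ u)   c d = ~-trans (⊟-cong (scale-+ u c d)) (~-sym (⁻¹-∙-comm _ _))

    scale-∧ : ∀ c d u → scale (c ∧ d) u T.≈ scale c (scale d u)
    scale-∧ c d (gen (a , b)) rewrite Boolₚ.∧-assoc c d b = ~-refl
    scale-∧ c d (u ⊞ v) = ⊞-cong (scale-∧ c d u) (scale-∧ c d v)
    scale-∧ c d 𝟘       = ~-refl
    scale-∧ c d (⊟ u)   = ⊟-cong (scale-∧ c d u)

  infix 9 _⊗𝔽₂
  _⊗𝔽₂ : VectorSpace
  _⊗𝔽₂ = record
    { Carrierᴹ = T.Carrier
    ; _≈ᴹ_     = T._≈_
    ; _+ᴹ_     = T._∙_
    ; _*ₗ_     = scale
    ; _*ᵣ_     = λ u c → scale c u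
    ; 0ᴹ       = 𝟘
    ; -ᴹ_      = ⊟_
    ; isModule = IsModuleFromLeft.isModule record { isLeftModule = isLeft }
    }
    where
    isLeft : IsLeftModule _ _ _ _ _ scale
    isLeft = record
      { isLeftSemimodule = record
        { +ᴹ-isCommutativeMonoid = T.isCommutativeMonoid
        ; isPreleftSemimodule = record
          { *ₗ-cong      = λ { {c} refl u≈v → scale-cong c u≈v }
          ; *ₗ-zeroˡ     = scale-0
          ; *ₗ-distribʳ  = scale-+
          ; *ₗ-identityˡ = scale-1
          ; *ₗ-assoc     = scale-∧
          ; *ₗ-zeroʳ     = λ _ → ~-refl
          ; *ₗ-distribˡ  = λ _ _ _ → ~-refl
          }
        }
      ; -ᴹ‿cong    = ⊟-cong
      ; -ᴹ‿inverse = T.inverse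
      }

formalSum : ∀ {n} → Subset n → Word (Fin n)
formalSum S = Vector.foldr _⊞_ 𝟘 λ e → if lookup S e then gen e else 𝟘

module _ {n} (M : Matroid n) where

  data CircuitRelation : Rel (Word (Fin n)) 0ℓ where
    circuit : ∀ {C} → Matroid.Circuit M C → CircuitRelation (formalSum C) 𝟘

  H₁ : AbelianGroup 0ℓ 0ℓ
  H₁ = ⟨ Fin n ∣ CircuitRelation ⟩

  H₁𝔽₂ : VectorSpace
  H₁𝔽₂ = H₁ ⊗𝔽₂

module _ {c ℓ} (M : CommutativeMonoid c ℓ) where
  private module M = CommutativeMonoid M
  open M using (Carrier; _≈_; ε)
  open SumLemmas M

  sum-image : ∀ {m n} (f : Fin m → Fin n) → Injective _≡_ _≡_ f →
              ∀ C (h : Fin n → Carrier) →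
              sum (λ i → if lookup C i then h (f i) else ε) ≈
              sum (λ j → if lookup (f [ C ]) j then h j else ε)
  sum-image {m} {n} f inj C h = M.trans (sum-cong-≋ λ i → M.sym (sum-↦ (f i) (x i)))
    (M.trans (∑-comm y) (sum-cong-≋ column))
    where
    x : Fin m → Carrier
    x i = if lookup C i then h (f i) else ε
    y : Fin m → Fin n → Carrier
    y i j = if does (f i Finₚ.≟ j) then x i else ε
    column : ∀ j → sum (λ i → y i j) ≈ (if lookup (f [ C ]) j then h j else ε)
    column j with lookup (f [ C ]) j in eq
    ... | true with ∈-image⁻ f C (bool∈ eq)
    ...   | i , i∈C , refl = M.trans
            (sum-single _ i λ k k≢i → M.reflexive (↦-≢ (k≢i ∘ inj)))
            (M.reflexive (trans (↦-≡ {i = f i} refl)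
              (cong (λ b → if b then h (f i) else ε) (∈bool i∈C))))
    column j | false = sum-ε _ term
      where
      term : ∀ i → y i j ≈ ε
      term i with f i Finₚ.≟ j
      ... | no  _ = M.refl
      ... | yes fi≡j = M.reflexive (cong (λ b → if b then h (f i) else ε)
              (∉bool λ i∈C → bool∉ eq (subst (_∈ f [ C ]) fi≡j (∈-image⁺ f i∈C))))

module _ {X : Set} (A : AbelianGroup 0ℓ 0ℓ) (f : X → AbelianGroup.Carrier A) where
  open Extend A f
  open SumLemmas (AbelianGroup.commutativeMonoid A) using (sum)

  extend-sum : ∀ {n} (w : Fin n → Word X) →
               extend (Vector.foldr _⊞_ 𝟘 w) ≡ sum (extend ∘ w)
  extend-sum {zero}  w = refl
  extend-sum {suc n} w = cong (AbelianGroup._∙_ A (extend (w zero))) (extend-sum (w ∘ suc))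

module _ {n : ℕ} (A : AbelianGroup 0ℓ 0ℓ) (f : Fin n → AbelianGroup.Carrier A) where
  open AbelianGroup A using (ε)
  open Extend A f
  open SumLemmas (AbelianGroup.commutativeMonoid A) using (sum; sum-cong-≗)

  extend-formalSum : ∀ C → extend (formalSum C) ≡ sum (λ e → if lookup C e then f e else ε)
  extend-formalSum C = trans
    (extend-sum A f λ e → if lookup C e then gen e else 𝟘)
    (sum-cong-≗ λ e → extend-if (lookup C e))
    where
    extend-if : ∀ {e} b → extend (if b then gen e else 𝟘) ≡ (if b then f e else ε)
    extend-if true  = refl
    extend-if false = refl

module _ {m n} {M : Matroid m} {N : Matroid n} (f : M ↪ N) where
  private
    module M = Matroid M
    module N = Matroid N
    module f = _↪_ f
    module HN = AbelianGroup (H₁ N)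

  image-circuit : ∀ {C} → M.Circuit C → N.Circuit (fun f [ C ])
  image-circuit {C} (¬indep , minimal) =
    ¬indep ∘ Equivalence.from (f.indep⇔ C) , λ {D} (D⊆ , j , j∈ , j∉D) →
      let P : Subset m
          P = tabulate (lookup D ∘ fun f)
          P⁻ : ∀ {i} → i ∈ P → fun f i ∈ D
          P⁻ {i} i∈P = bool∈ (trans (sym (Vecₚ.lookup∘tabulate _ i)) (∈bool i∈P))
          P⁺ : ∀ {i} → fun f i ∈ D → i ∈ P
          P⁺ {i} fi∈D = bool∈ (trans (Vecₚ.lookup∘tabulate _ i) (∈bool fi∈D))
          P⊆C : P ⊆ C
          P⊆C i∈P = let (i′ , i′∈C , eq) = ∈-image⁻ (fun f) C (D⊆ (P⁻ i∈P)) in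
            subst (_∈ C) (f.injective eq) i′∈C
          (i₀ , i₀∈C , eq₀) = ∈-image⁻ (fun f) C j∈
          i₀∉P : i₀ ∉ P
          i₀∉P i₀∈P = j∉D (subst (_∈ D) eq₀ (P⁻ i₀∈P))
          image≡D : fun f [ P ] ≡ D
          image≡D = ext⊆
            (λ k∈ → let (_ , i∈P , eq) = ∈-image⁻ (fun f) P k∈ in
              subst (_∈ D) eq (P⁻ i∈P))
            (λ k∈D → let (i , _ , eq) = ∈-image⁻ (fun f) C (D⊆ k∈D) in
              subst (_∈ fun f [ P ]) eq
                (∈-image⁺ (fun f) (P⁺ (subst (_∈ D) (sym eq) k∈D))))
      in  subst N.Indep image≡D
            (Equivalence.to (f.indep⇔ P) (minimal (P⊆C , i₀ , i₀∈C , i₀∉P)))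

  open Extend (H₁ N) (gen ∘ fun f) public using () renaming (extend to H₁-map)

  private
    resp : ∀ {u v} → CircuitRelation M u v → H₁-map u HN.≈ H₁-map v
    resp (circuit {C} isC) = HN.trans
      (HN.reflexive (extend-formalSum (H₁ N) (gen ∘ fun f) C))
      (HN.trans (sum-image HN.commutativeMonoid (fun f) f.injective C gen)
                (rel (circuit (image-circuit isC))))

  H₁-map-cong : ∀ {u v} → Rewrite (CircuitRelation M) u v → H₁-map u HN.≈ H₁-map v
  H₁-map-cong = Extend.extend-cong (H₁ N) (gen ∘ fun f) resp

  private
    tensor₀ : Word (Fin m) × Bool → Word (Word (Fin n) × Bool)
    tensor₀ (h , b) = gen (H₁-map h , b)

  open Extend (Tensor (H₁ N)) tensor₀ public using () renaming (extend to H₁𝔽₂-map)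

  private
    resp⊗ : ∀ {u v} → Bilinear (H₁ M) u v →
            Rewrite (Bilinear (H₁ N)) (H₁𝔽₂-map u) (H₁𝔽₂-map v)
    resp⊗ (⊗-cong a≈a′)  = rel (⊗-cong (H₁-map-cong a≈a′))
    resp⊗ (⊗-+ˡ a a′ b)  = rel (⊗-+ˡ _ _ b)
    resp⊗ (⊗-+ʳ a b b′)  = rel (⊗-+ʳ _ b b′)

  H₁𝔽₂-map-cong : ∀ {u v} → Rewrite (Bilinear (H₁ M)) u v →
                  Rewrite (Bilinear (H₁ N)) (H₁𝔽₂-map u) (H₁𝔽₂-map v)
  H₁𝔽₂-map-cong = Extend.extend-cong (Tensor (H₁ N)) tensor₀ resp⊗

H₁-map-id : ∀ {n} {M : Matroid n} w → H₁-map (↪-id {M = M}) w ≡ w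
H₁-map-id (gen x) = refl
H₁-map-id (u ⊞ v) = cong₂ _⊞_ (H₁-map-id u) (H₁-map-id v)
H₁-map-id 𝟘       = refl
H₁-map-id (⊟ u)   = cong ⊟_ (H₁-map-id u)

H₁𝔽₂-map-id : ∀ {n} {M : Matroid n} w → H₁𝔽₂-map (↪-id {M = M}) w ≡ w
H₁𝔽₂-map-id {M = M} (gen (h , b)) = cong (λ h → gen (h , b)) (H₁-map-id {M = M} h)
H₁𝔽₂-map-id (u ⊞ v) = cong₂ _⊞_ (H₁𝔽₂-map-id u) (H₁𝔽₂-map-id v)
H₁𝔽₂-map-id 𝟘       = refl
H₁𝔽₂-map-id (⊟ u)   = cong ⊟_ (H₁𝔽₂-map-id u)

module _ {l m n} {L : Matroid l} {M : Matroid m} {N : Matroid n}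
         (g : M ↪ N) (f : L ↪ M) where

  H₁-map-∘ : ∀ w → H₁-map (g ∘↪ f) w ≡ H₁-map g (H₁-map f w)
  H₁-map-∘ (gen x) = refl
  H₁-map-∘ (u ⊞ v) = cong₂ _⊞_ (H₁-map-∘ u) (H₁-map-∘ v)
  H₁-map-∘ 𝟘       = refl
  H₁-map-∘ (⊟ u)   = cong ⊟_ (H₁-map-∘ u)

  H₁𝔽₂-map-∘ : ∀ w → H₁𝔽₂-map (g ∘↪ f) w ≡ H₁𝔽₂-map g (H₁𝔽₂-map f w)
  H₁𝔽₂-map-∘ (gen (h , b)) = cong (λ h → gen (h , b)) (H₁-map-∘ h)
  H₁𝔽₂-map-∘ (u ⊞ v) = cong₂ _⊞_ (H₁𝔽₂-map-∘ u) (H₁𝔽₂-map-∘ v)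
  H₁𝔽₂-map-∘ 𝟘       = refl
  H₁𝔽₂-map-∘ (⊟ u)   = cong ⊟_ (H₁𝔽₂-map-∘ u)

module _ {m n} {M : Matroid m} {N : Matroid n} (f g : M ↪ N) (f≗g : fun f ≗ fun g) where

  H₁-map-≗ : ∀ w → H₁-map f w ≡ H₁-map g w
  H₁-map-≗ (gen x) = cong gen (f≗g x)
  H₁-map-≗ (u ⊞ v) = cong₂ _⊞_ (H₁-map-≗ u) (H₁-map-≗ v)
  H₁-map-≗ 𝟘       = refl
  H₁-map-≗ (⊟ u)   = cong ⊟_ (H₁-map-≗ u)

  H₁𝔽₂-map-≗ : ∀ w → H₁𝔽₂-map f w ≡ H₁𝔽₂-map g w
  H₁𝔽₂-map-≗ (gen (h , b)) = cong (λ h → gen (h , b)) (H₁-map-≗ h)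
  H₁𝔽₂-map-≗ (u ⊞ v) = cong₂ _⊞_ (H₁𝔽₂-map-≗ u) (H₁𝔽₂-map-≗ v)
  H₁𝔽₂-map-≗ 𝟘       = refl
  H₁𝔽₂-map-≗ (⊟ u)   = cong ⊟_ (H₁𝔽₂-map-≗ u)

enum : ∀ {n} (S : Subset n) → Fin ∣ S ∣ → Fin n
enum (true  ∷ S) zero    = zero
enum (true  ∷ S) (suc i) = suc (enum S i)
enum (false ∷ S) i       = suc (enum S i)

enum-∈ : ∀ {n} (S : Subset n) i → enum S i ∈ S
enum-∈ (true  ∷ S) zero    = here
enum-∈ (true  ∷ S) (suc i) = there (enum-∈ S i)
enum-∈ (false ∷ S) i       = there (enum-∈ S i)

enum-injective : ∀ {n} (S : Subset n) → Injective _≡_ _≡_ (enum S)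
enum-injective (true  ∷ S) {zero}  {zero}  _  = refl
enum-injective (true  ∷ S) {suc i} {suc j} eq =
  cong suc (enum-injective S (Finₚ.suc-injective eq))
enum-injective (false ∷ S) eq = enum-injective S (Finₚ.suc-injective eq)

enum-onto : ∀ {n} (S : Subset n) {e} → e ∈ S → ∃ λ i → enum S i ≡ e
enum-onto (true  ∷ S) here        = zero , refl
enum-onto (true  ∷ S) (there e∈S) = let (i , eq) = enum-onto S e∈S in suc i , cong suc eq
enum-onto (false ∷ S) (there e∈S) = let (i , eq) = enum-onto S e∈S in i , cong suc eq

module _ {c ℓ} (M : CommutativeMonoid c ℓ) where
  private module M = CommutativeMonoid M
  open M using (Carrier; _≈_; ε)
  open SumLemmas M

  enum-sum : ∀ {n} (S : Subset n) (h : Fin n → Carrier) →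
             (∀ e → e ∉ S → h e ≈ ε) → sum (h ∘ enum S) ≈ sum h
  enum-sum []          h off = M.refl
  enum-sum (true  ∷ S) h off =
    M.∙-cong M.refl (enum-sum S (h ∘ suc) λ e e∉S → off (suc e) λ { (there e∈S) → e∉S e∈S })
  enum-sum (false ∷ S) h off = M.trans
    (enum-sum S (h ∘ suc) λ e e∉S → off (suc e) λ { (there e∈S) → e∉S e∈S })
    (M.sym (M.trans (M.∙-cong (off zero λ ()) M.refl) (M.identityˡ _)))

∣∣≤∣image∣ : ∀ {m n} (f : Fin m → Fin n) → Injective _≡_ _≡_ f → ∀ S →
            ∣ S ∣ ℕ.≤ ∣ f [ S ] ∣
∣∣≤∣image∣ f inj S = Finₚ.injective⇒≤ {f = index} λ {i} {j} eq →
  enum-injective S (inj (trans (sym (index-eq i))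
    (trans (cong (enum (f [ S ])) eq) (index-eq j))))
  where
  position : ∀ i → ∃ λ k → enum (f [ S ]) k ≡ f (enum S i)
  position i = enum-onto (f [ S ]) (∈-image⁺ f (enum-∈ S i))
  index : Fin ∣ S ∣ → Fin ∣ f [ S ] ∣
  index i = proj₁ (position i)
  index-eq : ∀ i → enum (f [ S ]) (index i) ≡ f (enum S i)
  index-eq i = proj₂ (position i)

private
  module ∑₂ = SumLemmas (CommutativeRing.+-commutativeMonoid 𝔽₂)

Supported : ∀ {n} → (Fin n → Bool) → Subset n → Set
Supported c S = ∀ e → e ∉ S → c e ≡ false

⟦_⟧ : ∀ {n} → Fin n → Fin n → Bool
⟦ i ⟧ j = does (i Finₚ.≟ j)

⟦⟧-same : ∀ {n} (i : Fin n) → ⟦ i ⟧ i ≡ true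
⟦⟧-same i = dec-true (i Finₚ.≟ i) refl

⟦⟧-diff : ∀ {n} {i j : Fin n} → i ≢ j → ⟦ i ⟧ j ≡ false
⟦⟧-diff {i = i} {j} = dec-false (i Finₚ.≟ j)

pushforward : ∀ {m n} → (Fin m → Fin n) → (Fin m → Bool) → Fin n → Bool
pushforward g c j = ∑₂.sum λ i → if ⟦ g i ⟧ j then c i else false

module _ {m n} (g : Fin m → Fin n) (c : Fin m → Bool) where

  pushforward-at : Injective _≡_ _≡_ g → ∀ i → pushforward g c (g i) ≡ c i
  pushforward-at inj i = trans
    (∑₂.sum-single _ i λ k k≢i → ∑₂.↦-≢ {x = c k} (k≢i ∘ inj))
    (∑₂.↦-≡ {i = g i} refl)

  pushforward-off : ∀ j → (∀ i → g i ≡ j → c i ≡ false) → pushforward g c j ≡ false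
  pushforward-off j off = ∑₂.sum-ε _ term
    where
    term : ∀ i → (if ⟦ g i ⟧ j then c i else false) ≡ false
    term i with g i Finₚ.≟ j
    ... | yes eq = off i eq
    ... | no  _  = refl

module Combinations (V : VectorSpace) where
  open Lin V
  open import Relation.Binary.Reasoning.Setoid ≈ᴹ-setoid

  x+x : ∀ x → x +ᴹ x ≈ᴹ 0ᴹ
  x+x x = begin
    x +ᴹ x                       ≈⟨ +ᴹ-cong (*ₗ-identityˡ x) (*ₗ-identityˡ x) ⟨
    (true *ₗ x) +ᴹ (true *ₗ x)   ≈⟨ *ₗ-distribʳ x true true ⟨
    false *ₗ x                   ≈⟨ *ₗ-zeroˡ x ⟩
    0ᴹ                           ∎

  comb-cong : ∀ {n} {c d : Fin n → Bool} v → c ≗ d → comb c v ≈ᴹ comb d v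
  comb-cong v c≗d = ∑.sum-cong-≋ λ i → *ₗ-congʳ (c≗d i)

  comb-congʳ : ∀ {n} (c : Fin n → Bool) {v w} → (∀ i → v i ≈ᴹ w i) → comb c v ≈ᴹ comb c w
  comb-congʳ c v≈w = ∑.sum-cong-≋ λ i → *ₗ-congˡ (v≈w i)

  comb-0 : ∀ {n} {c : Fin n → Bool} v → (∀ i → c i ≡ false) → comb c v ≈ᴹ 0ᴹ
  comb-0 v c≡0 = ∑.sum-ε _ λ i → ≈ᴹ-trans (*ₗ-congʳ (c≡0 i)) (*ₗ-zeroˡ _)

  comb-+ : ∀ {n} (c d : Fin n → Bool) v →
           comb (λ i → c i xor d i) v ≈ᴹ comb c v +ᴹ comb d v
  comb-+ c d v = ≈ᴹ-trans (∑.sum-cong-≋ λ i → *ₗ-distribʳ (v i) (c i) (d i))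
                          (∑.∑-distrib-+ (λ i → c i *ₗ v i) (λ i → d i *ₗ v i))

  comb-* : ∀ {n} a (c : Fin n → Bool) v → comb (λ i → a ∧ c i) v ≈ᴹ a *ₗ comb c v
  comb-* true  c v = ≈ᴹ-sym (*ₗ-identityˡ _)
  comb-* false c v = ≈ᴹ-trans (comb-0 v λ _ → refl) (≈ᴹ-sym (*ₗ-zeroˡ _))

  comb-⟦⟧ : ∀ {n} (i : Fin n) v → comb ⟦ i ⟧ v ≈ᴹ v i
  comb-⟦⟧ i v = ≈ᴹ-trans
    (∑.sum-single _ i λ j j≢i → ≈ᴹ-trans (*ₗ-congʳ (⟦⟧-diff {i = i} {j} (j≢i ∘ sym))) (*ₗ-zeroˡ _))
    (≈ᴹ-trans (*ₗ-congʳ (⟦⟧-same i)) (*ₗ-identityˡ _))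

  sum-*ₗ : ∀ {n} (c : Fin n → Bool) x → ∑₂.sum c *ₗ x ≈ᴹ ∑.sum λ i → c i *ₗ x
  sum-*ₗ {zero}  c x = *ₗ-zeroˡ x
  sum-*ₗ {suc n} c x = ≈ᴹ-trans (*ₗ-distribʳ x _ _) (+ᴹ-congˡ (sum-*ₗ (c ∘ suc) x))

  comb-push : ∀ {m n} (g : Fin m → Fin n) c v → comb (pushforward g c) v ≈ᴹ comb c (v ∘ g)
  comb-push g c v = begin
    (∑.sum λ j → pushforward g c j *ₗ v j)
      ≈⟨ ∑.sum-cong-≋ (λ j → sum-*ₗ (λ i → if ⟦ g i ⟧ j then c i else false) (v j)) ⟩
    (∑.sum λ j → ∑.sum λ i → (if ⟦ g i ⟧ j then c i else false) *ₗ v j)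
      ≈⟨ ∑.∑-comm (λ j i → (if ⟦ g i ⟧ j then c i else false) *ₗ v j) ⟩
    (∑.sum λ i → ∑.sum λ j → (if ⟦ g i ⟧ j then c i else false) *ₗ v j)
      ≈⟨ ∑.sum-cong-≋ (λ i → ∑.sum-single _ (g i) λ j j≢gi → ≈ᴹ-trans
           (*ₗ-congʳ (∑₂.↦-≢ {x = c i} (j≢gi ∘ sym))) (*ₗ-zeroˡ _)) ⟩
    (∑.sum λ i → (if ⟦ g i ⟧ (g i) then c i else false) *ₗ v (g i))
      ≈⟨ ∑.sum-cong-≋ (λ i → *ₗ-congʳ (∑₂.↦-≡ {i = g i} refl)) ⟩
    (∑.sum λ i → c i *ₗ v (g i)) ∎

  module _ {n} (ρ : Fin n → Carrierᴹ) where

    Free : Subset n → Set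
    Free S = ∀ c → Supported c S → comb c ρ ≈ᴹ 0ᴹ → ∀ e → c e ≡ false

    InSpan : Subset n → Carrierᴹ → Set
    InSpan S v = ∃ λ c → Supported c S × comb c ρ ≈ᴹ v

    span-+ : ∀ {S u v} → InSpan S u → InSpan S v → InSpan S (u +ᴹ v)
    span-+ (c , sc , eq) (d , sd , eq′) =
      (λ i → c i xor d i) , (λ e e∉S → cong₂ _xor_ (sc e e∉S) (sd e e∉S))
      , ≈ᴹ-trans (comb-+ c d ρ) (+ᴹ-cong eq eq′)

    span-* : ∀ {S v} a → InSpan S v → InSpan S (a *ₗ v)
    span-* a (c , sc , eq) =
      (λ i → a ∧ c i)
      , (λ e e∉S → trans (cong (a ∧_) (sc e e∉S)) (Boolₚ.∧-zeroʳ a))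
      , ≈ᴹ-trans (comb-* a c ρ) (*ₗ-congˡ eq)

    span-comb : ∀ {S k} c (v : Fin k → Carrierᴹ) →
                (∀ i → InSpan S (v i)) → InSpan S (comb c v)
    span-comb {k = zero}  c v inS = (λ _ → false) , (λ _ _ → refl) , comb-0 ρ λ _ → refl
    span-comb {k = suc k} c v inS =
      span-+ (span-* (c zero) (inS zero)) (span-comb (c ∘ suc) (v ∘ suc) (inS ∘ suc))

    span-≈ : ∀ {S u v} → u ≈ᴹ v → InSpan S u → InSpan S v
    span-≈ u≈v (c , sc , eq) = c , sc , ≈ᴹ-trans eq u≈v

    span-∈ : ∀ {S e} → e ∈ S → InSpan S (ρ e)
    span-∈ {S} {e} e∈S =
      ⟦ e ⟧ , (λ j j∉S → ⟦⟧-diff {i = e} {j} λ { refl → j∉S e∈S }) , comb-⟦⟧ e ρ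

  restrict : ∀ {n} (S : Subset n) (c : Fin n → Bool) ρ →
             Supported c S → comb (c ∘ enum S) (ρ ∘ enum S) ≈ᴹ comb c ρ
  restrict S c ρ sc = enum-sum +ᴹ-commutativeMonoid S (λ e → c e *ₗ ρ e)
    λ e e∉S → ≈ᴹ-trans (*ₗ-congʳ (sc e e∉S)) (*ₗ-zeroˡ _)

record FamilyRepresentation {n} (M : Matroid n) (V : VectorSpace)
                            (ρ : Fin n → Module.Carrierᴹ V) : Set where
  open Module V
  open Combinations V
  field
    _≟ᴹ_  : RB.Decidable _≈ᴹ_
    free⇔ : ∀ S → Matroid.Indep M S ⇔ Free ρ S
    spans : ∀ v → ∃ λ c → Lin.comb V c ρ ≈ᴹ v

module _ {n} {M : Matroid n} (R : Representation M) where
  open Representation R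
  open Lin V
  open Combinations V

  private
    toFree : ∀ {S} → InjectiveOn S → LinearlyIndependent (Image S) → Free ρ S
    toFree {S} inj li c sc eq e with e Subₚ.∈? S
    ... | no  e∉S = sc e e∉S
    ... | yes e∈S with enum-onto S e∈S
    ...   | i , refl = li (ρ ∘ enum S)
              (λ j → enum S j , enum-∈ S j , ≈ᴹ-refl)
              (λ eq → enum-injective S (inj (enum-∈ S _) (enum-∈ S _) eq))
              (c ∘ enum S)
              (≈ᴹ-trans (restrict S c ρ sc) eq) i

    fromFree₁ : ∀ {S} → Free ρ S → InjectiveOn S
    fromFree₁ {S} free {e} {e′} e∈S e′∈S eq with e Finₚ.≟ e′
    ... | yes e≡e′ = e≡e′
    ... | no  e≢e′ with () ← trans (sym (cong₂ _xor_ (⟦⟧-same e) (⟦⟧-diff {i = e′} {e} (e≢e′ ∘ sym))))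
          (free (λ j → ⟦ e ⟧ j xor ⟦ e′ ⟧ j)
            (λ j j∉S → cong₂ _xor_ (⟦⟧-diff {i = e} {j} λ { refl → j∉S e∈S })
                                   (⟦⟧-diff {i = e′} {j} λ { refl → j∉S e′∈S }))
            (≈ᴹ-trans (comb-+ ⟦ e ⟧ ⟦ e′ ⟧ ρ)
            (≈ᴹ-trans (+ᴹ-cong (comb-⟦⟧ e ρ) (comb-⟦⟧ e′ ρ))
            (≈ᴹ-trans (+ᴹ-congʳ eq) (x+x (ρ e′)))))
            e)

    fromFree₂ : ∀ {S} → Free ρ S → LinearlyIndependent (Image S)
    fromFree₂ {S} free {k} v v∈ inj c eq i = trans
      (sym (pushforward-at g c g-inj i))
      (free (pushforward g c)
        (λ e e∉S → pushforward-off g c e λ j gj≡e →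
          contradiction (subst (_∈ S) gj≡e (proj₁ (proj₂ (v∈ j)))) e∉S)
        (≈ᴹ-trans (comb-push g c ρ)
        (≈ᴹ-trans (comb-congʳ c ρg≈v) eq))
        (g i))
      where
      g : Fin k → Fin n
      g j = proj₁ (v∈ j)
      ρg≈v : ∀ j → ρ (g j) ≈ᴹ v j
      ρg≈v j = proj₂ (proj₂ (v∈ j))
      g-inj : Injective _≡_ _≡_ g
      g-inj {a} {b} ga≡gb = inj (≈ᴹ-trans (≈ᴹ-sym (ρg≈v a))
        (≈ᴹ-trans (≈ᴹ-reflexive (cong ρ ga≡gb)) (ρg≈v b)))

  family : FamilyRepresentation M V ρ
  family = record
    { _≟ᴹ_  = _≟ᴹ_
    ; free⇔ = λ S → mk⇔
        (λ ind → let (inj , li) = Equivalence.to (indep⇔ S) ind in toFree inj li)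
        (λ free → Equivalence.from (indep⇔ S) (fromFree₁ free , fromFree₂ free))
    ; spans = λ v →
        let (k , u , c , u∈ , eq) = spans v
            g = λ i → proj₁ (u∈ i)
        in  pushforward g c
            , ≈ᴹ-trans (comb-push g c ρ)
              (≈ᴹ-trans (comb-congʳ c λ i → proj₂ (u∈ i)) eq)
    }

module _ {n} (M : Matroid n) where
  open Matroid M

  dependent⇒circuit : ∀ S → ¬ Indep S → ∃ λ C → C ⊆ S × Circuit C
  dependent⇒circuit S = go S (<-wellFounded ∣ S ∣)
    where
    go : ∀ S → Acc ℕ._<_ ∣ S ∣ → ¬ Indep S → ∃ λ C → C ⊆ S × Circuit C
    go S (acc rs) dep with Finₚ.any? (λ e → (e Subₚ.∈? S) ×-dec ¬? (indep? (S - e)))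
    ... | yes (e , e∈S , dep′) =
          let (C , C⊆ , isC) = go (S - e) (rs (Subₚ.x∈p⇒∣p-x∣<∣p∣ e∈S)) dep′ in
          C , proj₁ (Subₚ.x∈p⇒p-x⊂p e∈S) ∘ C⊆ , isC
    ... | no  none = S , id , dep , λ {D} (D⊆S , e , e∈S , e∉D) →
          decidable-stable (indep? D) λ depD → none (e , e∈S , λ ind → depD
            (hereditary (λ x∈D → Subₚ.x∈p∧x≢y⇒x∈p-y (D⊆S x∈D) λ { refl → e∉D x∈D }) ind))

module _ {n} {M : Matroid n} {V : VectorSpace} {ρ : Fin n → Module.Carrierᴹ V}
         (F : FamilyRepresentation M V ρ) where
  open Matroid M
  open FamilyRepresentation F
  open Lin V
  open Combinations V

  private
    indep⇒free : ∀ {S} → Indep S → Free ρ S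
    indep⇒free {S} = Equivalence.to (free⇔ S)

  circuit-comb : ∀ {C} → Circuit C → comb (lookup C) ρ ≈ᴹ 0ᴹ
  circuit-comb {C} (dep , minimal) = decidable-stable (_ ≟ᴹ _) λ ≉0 →
    dep (Equivalence.from (free⇔ C) λ c sc eq → free ≉0 c sc eq)
    where
    free : ¬ comb (lookup C) ρ ≈ᴹ 0ᴹ → Free ρ C
    free ≉0 c sc eq with Finₚ.any? (λ e → (e Subₚ.∈? C) ×-dec (c e Boolₚ.≟ false))
    ... | yes (e₀ , e₀∈C , ce₀) = indep⇒free
          (minimal (T⊆C , e₀ , e₀∈C , bool∉ (trans (Vecₚ.lookup∘tabulate c e₀) ce₀)))
          c (λ e e∉T → trans (sym (Vecₚ.lookup∘tabulate c e)) (∉bool e∉T)) eq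
      where
      T⊆C : tabulate c ⊆ C
      T⊆C {e} e∈T = decidable-stable (e Subₚ.∈? C) λ e∉C →
        bool∉ (trans (Vecₚ.lookup∘tabulate c e) (sc e e∉C)) e∈T
    ... | no none = contradiction (≈ᴹ-trans (comb-cong ρ same) eq) ≉0
      where
      same : lookup C ≗ c
      same e with e Subₚ.∈? C
      ... | no  e∉C = trans (∉bool e∉C) (sym (sc e e∉C))
      ... | yes e∈C with c e in ce
      ...   | true  = ∈bool e∈C
      ...   | false = contradiction (e , e∈C , ce) none

  private
    module W = Module (H₁𝔽₂ M)
    open Extend +ᴹ-abelianGroup ρ using () renaming (extend to φ₁)

    φ₁-resp : ∀ {u v} → CircuitRelation M u v → φ₁ u ≈ᴹ φ₁ v
    φ₁-resp (circuit {C} isC) = ≈ᴹ-trans (≈ᴹ-reflexive (extend-formalSum +ᴹ-abelianGroup ρ C))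
      (≈ᴹ-trans (∑.sum-cong-≋ λ e → if-* (lookup C e)) (circuit-comb isC))
      where
      if-* : ∀ {x} b → (if b then x else 0ᴹ) ≈ᴹ b *ₗ x
      if-* true  = ≈ᴹ-sym (*ₗ-identityˡ _)
      if-* false = ≈ᴹ-sym (*ₗ-zeroˡ _)

    φ₀ : Word (Fin n) × Bool → Carrierᴹ
    φ₀ (h , b) = b *ₗ φ₁ h

  open Extend +ᴹ-abelianGroup φ₀ public using () renaming (extend to classify)

  private
    φ = classify

    φ-cong : ∀ {u v} → u W.≈ᴹ v → φ u ≈ᴹ φ v
    φ-cong = Extend.extend-cong +ᴹ-abelianGroup φ₀ λ where
      (⊗-cong a≈a′) → *ₗ-congˡ (Extend.extend-cong +ᴹ-abelianGroup ρ φ₁-resp a≈a′)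
      (⊗-+ˡ a a′ b) → *ₗ-distribˡ b _ _
      (⊗-+ʳ a b b′) → *ₗ-distribʳ _ b b′

    φ-* : ∀ c w → φ (c W.*ₗ w) ≈ᴹ c *ₗ φ w
    φ-* true  w = ≈ᴹ-trans (φ-cong (W.*ₗ-identityˡ w)) (≈ᴹ-sym (*ₗ-identityˡ _))
    φ-* false w = ≈ᴹ-trans (φ-cong (W.*ₗ-zeroˡ w)) (≈ᴹ-sym (*ₗ-zeroˡ _))

    module ∑ᵂ = SumLemmas W.+ᴹ-commutativeMonoid
    module CW = Combinations (H₁𝔽₂ M)
    open import Algebra.Properties.AbelianGroup W.+ᴹ-abelianGroup using (inverseˡ-unique)

    -w≈w : ∀ w → ⊟ w W.≈ᴹ w
    -w≈w w = W.≈ᴹ-sym (inverseˡ-unique w w (CW.x+x w))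

    N : (Fin n → Bool) → W.Carrierᴹ
    N c = ∑ᵂ.sum λ e → gen (gen e , c e)

    N-cong : ∀ {c d} → c ≗ d → N c W.≈ᴹ N d
    N-cong c≗d = ∑ᵂ.sum-cong-≋ λ e → W.≈ᴹ-reflexive (cong (λ b → gen (gen e , b)) (c≗d e))

    N-+ : ∀ c d → N (λ e → c e xor d e) W.≈ᴹ N c W.+ᴹ N d
    N-+ c d = W.≈ᴹ-trans (∑ᵂ.sum-cong-≋ λ e → rel (⊗-+ʳ (gen e) (c e) (d e)))
      (∑ᵂ.∑-distrib-+ (λ e → gen (gen e , c e)) (λ e → gen (gen e , d e)))

    N-0 : ∀ {c} → (∀ e → c e ≡ false) → N c W.≈ᴹ 𝟘
    N-0 c≡0 = W.≈ᴹ-trans (N-cong c≡0) (∑ᵂ.sum-ε _ λ e → ⊗-0ʳ (H₁ M) (gen e))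

    Normal : W.Carrierᴹ → Set
    Normal w = ∃ λ c → w W.≈ᴹ N c

    normal-+ : ∀ {u v} → Normal u → Normal v → Normal (u ⊞ v)
    normal-+ (c , p) (d , q) =
      (λ e → c e xor d e) , W.≈ᴹ-trans (⊞-cong p q) (W.≈ᴹ-sym (N-+ c d))

    normal-≈ : ∀ {u v} → u W.≈ᴹ v → Normal v → Normal u
    normal-≈ u≈v (c , p) = c , W.≈ᴹ-trans u≈v p

    normal-0 : Normal 𝟘
    normal-0 = (λ _ → false) , W.≈ᴹ-sym (N-0 λ _ → refl)

    normal-⊗ : ∀ h b → Normal (gen (h , b))
    normal-⊗ (gen e) b = c , W.≈ᴹ-sym (W.≈ᴹ-trans
        (∑ᵂ.sum-single (λ j → gen (gen j , c j)) e λ j j≢e → W.≈ᴹ-trans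
          (W.≈ᴹ-reflexive (cong (λ a → gen (gen j , a)) (∑₂.↦-≢ {x = b} (j≢e ∘ sym))))
          (⊗-0ʳ (H₁ M) (gen j)))
        (W.≈ᴹ-reflexive (cong (λ a → gen (gen e , a)) (∑₂.↦-≡ {i = e} refl))))
      where
      c : Fin n → Bool
      c j = if ⟦ e ⟧ j then b else false
    normal-⊗ (u ⊞ v) b = normal-≈ (rel (⊗-+ˡ u v b)) (normal-+ (normal-⊗ u b) (normal-⊗ v b))
    normal-⊗ 𝟘       b = normal-≈ (⊗-0ˡ (H₁ M) b) normal-0
    normal-⊗ (⊟ u)   b = normal-≈ neg (normal-⊗ u b)
      where
      neg : gen (⊟ u , b) W.≈ᴹ gen (u , b)
      neg = W.≈ᴹ-trans (inverseˡ-unique _ _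
        (W.≈ᴹ-trans (~-sym (rel (⊗-+ˡ (⊟ u) u b)))
        (W.≈ᴹ-trans (rel (⊗-cong (⊟-inverse u))) (⊗-0ˡ (H₁ M) b)))) (-w≈w _)

    normal : ∀ w → Normal w
    normal (gen (h , b)) = normal-⊗ h b
    normal (u ⊞ v)       = normal-+ (normal u) (normal v)
    normal 𝟘             = normal-0
    normal (⊟ u)         = normal-≈ (-w≈w u) (normal u)

    ⊗-sum : ∀ {k} (h : Fin k → Word (Fin n)) →
            gen (Vector.foldr _⊞_ 𝟘 h , true) W.≈ᴹ ∑ᵂ.sum λ i → gen (h i , true)
    ⊗-sum {zero}  h = ⊗-0ˡ (H₁ M) true
    ⊗-sum {suc k} h = W.≈ᴹ-trans (rel (⊗-+ˡ (h zero) _ true))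
      (⊞-cong ~-refl (⊗-sum (h ∘ suc)))

    N-circuit : ∀ {C} → Circuit C → N (lookup C) W.≈ᴹ 𝟘
    N-circuit {C} isC = W.≈ᴹ-trans (∑ᵂ.sum-cong-≋ λ e → move (lookup C e))
      (W.≈ᴹ-trans (W.≈ᴹ-sym (⊗-sum λ e → if lookup C e then gen e else 𝟘))
      (W.≈ᴹ-trans (rel (⊗-cong (rel (circuit isC)))) (⊗-0ˡ (H₁ M) true)))
      where
      move : ∀ {e} b → gen (gen e , b) W.≈ᴹ gen ((if b then gen e else 𝟘) , true)
      move     true  = ~-refl
      move {e} false = W.≈ᴹ-trans (⊗-0ʳ (H₁ M) (gen e)) (W.≈ᴹ-sym (⊗-0ˡ (H₁ M) true))

    N-kernel : ∀ S → Acc ℕ._<_ ∣ S ∣ → comb (lookup S) ρ ≈ᴹ 0ᴹ → N (lookup S) W.≈ᴹ 𝟘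
    N-kernel S (acc rs) eq with Subₚ.nonempty? S
    ... | no  empty = N-0 λ e → ∉bool λ e∈S → empty (e , e∈S)
    ... | yes (e , e∈S) with dependent⇒circuit M S (λ ind →
                              bool∉ (indep⇒free ind (lookup S) (λ _ → ∉bool) eq e) e∈S)
    ...   | C , C⊆S , isC = W.≈ᴹ-trans (N-cong split) (W.≈ᴹ-trans (N-+ (lookup S′) (lookup C))
              (W.≈ᴹ-trans (⊞-cong
                (N-kernel S′ (rs (Subₚ.p⊂q⇒∣p∣<∣q∣ S′⊂S)) eq′) (N-circuit isC)) (⊞-idˡ 𝟘)))
      where
      S′ : Subset n
      S′ = tabulate λ e → lookup S e xor lookup C e
      S′-at : ∀ e → lookup S′ e ≡ lookup S e xor lookup C e
      S′-at = Vecₚ.lookup∘tabulate _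
      split : lookup S ≗ λ e → lookup S′ e xor lookup C e
      split e = sym (trans (cong (_xor lookup C e) (S′-at e))
        (trans (Boolₚ.xor-assoc (lookup S e) (lookup C e) (lookup C e))
        (trans (cong (lookup S e xor_) (Boolₚ.xor-same (lookup C e)))
               (Boolₚ.xor-identityʳ (lookup S e)))))
      eq′ : comb (lookup S′) ρ ≈ᴹ 0ᴹ
      eq′ = ≈ᴹ-trans (comb-cong ρ S′-at) (≈ᴹ-trans (comb-+ (lookup S) (lookup C) ρ)
        (≈ᴹ-trans (+ᴹ-cong eq (circuit-comb isC)) (+ᴹ-identityˡ 0ᴹ)))
      S′⊂S : S′ ⊂ S
      S′⊂S with Subₚ.nonempty? C
      ... | no  empty = contradiction (subst Indep (sym (Subₚ.Empty-unique empty)) ∅-indep)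
                                      (proj₁ isC)
      ... | yes (d , d∈C) =
            (λ {x} x∈S′ → decidable-stable (x Subₚ.∈? S) λ x∉S → bool∉
              (trans (S′-at x) (cong₂ _xor_ (∉bool x∉S) (∉bool (x∉S ∘ C⊆S)))) x∈S′)
            , d , C⊆S d∈C
            , bool∉ (trans (S′-at d) (cong₂ _xor_ (∈bool (C⊆S d∈C)) (∈bool d∈C)))

    φ-N : ∀ c → φ (N c) ≈ᴹ comb c ρ
    φ-N c = ≈ᴹ-reflexive (extend-sum +ᴹ-abelianGroup φ₀ λ e → gen (gen e , c e))

    φ-ker : ∀ w → φ w ≈ᴹ 0ᴹ → w W.≈ᴹ 𝟘
    φ-ker w φw≈0 with normal w
    ... | c , w≈Nc = W.≈ᴹ-trans w≈Nc (W.≈ᴹ-trans (N-cong (sym ∘ at))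
          (N-kernel (tabulate c) (<-wellFounded _)
            (≈ᴹ-trans (comb-cong ρ at) (≈ᴹ-trans (≈ᴹ-sym (φ-N c))
            (≈ᴹ-trans (φ-cong (W.≈ᴹ-sym w≈Nc)) φw≈0)))))
      where
      at : lookup (tabulate c) ≗ c
      at = Vecₚ.lookup∘tabulate c

  H₁𝔽₂≅V : H₁𝔽₂ M ≅ V
  H₁𝔽₂≅V = mk≅ φ φ-cong (λ _ _ → ≈ᴹ-refl) φ-* φ-ker λ v →
    let (c , eq) = spans v in N c , ≈ᴹ-trans (φ-N c) eq

  module _ {r} (bound : ∀ {I} → Indep I → ∣ I ∣ ℕ.≤ r) {B : Subset n} (indB : Indep B) where

    basis-spans : r ℕ.≤ ∣ B ∣ → ∀ v → InSpan ρ B v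
    basis-spans r≤B v = let (c , eq) = spans v in
      span-≈ ρ eq (span-comb ρ c ρ generator)
      where
      generator : ∀ e → InSpan ρ B (ρ e)
      generator e with e Subₚ.∈? B
      ... | yes e∈B = span-∈ ρ e∈B
      ... | no  e∉B with dependent⇒circuit M (B ∪ ⁅ e ⁆) (λ ind →
              ℕₚ.<⇒≱ (Subₚ.p⊂q⇒∣p∣<∣q∣ {p = B} {B ∪ ⁅ e ⁆}
                       (Subₚ.p⊆p∪q ⁅ e ⁆ , e , Subₚ.q⊆p∪q B ⁅ e ⁆ (Subₚ.x∈⁅x⁆ e) , e∉B))
                     (ℕₚ.≤-trans (bound ind) r≤B))
      ...   | C , C⊆ , isC = (λ j → lookup C j xor ⟦ e ⟧ j) , supp
              , ≈ᴹ-trans (comb-+ (lookup C) ⟦ e ⟧ ρ)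
                (≈ᴹ-trans (+ᴹ-cong (circuit-comb isC) (comb-⟦⟧ e ρ)) (+ᴹ-identityˡ _))
        where
        in-B : ∀ {j} → j ≢ e → j ∈ C → j ∈ B
        in-B j≢e j∈C = Sum.[ id , (λ j∈ → contradiction (Subₚ.x∈⁅y⁆⇒x≡y e j∈) j≢e) ]′
          (Subₚ.x∈p∪q⁻ B ⁅ e ⁆ (C⊆ j∈C))
        e∈C : e ∈ C
        e∈C = decidable-stable (e Subₚ.∈? C) λ e∉C → proj₁ isC
          (hereditary (λ j∈C → in-B (λ { refl → e∉C j∈C }) j∈C) indB)
        supp : Supported (λ j → lookup C j xor ⟦ e ⟧ j) B
        supp j j∉B with e Finₚ.≟ j
        ... | yes refl rewrite ∈bool e∈C = refl
        ... | no  e≢j  rewrite ∉bool (λ j∈C → j∉B (in-B (e≢j ∘ sym) j∈C)) = refl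

    basis≅ : ∣ B ∣ ≡ r → 𝔽₂^ r ≅ V
    basis≅ refl = mk≅ (λ c → comb c (ρ ∘ enum B))
      (comb-cong (ρ ∘ enum B))
      (λ c d → comb-+ c d (ρ ∘ enum B))
      (λ a c → comb-* a c (ρ ∘ enum B))
      (λ c eq i → trans (sym (pushforward-at (enum B) c (enum-injective B) i))
        (indep⇒free indB (pushforward (enum B) c)
          (λ e e∉B → pushforward-off (enum B) c e λ j eq →
            contradiction (subst (_∈ B) eq (enum-∈ B j)) e∉B)
          (≈ᴹ-trans (comb-push (enum B) c ρ) eq) (enum B i)))
      (λ v → let (c , sc , eq) = basis-spans ℕₚ.≤-refl v in
        c ∘ enum B , ≈ᴹ-trans (restrict B c ρ sc) eq)

module _ {m n r} {M : Matroid m} {N : Matroid n}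
         (rankM : Matroid.HasRank M r) (rankN : Matroid.HasRank N r) (f : M ↪ N)
         {V : VectorSpace} {ρ : Fin n → Module.Carrierᴹ V}
         (F : FamilyRepresentation N V ρ) where
  private
    module M = Matroid M
    module N = Matroid N
    module f = _↪_ f
    module F = FamilyRepresentation F
  open Lin V
  open Combinations V

  private
    back : ∀ {S} d → Supported d (fun f [ S ]) →
           comb (d ∘ fun f) (ρ ∘ fun f) ≈ᴹ comb d ρ
    back {S} d sd = ≈ᴹ-trans (≈ᴹ-sym (comb-push (fun f) (d ∘ fun f) ρ)) (comb-cong ρ same)
      where
      same : pushforward (fun f) (d ∘ fun f) ≗ d
      same j with j Subₚ.∈? (fun f [ S ])
      ... | yes j∈ with ∈-image⁻ (fun f) S j∈
      ...   | i , _ , refl = pushforward-at (fun f) (d ∘ fun f) f.injective i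
      same j | no j∉ = trans
        (pushforward-off (fun f) (d ∘ fun f) j λ { i refl → sd (fun f i) j∉ })
        (sym (sd j j∉))

    free⇒ : ∀ {S} → Free ρ (fun f [ S ]) → Free (ρ ∘ fun f) S
    free⇒ {S} free c sc eq i = trans
      (sym (pushforward-at (fun f) c f.injective i))
      (free (pushforward (fun f) c)
        (λ j j∉ → pushforward-off (fun f) c j λ k fk≡j → sc k λ k∈S →
          j∉ (subst (_∈ _) fk≡j (∈-image⁺ (fun f) k∈S)))
        (≈ᴹ-trans (comb-push (fun f) c ρ) eq) (fun f i))

    free⇐ : ∀ {S} → Free (ρ ∘ fun f) S → Free ρ (fun f [ S ])
    free⇐ {S} free d sd eq j with j Subₚ.∈? (fun f [ S ])
    ... | no  j∉ = sd j j∉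
    ... | yes j∈ with ∈-image⁻ (fun f) S j∈
    ...   | i , _ , refl = free (d ∘ fun f)
              (λ k k∉S → sd (fun f k) λ fk∈ →
                let (k′ , k′∈S , eq) = ∈-image⁻ (fun f) S fk∈ in
                k∉S (subst (_∈ S) (f.injective eq) k′∈S))
              (≈ᴹ-trans (back d sd) eq) i

  pullback : FamilyRepresentation M V (ρ ∘ fun f)
  pullback = record
    { _≟ᴹ_  = F._≟ᴹ_
    ; free⇔ = λ S →
        let module f⇔ = Equivalence (f.indep⇔ S)
            module F⇔ = Equivalence (F.free⇔ (fun f [ S ]))
        in  mk⇔ (free⇒ ∘ F⇔.to ∘ f⇔.to) (f⇔.from ∘ F⇔.from ∘ free⇐)
    ; spans = λ v →
        let ((B , indB , ∣B∣≡r) , _) = rankM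
            (d , sd , eq) = basis-spans F (proj₂ rankN)
              (Equivalence.to (f.indep⇔ B) indB)
              (ℕₚ.≤-trans (ℕₚ.≤-reflexive (sym ∣B∣≡r))
                          (∣∣≤∣image∣ (fun f) f.injective B)) v
        in  d ∘ fun f , ≈ᴹ-trans (back d sd) eq
    }

  private
    classify₁ : ∀ w → Extend.extend +ᴹ-abelianGroup ρ (H₁-map f w) ≡
                      Extend.extend +ᴹ-abelianGroup (ρ ∘ fun f) w
    classify₁ (gen x) = refl
    classify₁ (u ⊞ v) = cong₂ _+ᴹ_ (classify₁ u) (classify₁ v)
    classify₁ 𝟘       = refl
    classify₁ (⊟ u)   = cong -ᴹ_ (classify₁ u)

    classify-map : ∀ w → classify F (H₁𝔽₂-map f w) ≡ classify pullback w
    classify-map (gen (h , b)) = cong (b *ₗ_) (classify₁ h)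
    classify-map (u ⊞ v) = cong₂ _+ᴹ_ (classify-map u) (classify-map v)
    classify-map 𝟘       = refl
    classify-map (⊟ u)   = cong -ᴹ_ (classify-map u)

    module φN = _≅_ (H₁𝔽₂≅V F)
    module φM = _≅_ (H₁𝔽₂≅V pullback)
    module HM = Module (H₁𝔽₂ M)
    module HN = Module (H₁𝔽₂ N)

  H₁𝔽₂-iso : H₁𝔽₂ M ≅ H₁𝔽₂ N
  H₁𝔽₂-iso = mk≅ (H₁𝔽₂-map f) (H₁𝔽₂-map-cong f) (λ _ _ → ~-refl) map-*
    (λ w eq → φM.injective (≈ᴹ-trans (≈ᴹ-reflexive (sym (classify-map w))) (φN.⟦⟧-cong eq)))
    (λ y → let (x , eq) = φM.surjective (φN.to y) in
      x , φN.injective (≈ᴹ-trans (≈ᴹ-reflexive (classify-map x)) (eq HM.≈ᴹ-refl)))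
    where
    map-* : ∀ c w → H₁𝔽₂-map f (c HM.*ₗ w) HN.≈ᴹ c HN.*ₗ H₁𝔽₂-map f w
    map-* true  w = HN.≈ᴹ-trans (H₁𝔽₂-map-cong f (HM.*ₗ-identityˡ w))
                                (HN.≈ᴹ-sym (HN.*ₗ-identityˡ _))
    map-* false w = HN.≈ᴹ-trans (H₁𝔽₂-map-cong f (HM.*ₗ-zeroˡ w))
                                (HN.≈ᴹ-sym (HN.*ₗ-zeroˡ (H₁𝔽₂-map f w)))

mod2Homology : ∀ r → Functor (ℳ r) (𝒢ℓ r)
mod2Homology r = record
  { F₀     = λ M → H₁𝔽₂ (matroid M) , coordinates M
  ; F₁     = λ {M} {N} f → H₁𝔽₂-iso (rank M) (rank N) f (family (binary N))
  ; F-cong = λ {M} {N} {f} {g} f≗g w →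
      Module.≈ᴹ-reflexive (H₁𝔽₂ (matroid N)) (H₁𝔽₂-map-≗ f g f≗g w)
  ; F-id   = λ {M} w →
      Module.≈ᴹ-reflexive (H₁𝔽₂ (matroid M)) (H₁𝔽₂-map-id w)
  ; F-∙    = λ {_} {_} {N} g f w →
      Module.≈ᴹ-reflexive (H₁𝔽₂ (matroid N)) (H₁𝔽₂-map-∘ g f w)
  }
  where
  open BinaryMatroid
  coordinates : ∀ M → 𝔽₂^ r ≅ H₁𝔽₂ (matroid M)
  coordinates M =
    let F = family (binary M)
        ((_ , indep , ∣B∣≡r) , bound) = rank M
    in  ≅-sym (H₁𝔽₂≅V F) ∘≅ basis≅ F bound indep ∣B∣≡r

{-# OPTIONS --safe #-}

-- A natural transformation induces a homotopy between the maps of classifying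
-- spaces. By passing to coordinates, send a space of dimension r to the matroid
-- of all vectors of 𝔽₂^r. On 𝒢ℓ this composes with homology to a functor
-- naturally isomorphic to the identity. On ℳ the other composite is joined to
-- the identity by the zigzag M → T(M) ← 𝔽₂^r, where T(M) is M with all vectors
-- of its homology added as further elements; the detour is needed since
-- morphisms are injective while M may have loops and parallel elements.
--
-- For the homotopy, a point (s , t) of Δⁿ × 𝕀 is the pair of marginals of
-- weights on a chain in {0 < ⋯ < n} × {0 < 1}. Any two such weighted chains give
-- the same point of |X × Δ¹|, so choosing one defines |X| × 𝕀 → |X × Δ¹|; it is
-- continuous for the product topology because the interval is locally compact.
module Submission where

open import Algebra.Bundles using (CommutativeMonoid)
open import Algebra.Module.Bundles using (Module)
open import Axiom.ExcludedMiddle using (ExcludedMiddle)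
open import Data.Bool.Base using (Bool; true; false; if_then_else_; T; _xor_; _∧_)
import Data.Bool.Properties as Boolₚ
open import Data.Empty using (⊥; ⊥-elim)
open import Data.Fin.Base
  using (Fin; zero; suc; toℕ; pinch; inject₁; combine; finToFun; funToFin; splitAt; join; _↑ˡ_; _↑ʳ_)
  renaming (_≤_ to _≤ᶠ_)
import Data.Fin.Properties as Finₚ
open import Data.Fin.Subset using (Subset; _∈_; _∉_; _⊆_; _∪_; ⁅_⁆; ∣_∣) renaming (⊥ to ∅)
import Data.Fin.Subset.Properties as Subₚ
open import Data.Integer.Base as ℤ using (+_; -[1+_])
import Data.Integer.Properties as ℤₚ
open import Data.Nat.Base as ℕ using (ℕ; zero; suc; z≤n; s≤s)
import Data.Nat.Properties as ℕₚ
open import Data.Product.Base using (Σ; ∃; _×_; _,_; proj₁; proj₂)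
open import Data.Rational.Base as ℚ using (ℚ; 0ℚ; 1ℚ)
import Data.Rational.Properties as ℚₚ
open import Data.Rational.Solver using (module +-*-Solver)
import Data.Rational.Unnormalised.Base as ℚᵘ
import Data.Rational.Unnormalised.Properties as ℚᵘₚ
open import Data.Sum.Base as Sum using (_⊎_; inj₁; inj₂)
import Data.Sum.Properties as Sumₚ
open import Data.Unit.Polymorphic.Base using (⊤; tt)
open import Data.Vec.Base using (_∷_; tabulate)
import Data.Vec.Properties as Vecₚ
open import Function.Base using (_∘_; id)
open import Function.Bundles using (_⇔_; mk⇔; Inverse)
open import Function.Definitions using (Injective)
open import Function.Properties.Equivalence using () renaming (sym to ⇔-sym; trans to ⇔-trans)
open import Level using (_⊔_; 0ℓ; Lift; lift) renaming (suc to lsuc)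
open import Relation.Binary.Bundles using (Setoid)
import Relation.Binary.Construct.Closure.Equivalence as EqC
import Relation.Binary.Definitions as RB
open import Relation.Binary.Definitions using (_Respects_)
open import Relation.Binary.PropositionalEquality
  using (_≡_; _≢_; _≗_; refl; sym; trans; cong; cong₂; subst)
open import Relation.Nullary using (¬_; Dec; yes; no; does; contradiction)
open import Relation.Nullary.Decidable
  using (True; toWitness; fromWitness; decidable-stable; map′; dec-true)
open import Relation.Unary using (Pred; _∩_)
open import Defs

-- Dedekind cuts

-- The prism map rests on choices that need not vary continuously, so its continuity comes from
-- uniqueness. Within a fixed shape of chain the tail sums of the weights are forced: they are those
-- of s with t inserted at its place. Hence the weights depend only on (s , t), and continuously.
-- Chains of different shapes over the same (s , t) differ only at vertices of weight 0, which
-- gluing ignores. Excluded middle decides comparisons of reals, and through them which shape to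
-- use.
--
-- For matroids, naturality dictates the construction. The vectors of a chosen representation of M
-- bear no relation to those of another matroid, so elements are represented by their homology
-- classes instead. A morphism then acts on these classes and on the added vectors through one and
-- the same matrix, which is what makes T a functor and both legs of the zigzag natural. A thickened
-- matroid is a labelled family of vectors rather than a set, so an old element and an added one may
-- carry the same vector and stay distinct.

private
  module ℝ⁺ = CommutativeMonoid +ʳ-commutativeMonoid
  module Σʳ = SumLemmas +ʳ-commutativeMonoid

  -- Built by adding `1ℚ` so that the search in `approximate` can peel off one step of length ε at a
  -- time.
  ι : ℕ → ℚ
  ι zero    = 0ℚ
  ι (suc n) = 1ℚ ℚ.+ ι n

  toℚᵘ-ι : ∀ n → ℚ.toℚᵘ (ι n) ℚᵘ.≃ ℚᵘ.mkℚᵘ (+ n) 0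
  toℚᵘ-ι zero    = ℚᵘₚ.≃-refl
  toℚᵘ-ι (suc n) = ℚᵘₚ.≃-trans (ℚₚ.toℚᵘ-homo-+ 1ℚ (ι n))
    (ℚᵘₚ.≃-trans (ℚᵘₚ.+-congʳ (ℚᵘ.mkℚᵘ (+ 1) 0) (toℚᵘ-ι n))
      (ℚᵘ.*≡* (cong (λ m → (+ 1 ℤ.+ m) ℤ.* + 1) (ℤₚ.*-identityʳ (+ n)))))

  -- A nonnegative fraction is at most its numerator, and a negative one is at most 0.
  ≤ι : ∀ q → ∃ λ n → q ℚ.≤ ι n
  ≤ι q@(ℚ.mkℚ (+ n) d c) = n , ℚₚ.toℚᵘ-cancel-≤
    (ℚᵘₚ.≤-respʳ-≃ {ℚ.toℚᵘ q} (ℚᵘₚ.≃-sym (toℚᵘ-ι n))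
      (ℚᵘ.*≤* (ℤₚ.*-monoˡ-≤-nonNeg (+ n) {+ 1} {+ suc d} (ℤ.+≤+ (ℕ.s≤s ℕ.z≤n)))))
  ≤ι (ℚ.mkℚ -[1+ n ] d c) = 0 , ℚₚ.toℚᵘ-cancel-≤ (ℚᵘ.*≤* ℤ.-≤+)

subst₂-< : ∀ {a a′ b b′} → a ≡ a′ → b ≡ b′ → a ℚ.< b → a′ ℚ.< b′
subst₂-< refl refl lt = lt

p-q+q : ∀ p q → p ℚ.- q ℚ.+ q ≡ p
p-q+q = solve 2 (λ p q → p :- q :+ q := p) refl
  where open +-*-Solver

p+q-q : ∀ p q → p ℚ.+ q ℚ.- q ≡ p
p+q-q = solve 2 (λ p q → p :+ q :- q := p) refl
  where open +-*-Solver

q+[p-q] : ∀ p q → q ℚ.+ (p ℚ.- q) ≡ p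
q+[p-q] = solve 2 (λ p q → q :+ (p :- q) := p) refl
  where open +-*-Solver

ℚ-archimedean : ∀ p {ε} → 0ℚ ℚ.< ε → ∃ λ n → p ℚ.≤ ι n ℚ.* ε
ℚ-archimedean p {ε} ε>0 = n , (begin
    p                   ≡⟨ ℚₚ.*-identityʳ p ⟨
    p ℚ.* 1ℚ            ≡⟨ cong (p ℚ.*_) (ℚₚ.*-inverseˡ ε) ⟨
    p ℚ.* (ℚ.1/ ε ℚ.* ε) ≡⟨ ℚₚ.*-assoc p _ ε ⟨
    p ℚ.* ℚ.1/ ε ℚ.* ε  ≤⟨ ℚₚ.*-monoʳ-≤-nonNeg ε (proj₂ bound) ⟩
    ι n ℚ.* ε           ∎)
  where
  open ℚₚ.≤-Reasoning
  instance
    ε-pos : ℚ.Positive ε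
    ε-pos = ℚ.positive ε>0
    ε-nonZero : ℚ.NonZero ε
    ε-nonZero = ℚₚ.pos⇒nonZero ε
    ε-nonNeg : ℚ.NonNegative ε
    ε-nonNeg = ℚₚ.pos⇒nonNeg ε
  bound : ∃ λ n → p ℚ.* ℚ.1/ ε ℚ.≤ ι n
  bound = ≤ι _
  n : ℕ
  n = proj₁ bound

<⇒0<- : ∀ {p q} → p ℚ.< q → 0ℚ ℚ.< q ℚ.- p
<⇒0<- {p} {q} p<q = subst (ℚ._< q ℚ.- p) (ℚₚ.+-inverseʳ p) (ℚₚ.+-monoˡ-< (ℚ.- p) p<q)

+-cancelʳ-< : ∀ {p q} r → p ℚ.+ r ℚ.< q ℚ.+ r → p ℚ.< q
+-cancelʳ-< {p} {q} r lt = subst₂-< (p+q-q p r) (p+q-q q r) (ℚₚ.+-monoˡ-< (ℚ.- r) lt)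

below<above : ∀ (x : ℝ) {p q} → Below x p → ¬ Below x q → p ℚ.< q
below<above x {p} {q} b ¬b with ℚₚ.<-cmp p q
... | RB.tri< p<q _ _  = p<q
... | RB.tri≈ _ refl _ = contradiction b ¬b
... | RB.tri> _ _ q<p  = contradiction (down x q<p b) ¬b

down-≤ : ∀ (x : ℝ) {p q} → p ℚ.≤ q → Below x q → Below x p
down-≤ x {p} {q} p≤q b with ℚₚ.<-cmp p q
... | RB.tri< p<q _ _  = down x p<q b
... | RB.tri≈ _ refl _ = b
... | RB.tri> _ _ q<p  = ⊥-elim (ℚₚ.<-irrefl refl (ℚₚ.<-≤-trans q<p p≤q))

Below⇒<ʳ : ∀ {x q} → Below x q → fromℚ q <ʳ x
Below⇒<ʳ {q = q} b = <ʳ⁺ (q , ℚₚ.<-irrefl refl , b)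

<ʳ⇒Below : ∀ {x q} → fromℚ q <ʳ x → Below x q
<ʳ⇒Below {x} (<ʳ⁺ (p , p≮q , b)) = down-≤ x (ℚₚ.≮⇒≥ p≮q) b

<ʳ⇒≤ʳ : ∀ {x y} → x <ʳ y → x ≤ʳ y
<ʳ⇒≤ʳ {x} {y} (<ʳ⁺ (q , ¬b , b)) = ≤ʳ⁺ λ bp → down y (below<above x bp ¬b) b

≤ʳ-<ʳ-trans : ∀ {x y z} → x ≤ʳ y → y <ʳ z → x <ʳ z
≤ʳ-<ʳ-trans x≤y (<ʳ⁺ (q , ¬b , b)) = <ʳ⁺ (q , ¬b ∘ ≤ʳ⁻ x≤y , b)

<ʳ-irrefl : ∀ {x y} → x <ʳ y → ¬ y ≤ʳ x
<ʳ-irrefl (<ʳ⁺ (q , ¬b , b)) y≤x = ¬b (≤ʳ⁻ y≤x b)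

_⊓ʳ_ : ℝ → ℝ → ℝ
Below (x ⊓ʳ y) q = Below x q × Below y q
inhabited (x ⊓ʳ y) =
  let (p , bp) = inhabited x ; (q , bq) = inhabited y in
  p ℚ.⊓ q , down-≤ x (ℚₚ.p⊓q≤p p q) bp , down-≤ y (ℚₚ.p⊓q≤q p q) bq
proper (x ⊓ʳ y) = let (p , ¬b) = proper x in p , ¬b ∘ proj₁
down (x ⊓ʳ y) p<q (b , b′) = down x p<q b , down y p<q b′
rounded (x ⊓ʳ y) (b , b′) with rounded x b | rounded y b′
... | p , lt , bp | q , lt′ , bq with ℚₚ.⊓-sel p q
...   | inj₁ eq = p ℚ.⊓ q , subst (_ ℚ.<_) (sym eq) lt
                , down-≤ x (ℚₚ.p⊓q≤p p q) bp , down-≤ y (ℚₚ.p⊓q≤q p q) bq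
...   | inj₂ eq = p ℚ.⊓ q , subst (_ ℚ.<_) (sym eq) lt′
                , down-≤ x (ℚₚ.p⊓q≤p p q) bp , down-≤ y (ℚₚ.p⊓q≤q p q) bq

-- Since ¬ Below y r means y ≤ r, the lower cut of x - y consists of the q with
-- q + r < x for some rational r ≥ y.
_-ʳ_ : ℝ → ℝ → ℝ
Below (x -ʳ y) q = ∃ λ r → ¬ Below y r × Below x (q ℚ.+ r)
inhabited (x -ʳ y) =
  let (p , bp) = inhabited x ; (r , ¬br) = proper y in
  p ℚ.- r , r , ¬br , subst (Below x) (sym (p-q+q p r)) bp
proper (x -ʳ y) =
  let (u , ¬bu) = proper x ; (p , bp) = inhabited y in
  u ℚ.- p , λ (r , ¬br , b) → ℚₚ.<-asym (below<above y bp ¬br)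
    (+-cancelʳ-< (u ℚ.- p) (subst₂-< (ℚₚ.+-comm (u ℚ.- p) r) (sym (q+[p-q] u p))
                                     (below<above x b ¬bu)))
down (x -ʳ y) p<q (r , ¬br , b) = r , ¬br , down x (ℚₚ.+-monoˡ-< r p<q) b
rounded (x -ʳ y) {q} (r , ¬br , b) =
  let (s , lt , bs) = rounded x b in
  s ℚ.- r , +-cancelʳ-< r (subst (q ℚ.+ r ℚ.<_) (sym (p-q+q s r)) lt)
  , r , ¬br , subst (Below x) (sym (p-q+q s r)) bs

module Reals (em : ∀ {ℓ} → ExcludedMiddle ℓ) where

  abstract
    dne : ∀ {ℓ} {P : Set ℓ} → ¬ ¬ P → P
    dne = decidable-stable em

    ≤ʳ⊎<ʳ : ∀ x y → x ≤ʳ y ⊎ y <ʳ x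
    ≤ʳ⊎<ʳ x y with em {P = ∃ λ q → ¬ Below y q × Below x q}
    ... | yes gap  = inj₂ (<ʳ⁺ gap)
    ... | no  none = inj₁ (≤ʳ⁺ λ {q} b → dne λ ¬b → none (q , ¬b , b))

    -- Walk up from a rational below x in steps of ε. The walk leaves the cut after finitely many
    -- steps, and the last position inside is the answer. This is what makes subtraction of cuts
    -- exact.
    approximate : ∀ x {ε} → 0ℚ ℚ.< ε → ∃ λ p → Below x p × ¬ Below x (p ℚ.+ ε)
    approximate x {ε} ε>0 =
      let (p , bp) = inhabited x
          (u , ¬bu) = proper x
          (n , u-p≤) = ℚ-archimedean (u ℚ.- p) ε>0
      in  search n p bp λ b → ¬bu (down-≤ x (bound u p (ι n ℚ.* ε) u-p≤) b)
      where
      bound : ∀ u p v → u ℚ.- p ℚ.≤ v → u ℚ.≤ p ℚ.+ v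
      bound u p v le = subst (ℚ._≤ p ℚ.+ v) (q+[p-q] u p) (ℚₚ.+-monoʳ-≤ p le)
      step : ∀ p i → p ℚ.+ ε ℚ.+ i ℚ.* ε ≡ p ℚ.+ (1ℚ ℚ.+ i) ℚ.* ε
      step p i = eq p i ε
        where
        eq : ∀ p i ε → p ℚ.+ ε ℚ.+ i ℚ.* ε ≡ p ℚ.+ (1ℚ ℚ.+ i) ℚ.* ε
        eq = solve 3 (λ p i ε → p :+ ε :+ i :* ε := p :+ (con 1ℚ :+ i) :* ε) refl
          where open +-*-Solver
      search : ∀ n p → Below x p → ¬ Below x (p ℚ.+ ι n ℚ.* ε) →
               ∃ λ p → Below x p × ¬ Below x (p ℚ.+ ε)
      search zero    p bp ¬b = contradiction
        (subst (Below x) (sym (trans (cong (p ℚ.+_) (ℚₚ.*-zeroˡ ε)) (ℚₚ.+-identityʳ p))) bp) ¬b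
      search (suc n) p bp ¬b with em {P = Below x (p ℚ.+ ε)}
      ... | no  ¬bε = p , bp , ¬bε
      ... | yes bε  = search n (p ℚ.+ ε) bε λ b → ¬b (subst (Below x)
              (step p (ι n)) b)

    +-minus : ∀ x y → y +ʳ (x -ʳ y) ≈ʳ x
    +-minus x y =
        ≤ʳ⁺ (λ { (p , q , bp , (r , ¬br , b) , refl) → down x
          (subst (ℚ._< q ℚ.+ r) (ℚₚ.+-comm q p) (ℚₚ.+-monoʳ-< q (below<above y bp ¬br))) b })
      , ≤ʳ⁺ λ {s} bs →
          -- Roundedness leaves a gap s′ - s under x. As p comes within that gap of the supremum of
          -- y, p + (s′ - s) bounds y and witnesses that s - p lies below x - y.
          let (s′ , s<s′ , bs′) = rounded x bs
              (p , bp , ¬bp) = approximate y (<⇒0<- s<s′)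
          in  p , s ℚ.- p , bp
              , (p ℚ.+ (s′ ℚ.- s) , ¬bp , subst (Below x) (telescope p s s′) bs′)
              , sym (q+[p-q] s p)
      where
      telescope : ∀ p s s′ → s′ ≡ s ℚ.- p ℚ.+ (p ℚ.+ (s′ ℚ.- s))
      telescope = solve 3 (λ p s s′ → s′ := s :- p :+ (p :+ (s′ :- s))) refl
        where open +-*-Solver

    +-cancelˡ-≤ : ∀ a {x y} → a +ʳ x ≤ʳ a +ʳ y → x ≤ʳ y
    +-cancelˡ-≤ a {x} {y} le = ≤ʳ-trans (proj₂ (undo x))
      (≤ʳ-trans (+ʳ-mono (≤ʳ-refl {0ʳ -ʳ a}) le) (proj₁ (undo y)))
      where
      undo : ∀ z → (0ʳ -ʳ a) +ʳ (a +ʳ z) ≈ʳ z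
      undo z = ℝ⁺.trans (ℝ⁺.sym (ℝ⁺.assoc (0ʳ -ʳ a) a z))
        (ℝ⁺.trans (ℝ⁺.∙-congʳ (ℝ⁺.trans (ℝ⁺.comm (0ʳ -ʳ a) a) (+-minus 0ʳ a))) (ℝ⁺.identityˡ z))

    +-cancelˡ : ∀ a {x y} → a +ʳ x ≈ʳ a +ʳ y → x ≈ʳ y
    +-cancelˡ a (le , ge) = +-cancelˡ-≤ a le , +-cancelˡ-≤ a ge

    minus-≥0 : ∀ {x y} → y ≤ʳ x → 0ʳ ≤ʳ x -ʳ y
    minus-≥0 {x} {y} y≤x = +-cancelˡ-≤ y (≤ʳ-trans
      (proj₁ (ℝ⁺.identityʳ y)) (≤ʳ-trans y≤x (proj₂ (+-minus x y))))

-- Neighbourhoods and continuity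

-- P may lie in any universe and need not be open, so conditions can be combined around a point
-- before an open set is named; `near⇒open` returns to open sets.
record Near {e o ℓ} (X : Space e o) (x : Space.Point X) (P : Pred (Space.Point X) ℓ)
            : Set (lsuc 1ℓ ⊔ o ⊔ ℓ) where
  constructor near
  field
    nbhd     : Pred (Space.Point X) 1ℓ
    isOpen   : Space.Open X nbhd
    contains : nbhd x
    inside   : ∀ {y} → nbhd y → P y

open Near

module _ {e o} {X : Space e o} where
  open Space X

  near-map : ∀ {ℓ ℓ′ x} {P : Pred Point ℓ} {Q : Pred Point ℓ′} →
             (∀ {y} → P y → Q y) → Near X x P → Near X x Q
  near-map P⊆Q (near U oU x∈U U⊆P) = near U oU x∈U (P⊆Q ∘ U⊆P)

  near-∩ : ∀ {ℓ ℓ′ x} {P : Pred Point ℓ} {Q : Pred Point ℓ′} →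
           Near X x P → Near X x Q → Near X x (P ∩ Q)
  near-∩ (near U oU x∈U U⊆P) (near V oV x∈V V⊆Q) =
    near (U ∩ V) (open-∩ oU oV) (x∈U , x∈V) λ (y∈U , y∈V) → U⊆P y∈U , V⊆Q y∈V

  near-true : ∀ {ℓ x} {P : Pred Point ℓ} → (∀ y → P y) → Near X x P
  near-true all = near (λ _ → ⊤) open-⊤ tt λ {y} _ → all y

  near-∀ : ∀ {ℓ x n} {P : Fin n → Pred Point ℓ} →
           (∀ i → Near X x (P i)) → Near X x (λ y → ∀ i → P i y)
  near-∀ {n = zero}  nears = near-true λ _ ()
  near-∀ {n = suc n} nears = near-map
    (λ { (p , ps) zero → p ; (p , ps) (suc i) → ps i })
    (near-∩ (nears zero) (near-∀ (nears ∘ suc)))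

  open⇒near : ∀ {U x} → Open U → U x → Near X x U
  open⇒near {U} oU x∈U = near U oU x∈U id

  near⇒open : ∀ {U} → (∀ x → U x → Near X x U) → Open U
  near⇒open {U} nears = open-≐
    ( (λ ((x , x∈U) , y∈) → inside (nears x x∈U) y∈)
    , λ {x} x∈U → (x , x∈U) , contains (nears x x∈U) )
    (open-⋃ {J = Σ Point U} (λ (x , x∈U) → nbhd (nears x x∈U))
            (λ (x , x∈U) → isOpen (nears x x∈U)))

module _ {e o e′ o′} {X : Space e o} {Y : Space e′ o′} where
  private
    module X = Space X
    module Y = Space Y

  near-proj₁ : ∀ {ℓ x y} {P : Pred X.Point ℓ} →
               Near X x P → Near (X ×ₜ Y) (x , y) (P ∘ proj₁)
  near-proj₁ (near U oU x∈U U⊆P) = near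
    (U ∘ proj₁)
    (λ a b a∈U → U , (λ _ → ⊤) , oU , Y.open-⊤ , a∈U , tt , λ _ _ a′∈U _ → a′∈U)
    x∈U U⊆P

  near-proj₂ : ∀ {ℓ x y} {P : Pred Y.Point ℓ} →
               Near Y y P → Near (X ×ₜ Y) (x , y) (P ∘ proj₂)
  near-proj₂ (near U oU y∈U U⊆P) = near
    (U ∘ proj₂)
    (λ a b b∈U → (λ _ → ⊤) , U , X.open-⊤ , oU , tt , b∈U , λ _ _ _ b′∈U → b′∈U)
    y∈U U⊆P

  near-×⁻ : ∀ {ℓ x y} {P : Pred (X.Point × Y.Point) ℓ} → Near (X ×ₜ Y) (x , y) P →
            ∃ λ V → ∃ λ W → X.Open V × Y.Open W × V x × W y × (∀ a b → V a → W b → P (a , b))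
  near-×⁻ (near U oU xy∈U U⊆P) =
    let (V , W , oV , oW , x∈V , y∈W , sub) = oU _ _ xy∈U in
    V , W , oV , oW , x∈V , y∈W , λ a b a∈V b∈W → U⊆P (sub a b a∈V b∈W)

  open-×⁺ : ∀ {U : Pred (X.Point × Y.Point) 1ℓ} →
            (∀ x y → U (x , y) → Near (X ×ₜ Y) (x , y) U) → Space.Open (X ×ₜ Y) U
  open-×⁺ nears x y u = near-×⁻ (nears x y u)

-- The two semicontinuities. For a lower cut, q < f x is just `Below (f x) q`, whereas f x < q must
-- leave a rational gap, hence `_<ʳ_`.
record ContinuousAt {e o} (X : Space e o) (f : Space.Point X → ℝ) (x : Space.Point X)
                    : Set (lsuc 1ℓ ⊔ e ⊔ o) where
  field
    lower-near : ∀ {q} → Below (f x) q → Near X x λ y → Below (f y) q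
    upper-near : ∀ {q} → f x <ʳ fromℚ q → Near X x λ y → f y <ʳ fromℚ q

open ContinuousAt public

module _ {n} {A : Setoid 1ℓ 0ℓ} {coords : Setoid.Carrier A → Fin n → ℝ}
         {coords-cong : ∀ {x y} → Setoid._≈_ A x y → ∀ i → coords x i ≈ʳ coords y i} where
  private
    S : Space 0ℓ 1ℓ
    S = subspace A coords coords-cong

  near-box : ∀ {ℓ x} {P : Pred (Setoid.Carrier A) ℓ} b → coords x ∈ᴮ b →
             (∀ {y} → coords y ∈ᴮ b → P y) → Near S x P
  near-box b x∈b b⊆P = near (λ y → Lift 1ℓ (coords y ∈ᴮ b))
    (λ { y (lift y∈b) → b , y∈b , λ _ → lift }) (lift x∈b) λ { (lift y∈b) → b⊆P y∈b }

  coord-continuous : ∀ i x → ContinuousAt S (λ y → coords y i) x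
  coord-continuous i x = record
    { lower-near = λ {q} x∋q → near-box
        (record { lower = λ j → if does (j Finₚ.≟ i) then q else Box.lower around j
                ; upper = Box.upper around })
        (λ j → lo j x∋q , proj₂ (x∈around j))
        (λ {y} y∈ → <ʳ⇒Below (lo⁻ y (proj₁ (y∈ i))))
    ; upper-near = λ {q} x<q → near-box
        (record { lower = Box.lower around
                ; upper = λ j → if does (j Finₚ.≟ i) then q else Box.upper around j })
        (λ j → proj₁ (x∈around j) , hi j x<q)
        (λ {y} y∈ → hi⁻ y (proj₂ (y∈ i)))
    }
    where
    -- A box bounds every coordinate, so some box around x is needed before the single bound at i is
    -- replaced.
    ∃around = Space.open-⊤ S x tt
    around = proj₁ ∃around
    x∈around = proj₁ (proj₂ ∃around)
    lo : ∀ j {q} → Below (coords x i) q →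
         fromℚ (if does (j Finₚ.≟ i) then q else Box.lower around j) <ʳ coords x j
    lo j x∋q with j Finₚ.≟ i
    ... | yes refl = Below⇒<ʳ x∋q
    ... | no  _    = proj₁ (x∈around j)
    lo⁻ : ∀ y {q} → fromℚ (if does (i Finₚ.≟ i) then q else Box.lower around i) <ʳ coords y i →
          fromℚ q <ʳ coords y i
    lo⁻ y q< with i Finₚ.≟ i
    ... | yes _  = q<
    ... | no i≢i = contradiction refl i≢i
    hi : ∀ j {q} → coords x i <ʳ fromℚ q →
         coords x j <ʳ fromℚ (if does (j Finₚ.≟ i) then q else Box.upper around j)
    hi j x<q with j Finₚ.≟ i
    ... | yes refl = x<q
    ... | no  _    = proj₂ (x∈around j)
    hi⁻ : ∀ y {q} → coords y i <ʳ fromℚ (if does (i Finₚ.≟ i) then q else Box.upper around i) →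
          coords y i <ʳ fromℚ q
    hi⁻ y <q with i Finₚ.≟ i
    ... | yes _  = <q
    ... | no i≢i = contradiction refl i≢i

continuous-proj₁ : ∀ {e o e′ o′} {X : Space e o} {Y : Space e′ o′} {f x y} →
                   ContinuousAt X f x → ContinuousAt (X ×ₜ Y) (f ∘ proj₁) (x , y)
continuous-proj₁ {X = X} {Y} {f} c = record
  { lower-near = λ {q} b → near-proj₁ {X = X} {Y} (lower-near c b)
  ; upper-near = λ {q} b → near-proj₁ {X = X} {Y} (upper-near c b) }

continuous-proj₂ : ∀ {e o e′ o′} {X : Space e o} {Y : Space e′ o′} {f x y} →
                   ContinuousAt Y f y → ContinuousAt (X ×ₜ Y) (f ∘ proj₂) (x , y)
continuous-proj₂ {X = X} {Y} {f} c = record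
  { lower-near = λ {q} b → near-proj₂ {X = X} {Y} (lower-near c b)
  ; upper-near = λ {q} b → near-proj₂ {X = X} {Y} (upper-near c b) }

module Continuity (em : ∀ {ℓ} → ExcludedMiddle ℓ) {e o} (X : Space e o) where
  open Space X using (Point)
  open Reals em

  continuous-const : ∀ c x → ContinuousAt X (λ _ → c) x
  continuous-const c x = record
    { lower-near = λ b → near-true λ _ → b ; upper-near = λ b → near-true λ _ → b }

  continuous-+ : ∀ {f g x} → ContinuousAt X f x → ContinuousAt X g x →
                 ContinuousAt X (λ y → f y +ʳ g y) x
  continuous-+ {f} {g} {x} cf cg = record
    { lower-near = λ (p , q , bp , bq , eq) → near-map (λ (bp , bq) → p , q , bp , bq , eq)
        (near-∩ (lower-near cf bp) (lower-near cg bq))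
    ; upper-near = upper
    }
    where
    upper : ∀ {u} → f x +ʳ g x <ʳ fromℚ u → Near X x λ y → f y +ʳ g y <ʳ fromℚ u
    upper {u} (<ʳ⁺ (v , ¬bv , v<u)) =
      -- The slack from v to u is cut at w and w′: the first piece is the error in approximating f
      -- x, the other two enlarge the bounds for f and for g so that both hold strictly.
      let (w , v<w , w<u) = ℚₚ.<-dense v<u
          (w′ , w<w′ , w′<u) = ℚₚ.<-dense w<u
          (p , bp , ¬bp) = approximate (f x) (<⇒0<- v<w)
          a  = p ℚ.+ (w ℚ.- v)
          a⁺ = a ℚ.+ (w′ ℚ.- w)
          b  = v ℚ.- p
          b⁺ = b ℚ.+ (u ℚ.- w′)
          ¬bb : ¬ Below (g x) b
          ¬bb bb = ¬bv (p , b , bp , bb , sym (q+[p-q] v p))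
      in  near-map
            (λ { {y} (<ʳ⁺ (c , ¬c , c<) , <ʳ⁺ (d , ¬d , d<)) → <ʳ⁺ (c ℚ.+ d
              , (λ (r , s , br , bs , eq) → ℚₚ.<-irrefl (sym eq)
                  (ℚₚ.+-mono-< (below<above (f y) br ¬c) (below<above (g y) bs ¬d)))
              , subst (c ℚ.+ d ℚ.<_) (total p v w w′ u) (ℚₚ.+-mono-< c< d<)) })
            (near-∩ (upper-near cf (<ʳ⁺ (a , ¬bp , more a w<w′)))
                    (upper-near cg (<ʳ⁺ (b , ¬bb , more b w′<u))))
      where
      more : ∀ a {p q} → p ℚ.< q → a ℚ.< a ℚ.+ (q ℚ.- p)
      more a {p} {q} p<q = subst (ℚ._< a ℚ.+ (q ℚ.- p)) (ℚₚ.+-identityʳ a) (ℚₚ.+-monoʳ-< a (<⇒0<- p<q))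
      total : ∀ p v w w′ u →
              (p ℚ.+ (w ℚ.- v) ℚ.+ (w′ ℚ.- w)) ℚ.+ (v ℚ.- p ℚ.+ (u ℚ.- w′)) ≡ u
      total = solve 5 (λ p v w w′ u →
        (p :+ (w :- v) :+ (w′ :- w)) :+ (v :- p :+ (u :- w′)) := u) refl
        where open +-*-Solver

  -- Continuity of the difference h - g, but for an arbitrary solution a of a + g = h: the weights
  -- of a chain are known only through such equations, not as a function of the point.
  near-summand : ∀ {g h x a} → ContinuousAt X g x → ContinuousAt X h x → a +ʳ g x ≈ʳ h x →
    (∀ {q} → Below a q → Near X x λ y → ∀ {a′} → a′ +ʳ g y ≈ʳ h y → Below a′ q) ×
    (∀ {q} → a <ʳ fromℚ q → Near X x λ y → ∀ {a′} → a′ +ʳ g y ≈ʳ h y → a′ <ʳ fromℚ q)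
  near-summand {g} {h} {x} {a} cg ch a+g≈h = lower , upper
    where
    lower : ∀ {q} → Below a q → Near X x λ y → ∀ {a′} → a′ +ʳ g y ≈ʳ h y → Below a′ q
    lower {q} bq =
      let (q″ , q<q″ , bq″) = rounded a bq
          (q′ , q<q′ , q′<q″) = ℚₚ.<-dense q<q″
          (p , bp , ¬bp) = approximate (g x) (<⇒0<- q′<q″)
          -- Since q < q′, b exceeds g x strictly, while q + b = q″ + p is still below h x. Both
          -- persist nearby and force a′ above q.
          b  = p ℚ.+ (q″ ℚ.- q)
          bh : Below (h x) (q ℚ.+ b)
          bh = ≤ʳ⁻ (proj₁ a+g≈h) (q″ , p , bq″ , bp , total q p q″)
      in  near-map
            (λ { {y} (<ʳ⁺ (c , ¬c , c<b) , bh′) {a′} eq →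
              let (u , v , bu , bv , eq′) = ≤ʳ⁻ (proj₂ eq) bh′ in
              down a′ (+-cancelʳ-< v (subst (q ℚ.+ v ℚ.<_) eq′
                (ℚₚ.+-monoʳ-< q (ℚₚ.<-trans (below<above (g y) bv ¬c) c<b)))) bu })
            (near-∩ (upper-near cg (<ʳ⁺ (_ , ¬bp ,
                       ℚₚ.+-monoʳ-< p (ℚₚ.+-monoʳ-< q″ (ℚₚ.neg-antimono-< q<q′)))))
                    (lower-near ch bh))
      where
      total : ∀ q p q″ → q ℚ.+ (p ℚ.+ (q″ ℚ.- q)) ≡ q″ ℚ.+ p
      total = solve 3 (λ q p q″ → q :+ (p :+ (q″ :- q)) := q″ :+ p) refl
        where open +-*-Solver
    upper : ∀ {u} → a <ʳ fromℚ u → Near X x λ y → ∀ {a′} → a′ +ʳ g y ≈ʳ h y → a′ <ʳ fromℚ u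
    upper {u} (<ʳ⁺ (u′ , ¬bu′ , u′<u)) =
      let (w , u′<w , w<u) = ℚₚ.<-dense u′<u
          (p , bp , ¬bp) = approximate (g x) (<⇒0<- u′<w)
          ¬bh : ¬ Below (h x) (w ℚ.+ p)
          ¬bh bh = let (r , s , br , bs , eq) = ≤ʳ⁻ (proj₂ a+g≈h) bh in
            ℚₚ.<-irrefl (trans (sym eq) (total u′ p w))
              (ℚₚ.+-mono-< (below<above a br ¬bu′) (below<above (g x) bs ¬bp))
      in  near-map
            (λ { {y} (bp′ , <ʳ⁺ (d , ¬d , d<)) eq → <ʳ⁺ (d ℚ.- p
              , (λ b → ¬d (≤ʳ⁻ (proj₁ eq) (d ℚ.- p , p , b , bp′ , sym (p-q+q d p))))
              , subst (d ℚ.- p ℚ.<_) (p+q-q u p) (ℚₚ.+-monoˡ-< (ℚ.- p) d<)) })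
            (near-∩ (lower-near cg bp)
                    (upper-near ch (<ʳ⁺ (_ , ¬bh , ℚₚ.+-monoˡ-< p w<u))))
      where
      total : ∀ u′ p w → w ℚ.+ p ≡ u′ ℚ.+ (p ℚ.+ (w ℚ.- u′))
      total = solve 3 (λ u′ p w → w :+ p := u′ :+ (p :+ (w :- u′))) refl
        where open +-*-Solver

  near-< : ∀ {f g x} → ContinuousAt X f x → ContinuousAt X g x → f x <ʳ g x →
           Near X x λ y → f y <ʳ g y
  near-< {f} {g} {x} cf cg (<ʳ⁺ (q , ¬b , b)) =
    let (r , q<r , br) = rounded (g x) b in
    near-map
      (λ (f<r , br) → ≤ʳ-<ʳ-trans (<ʳ⇒≤ʳ f<r) (Below⇒<ʳ br))
      (near-∩ (upper-near cf (<ʳ⁺ (q , ¬b , q<r))) (lower-near cg br))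

-- Products with the interval and homotopies

module Topology (em : ∀ {ℓ} → ExcludedMiddle ℓ) where
  open Reals em

  module _ {e o} {X : Space e o} {O : Pred (Space.Point X × UnitPoint) 1ℓ}
           (openO : Space.Open (X ×ₜ 𝕀) O) (a b : ℚ) where
    open Space X using (Point)

    Tube : Pred Point 1ℓ
    Tube y = ∀ t → fromℚ a ≤ʳ value t → value t ≤ʳ fromℚ b → O (y , t)

    -- The supremum c of the q for which the part of the tube up to q can be
    -- thickened cannot have a neighbourhood on which O contains a rectangle.
    tube : ∀ {x} → Tube x → Near X x Tube
    tube {x} tube-x with em {P = Near X x Tube}
    ... | yes n    = n
    ... | no  ¬all = ⊥-elim absurd
      where
      Good : ℚ → Set _
      Good q = Near X x λ y → ∀ t → fromℚ a ≤ʳ value t → value t ≤ʳ fromℚ b →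
               value t ≤ʳ fromℚ q → O (y , t)

      good<1 : ∀ {q} → Good q → q ℚ.< 1ℚ
      good<1 {q} g = ℚₚ.≰⇒> λ 1≤q → ¬all (near-map
        (λ f t a≤t t≤b → f t a≤t t≤b
          (≤ʳ⁺ λ p∈t → ℚₚ.<-≤-trans (≤ʳ⁻ (UnitPoint.≤1 t) p∈t) 1≤q)) g)

      good<b : ∀ {q} → Good q → q ℚ.< b
      good<b {q} g = ℚₚ.≰⇒> λ b≤q → ¬all (near-map
        (λ f t a≤t t≤b → f t a≤t t≤b
          (≤ʳ⁺ λ p∈t → ℚₚ.<-≤-trans (≤ʳ⁻ t≤b p∈t) b≤q)) g)

      -- Below 0 or below a no t qualifies, so such q are good vacuously. This makes the cut c
      -- inhabited and places c above 0 and a.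
      good-low : ∀ {q} (r : UnitPoint → ℝ) → (∀ t → fromℚ a ≤ʳ value t → r t ≤ʳ value t) →
                 (∀ t → Below (r t) q) → Good q
      good-low r r≤ q∈r = near-true λ y t a≤t _ t≤q →
        ⊥-elim (ℚₚ.<-irrefl refl (≤ʳ⁻ t≤q (≤ʳ⁻ (r≤ t a≤t) (q∈r t))))

      -- `Good q′` lies in too large a universe for a cut, so it enters through its decision by
      -- excluded middle; the strict q < q′ makes the cut rounded.
      c : ℝ
      Below c q = ∃ λ q′ → q ℚ.< q′ × True (em {P = Good q′})
      inhabited c = let (p , p<-1) = inhabited (fromℚ (ℚ.- 1ℚ)) in
        p , ℚ.- 1ℚ , p<-1 , fromWitness (good-low (λ _ → 0ʳ)
          (λ t _ → UnitPoint.0≤ t) (λ _ → ℚₚ.negative⁻¹ (ℚ.- 1ℚ)))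
      proper c = 1ℚ , λ (q , 1<q , g) → ℚₚ.<-asym 1<q (good<1 (toWitness g))
      down c p<q (q′ , q<q′ , g) = q′ , ℚₚ.<-trans p<q q<q′ , g
      rounded c (q′ , q<q′ , g) = let (m , q<m , m<q′) = ℚₚ.<-dense q<q′ in
        m , q<m , q′ , m<q′ , g

      cᴵ : UnitPoint
      cᴵ = unitPoint c
        (≤ʳ⁺ λ q<0 → let (m , q<m , m<0) = ℚₚ.<-dense q<0 in
          m , q<m , fromWitness (good-low (λ _ → 0ʳ) (λ t _ → UnitPoint.0≤ t) (λ _ → m<0)))
        (≤ʳ⁺ λ (q′ , q<q′ , g) → ℚₚ.<-trans q<q′ (good<1 (toWitness g)))

      a≤c : fromℚ a ≤ʳ c
      a≤c = ≤ʳ⁺ λ q<a → let (m , q<m , m<a) = ℚₚ.<-dense q<a in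
        m , q<m , fromWitness (good-low (λ _ → fromℚ a) (λ t a≤t → a≤t) (λ _ → m<a))

      c≤b : c ≤ʳ fromℚ b
      c≤b = ≤ʳ⁺ λ (q′ , q<q′ , g) → ℚₚ.<-trans q<q′ (good<b (toWitness g))

      absurd : ⊥
      absurd =
        let (V , W , oV , oW , x∈V , c∈W , V×W⊆O) = openO x cᴵ (tube-x cᴵ a≤c c≤b)
            (β , c∈β , β⊆W) = oW cᴵ c∈W
            (q′ , l<q′ , g) = <ʳ⇒Below {c} (proj₁ (c∈β zero))
            (p , p∉c , p<u) = between (proj₂ (c∈β zero))
            -- As p is not below c, a good m above p is absurd. Up to q′ the old thickening serves,
            -- and from there to m the rectangle V × W does.
            (m , p<m , m<u) = ℚₚ.<-dense p<u
            extend : Good m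
            extend = near-map
              (λ { {y} (y∈V , f) t a≤t t≤b t≤m → Sum.[ f t a≤t t≤b
                 , (λ t∈β → V×W⊆O y t y∈V (β⊆W t t∈β)) ]′
                 (below-or-in β l<q′ t (<ʳ⁺ (m , ℚₚ.<-irrefl refl ∘ ≤ʳ⁻ t≤m , m<u))) })
              (near-∩ (open⇒near oV x∈V) (toWitness g))
        in  p∉c (m , p<m , fromWitness extend)
        where
        below-or-in : ∀ (β : Box 1) {q} → Box.lower β zero ℚ.< q → ∀ t →
                      value t <ʳ fromℚ (Box.upper β zero) →
                      value t ≤ʳ fromℚ q ⊎ (λ _ → value t) ∈ᴮ β
        below-or-in β {q} l<q t t<u with ≤ʳ⊎<ʳ (value t) (fromℚ q)
        ... | inj₁ t≤q = inj₁ t≤q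
        ... | inj₂ q<t = inj₂ λ { zero → Below⇒<ʳ (down (value t) l<q (<ʳ⇒Below q<t)) , t<u }

  continuous-value : ∀ t → ContinuousAt 𝕀 value t
  continuous-value = coord-continuous {coords-cong = λ eq _ → eq} zero

  -- The unit interval is locally compact, so products with it preserve quotient maps.
  open-|X|×𝕀 : ∀ (X : SimplicialSet) {O : Pred (Space.Point (∣ X ∣ˢ ×ₜ 𝕀)) 1ℓ} →
    O Respects Space._≈_ (∣ X ∣ˢ ×ₜ 𝕀) →
    (∀ {n} x → Space.Open (Δᵗ n ×ₜ 𝕀) λ (s , t) → O ((n , x , s) , t)) →
    Space.Open (∣ X ∣ˢ ×ₜ 𝕀) O
  open-|X|×𝕀 X {O} resp openO (n , x , s) t o =
    let (V , W , oV , oW , s∈V , t∈W , V×W⊆O) = openO x s t o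
        (β , t∈β , β⊆W) = oW t t∈W
        (a , l<a , a∈t) = rounded (value t) (<ʳ⇒Below (proj₁ (t∈β zero)))
        (p , p∉t , p<u) = between (proj₂ (t∈β zero))
        (b , p<b , b<u) = ℚₚ.<-dense p<u
        in-β : ∀ t′ → fromℚ a ≤ʳ value t′ → value t′ ≤ʳ fromℚ b → (λ _ → value t′) ∈ᴮ β
        in-β t′ a≤t′ t′≤b = λ { zero → Below⇒<ʳ (≤ʳ⁻ a≤t′ l<a)
                                     , <ʳ⁺ (b , ℚₚ.<-irrefl refl ∘ ≤ʳ⁻ t′≤b , b<u) }
        oK : Space.Open 𝕀 λ t′ → Lift 1ℓ (Below (value t′) a × value t′ <ʳ fromℚ b)
        oK = near⇒open {X = 𝕀} λ { t′ (lift (a∈ , <b)) → near-map lift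
               (near-∩ (lower-near (continuous-value t′) a∈) (upper-near (continuous-value t′) <b)) }
    -- The c with all of c × [a , b] inside O form an open set: it is saturated because O is, and
    -- open on each cell by the tube lemma. The other side of the rectangle is the open interval
    -- from a to b.
    in  (λ c → ∀ t′ → fromℚ a ≤ʳ value t′ → value t′ ≤ʳ fromℚ b → O (c , t′))
        , (λ t′ → Lift 1ℓ (Below (value t′) a × value t′ <ʳ fromℚ b))
        , ( (λ c≈d f t′ a≤ ≤b → resp (c≈d , (≤ʳ-refl , ≤ʳ-refl)) (f t′ a≤ ≤b))
          , λ {m} y → near⇒open {X = Δᵗ m} λ _ → tube {X = Δᵗ m} (openO y) a b )
        , oK
        , (λ t′ a≤ ≤b → V×W⊆O s t′ s∈V (β⊆W t′ (in-β t′ a≤ ≤b)))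
        , lift (a∈t , <ʳ⁺ (p , p∉t , p<b))
        , λ { c t′ f (lift (a∈ , <b)) → f t′ (<ʳ⇒≤ʳ (Below⇒<ʳ a∈)) (<ʳ⇒≤ʳ <b) }

  module _ {e o} {X : Space e o} {n} {A : Setoid 1ℓ 0ℓ} {coords : Setoid.Carrier A → Fin n → ℝ}
           {coords-cong : ∀ {x y} → Setoid._≈_ A x y → ∀ i → coords x i ≈ʳ coords y i} where

    near-coords : ∀ {f : Space.Point X → Setoid.Carrier A} {x U} →
      (∀ i → ContinuousAt X (λ y → coords (f y) i) x) →
      Space.Open (subspace A coords coords-cong) U → U (f x) → Near X x (U ∘ f)
    near-coords {f} {x} cont oU u =
      let (β , fx∈β , β⊆U) = oU (f x) u in near-map (λ in-β → β⊆U _ in-β)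
        (near-∀ λ i → near-map (λ (l , u) → Below⇒<ʳ l , u)
          (near-∩ (lower-near (cont i) (<ʳ⇒Below (proj₁ (fx∈β i))))
                  (upper-near (cont i) (proj₂ (fx∈β i)))))

  ≈ʳ-flip : ∀ {s s′ t t′} → s +ʳ t ≈ʳ 1ʳ → s′ +ʳ t′ ≈ʳ 1ʳ → t ≈ʳ t′ → s ≈ʳ s′
  ≈ʳ-flip {s} {s′} {t} {t′} p p′ t≈t′ = +-cancelˡ t
    (ℝ⁺.trans (ℝ⁺.comm t s) (ℝ⁺.trans p (ℝ⁺.trans (ℝ⁺.sym p′)
      (ℝ⁺.trans (ℝ⁺.comm s′ t′) (ℝ⁺.∙-congʳ (ℝ⁺.sym t≈t′))))))

  abstract
    flip-≥0 : ∀ t → 0ʳ ≤ʳ 1ʳ -ʳ value t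
    flip-≥0 t = minus-≥0 (UnitPoint.≤1 t)

    flip-≤1 : ∀ t → 1ʳ -ʳ value t ≤ʳ 1ʳ
    flip-≤1 t = ≤ʳ-trans (proj₂ (ℝ⁺.identityˡ _))
      (≤ʳ-trans (+ʳ-mono (UnitPoint.0≤ t) ≤ʳ-refl) (proj₁ (+-minus 1ʳ (value t))))

    double-≥0 : ∀ t → 0ʳ ≤ʳ 1ʳ ⊓ʳ (value t +ʳ value t)
    double-≥0 t = ≤ʳ⁺ λ q<0 → ≤ʳ⁻ (UnitPoint.0≤ 1ᴵ) q<0
      , ≤ʳ⁻ (+ʳ-mono (UnitPoint.0≤ t) (UnitPoint.0≤ t)) (≤ʳ⁻ (proj₂ (ℝ⁺.identityˡ 0ʳ)) q<0)

    double-≤1 : ∀ t → 1ʳ ⊓ʳ (value t +ʳ value t) ≤ʳ 1ʳ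
    double-≤1 t = ≤ʳ⁺ proj₁

  flip double : UnitPoint → UnitPoint
  flip t   = unitPoint (1ʳ -ʳ value t) (flip-≥0 t) (flip-≤1 t)
  double t = unitPoint (1ʳ ⊓ʳ (value t +ʳ value t)) (double-≥0 t) (double-≤1 t)

  flip-+ : ∀ t → value (flip t) +ʳ value t ≈ʳ 1ʳ
  flip-+ t = ℝ⁺.trans (ℝ⁺.comm _ (value t)) (+-minus 1ʳ (value t))

  flip-1 : value (flip 1ᴵ) ≈ʳ 0ʳ
  flip-1 = ≈ʳ-flip (flip-+ 1ᴵ) (ℝ⁺.identityˡ 1ʳ) (ℝ⁺.refl {1ʳ})

  flipᶜ : Continuous 𝕀 𝕀
  flipᶜ = record
    { to       = flip
    ; to-cong  = λ {s} {t} s≈t → ≈ʳ-flip (flip-+ s) (flip-+ t) s≈t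
    ; preimage = λ {U} oU → near⇒open {X = 𝕀} λ t →
        near-coords {X = 𝕀} {A = Space.setoid 𝕀} {coords = λ t _ → value t}
          {coords-cong = λ eq _ → eq} {f = flip} {U = U} (λ { zero → continuous t }) oU
    }
    where
    open Continuity em 𝕀
    continuous : ∀ t → ContinuousAt 𝕀 (value ∘ flip) t
    continuous t =
      let (lo , hi) = near-summand (continuous-value t) (continuous-const 1ʳ t) (flip-+ t) in record
        { lower-near = λ {q} b → near-map (λ {t′} f → f (flip-+ t′)) (lo {q} b)
        ; upper-near = λ {q} b → near-map (λ {t′} f → f (flip-+ t′)) (hi {q} b) }

  doubleᶜ : Continuous 𝕀 𝕀
  doubleᶜ = record
    { to       = double
    ; to-cong  = λ (p , q) → ≤ʳ⁺ (λ (a , b) → a , ≤ʳ⁻ (+ʳ-mono p p) b)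
                           , ≤ʳ⁺ (λ (a , b) → a , ≤ʳ⁻ (+ʳ-mono q q) b)
    ; preimage = λ {U} oU → near⇒open {X = 𝕀} λ t →
        near-coords {X = 𝕀} {A = Space.setoid 𝕀} {coords = λ t _ → value t}
          {coords-cong = λ eq _ → eq} {f = double} {U = U} (λ { zero → continuous t }) oU
    }
    where
    open Continuity em 𝕀
    continuous : ∀ t → ContinuousAt 𝕀 (value ∘ double) t
    continuous t = record
      { lower-near = λ (a , b) → near-map (a ,_) (lower-near c+c b)
      ; upper-near = λ { (<ʳ⁺ (p , ¬b , p<q)) → upper ¬b p<q (em {P = p ℚ.< 1ℚ}) }
      }
      where
      c+c : ContinuousAt 𝕀 (λ t → value t +ʳ value t) t
      c+c = continuous-+ (continuous-value t) (continuous-value t)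
      upper : ∀ {p q} → ¬ Below (value (double t)) p → p ℚ.< q → Dec (p ℚ.< 1ℚ) →
              Near 𝕀 t λ t → value (double t) <ʳ fromℚ q
      upper ¬b p<q (yes p<1) = near-map
        (λ <q → ≤ʳ-<ʳ-trans (≤ʳ⁺ proj₂) <q) (upper-near c+c (<ʳ⁺ (_ , (λ b → ¬b (p<1 , b)) , p<q)))
      upper ¬b p<q (no p≮1) = near-true λ _ → <ʳ⁺ (_ , p≮1 ∘ proj₁ , p<q)

  module _ {e o} {X : Space e o} (φ : Continuous 𝕀 𝕀) where
    private
      module X = Space X
      module φ = Continuous φ

    id×ᶜ : Continuous (X ×ₜ 𝕀) (X ×ₜ 𝕀)
    id×ᶜ = record
      { to       = λ (x , t) → x , to φ t
      ; to-cong  = λ (p , q) → p , φ.to-cong q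
      ; preimage = λ oU x t u →
          let (V , W , oV , oW , x∈V , t∈W , sub) = oU x (to φ t) u in
          V , W ∘ to φ , oV , φ.preimage oW , x∈V , t∈W , λ x′ t′ → sub x′ (to φ t′)
      }

  module _ {e o e′ o′} {X : Space e o} {Y : Space e′ o′} where
    private
      module X = Space X
      module Y = Space Y

    homotopy-resp : ∀ {f f′ g g′ : Continuous X Y} → (∀ x → to f x Y.≈ to f′ x) →
                    (∀ x → to g x Y.≈ to g′ x) → Homotopy f g → Homotopy f′ g′
    homotopy-resp f≈f′ g≈g′ h = record
      { H   = Homotopy.H h
      ; at0 = λ x → Y.trans (Homotopy.at0 h x) (f≈f′ x)
      ; at1 = λ x → Y.trans (Homotopy.at1 h x) (g≈g′ x)
      }

    -- F at double speed, then G at double speed backwards.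
    module _ {f g h : Continuous X Y} (F : Homotopy f h) (G : Homotopy g h) where
      private
        module F = Homotopy F
        module G = Homotopy G
        P Q : Continuous (X ×ₜ 𝕀) Y
        P = F.H ∘ᶜ id×ᶜ {X = X} doubleᶜ
        Q = G.H ∘ᶜ id×ᶜ {X = X} (doubleᶜ ∘ᶜ flipᶜ)
        module P = Continuous P
        module Q = Continuous Q

        glue-at : ∀ x t → value t +ʳ value t ≤ʳ 1ʳ ⊎ 1ʳ <ʳ value t +ʳ value t → Y.Point
        glue-at x t (inj₁ _) = to P (x , t)
        glue-at x t (inj₂ _) = to Q (x , t)

        glued : X.Point × UnitPoint → Y.Point
        glued (x , t) = glue-at x t (≤ʳ⊎<ʳ (value t +ʳ value t) 1ʳ)

        double≈1 : ∀ t → 1ʳ ≤ʳ value t +ʳ value t → value (double t) ≈ʳ 1ʳ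
        double≈1 t 1≤ = UnitPoint.≤1 (double t) , ≤ʳ⁺ λ q<1 → q<1 , ≤ʳ⁻ 1≤ q<1

        flip-≥½ : ∀ t → value t +ʳ value t ≤ʳ 1ʳ → 1ʳ ≤ʳ value (flip t) +ʳ value (flip t)
        flip-≥½ t ≤1 = +-cancelˡ-≤ 1ʳ (≤ʳ-trans
          (+ʳ-mono (proj₂ (flip-+ t)) (proj₂ (flip-+ t)))
          (≤ʳ-trans (proj₁ (interchange (value (flip t)) (value t) (value (flip t)) (value t)))
          (≤ʳ-trans (+ʳ-mono ≤ʳ-refl ≤1) (proj₁ (ℝ⁺.comm _ 1ʳ)))))
          where open import Algebra.Properties.CommutativeSemigroup ℝ⁺.commutativeSemigroup
                  using (interchange)

        left-at : ∀ x t d → value t +ʳ value t ≤ʳ 1ʳ → glue-at x t d Y.≈ to P (x , t)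
        left-at x t (inj₁ _)  ≤1 = Y.refl
        left-at x t (inj₂ 1<) ≤1 = ⊥-elim (<ʳ-irrefl 1< ≤1)

        -- If the decision took the left branch then 2t = 1, where both homotopies have arrived at
        -- h.
        right-at : ∀ x t d → 1ʳ ≤ʳ value t +ʳ value t → glue-at x t d Y.≈ to Q (x , t)
        right-at x t (inj₂ _)  1≤ = Y.refl
        right-at x t (inj₁ ≤1) 1≤ = Y.trans
          (Continuous.to-cong F.H {x , double t} {x , 1ᴵ} (X.refl , double≈1 t 1≤))
          (Y.trans (F.at1 x) (Y.trans (Y.sym (G.at1 x))
          (Continuous.to-cong G.H {x , 1ᴵ} {x , double (flip t)}
            (X.refl , ℝ⁺.sym (double≈1 (flip t) (flip-≥½ t ≤1))))))

        left : ∀ x t → value t +ʳ value t ≤ʳ 1ʳ → glued (x , t) Y.≈ to P (x , t)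
        left x t = left-at x t (≤ʳ⊎<ʳ (value t +ʳ value t) 1ʳ)

        right : ∀ x t → 1ʳ ≤ʳ value t +ʳ value t → glued (x , t) Y.≈ to Q (x , t)
        right x t = right-at x t (≤ʳ⊎<ʳ (value t +ʳ value t) 1ʳ)

        sides : ∀ t → value t +ʳ value t ≤ʳ 1ʳ ⊎ 1ʳ ≤ʳ value t +ʳ value t
        sides t = Sum.map₂ <ʳ⇒≤ʳ (≤ʳ⊎<ʳ _ 1ʳ)

        glued-cong : ∀ x y s t → x X.≈ y → value s ≈ʳ value t → glued (x , s) Y.≈ glued (y , t)
        glued-cong x y s t x≈y s≈t = Sum.[
            (λ ≤1 → Y.trans (left x s ≤1) (Y.trans (P.to-cong {x , s} {y , t} (x≈y , s≈t))
              (Y.sym (left y t (≤ʳ-trans (+ʳ-mono (proj₂ s≈t) (proj₂ s≈t)) ≤1)))))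
          , (λ 1≤ → Y.trans (right x s 1≤) (Y.trans (Q.to-cong {x , s} {y , t} (x≈y , s≈t))
              (Y.sym (right y t (≤ʳ-trans 1≤ (+ʳ-mono (proj₁ s≈t) (proj₁ s≈t))))))) ]′ (sides s)

        module _ {U : Pred Y.Point 1ℓ} (oU : Y.Open U) (x : X.Point) (t : UnitPoint)
                 (u : U (glued (x , t))) where
          open Continuity em (X ×ₜ 𝕀)
          c+c : ContinuousAt (X ×ₜ 𝕀) (λ (_ , t) → value t +ʳ value t) (x , t)
          c+c = continuous-+ c c
            where c = continuous-proj₂ {X = X} {𝕀} (continuous-value t)

          -- Inside the closed half the first homotopy supplies the neighbourhood; outside it the
          -- strict inequality persists and the implication is vacuous. With `near-right` this
          -- covers all times, since the halves do.
          near-left : Near (X ×ₜ 𝕀) (x , t) λ (x , t) → value t +ʳ value t ≤ʳ 1ʳ → U (glued (x , t))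
          near-left = Sum.[
              (λ ≤1 → near-map
                (λ { {y , s} u ≤1 → Y.open-resp oU (Y.sym (left y s ≤1)) u })
                (open⇒near {X = X ×ₜ 𝕀} (P.preimage oU) (Y.open-resp oU (left x t ≤1) u)))
            , (λ 1< → near-map (λ 1< ≤1 → ⊥-elim (<ʳ-irrefl 1< ≤1))
                (near-< (continuous-const 1ʳ (x , t)) c+c 1<)) ]′
            (≤ʳ⊎<ʳ (value t +ʳ value t) 1ʳ)

          near-right : Near (X ×ₜ 𝕀) (x , t) λ (x , t) → 1ʳ ≤ʳ value t +ʳ value t → U (glued (x , t))
          near-right = Sum.[
              (λ 1≤ → near-map
                (λ { {y , s} u 1≤ → Y.open-resp oU (Y.sym (right y s 1≤)) u })
                (open⇒near {X = X ×ₜ 𝕀} (Q.preimage oU) (Y.open-resp oU (right x t 1≤) u)))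
            , (λ <1 → near-map (λ <1 1≤ → ⊥-elim (<ʳ-irrefl <1 1≤))
                (near-< c+c (continuous-const 1ʳ (x , t)) <1)) ]′
            (≤ʳ⊎<ʳ 1ʳ (value t +ʳ value t))

          near-glued : Near (X ×ₜ 𝕀) (x , t) (U ∘ glued)
          near-glued = near-map (λ { {_ , s} (l , r) → Sum.[ l , r ]′ (sides s) })
                                (near-∩ near-left near-right)

        0+0≤1 : 0ʳ +ʳ 0ʳ ≤ʳ 1ʳ
        0+0≤1 = ≤ʳ-trans (proj₁ (ℝ⁺.identityˡ 0ʳ)) (UnitPoint.0≤ 1ᴵ)

        1≤1+1 : 1ʳ ≤ʳ 1ʳ +ʳ 1ʳ
        1≤1+1 = ≤ʳ-trans (proj₂ (ℝ⁺.identityˡ 1ʳ)) (+ʳ-mono (UnitPoint.0≤ 1ᴵ) ≤ʳ-refl)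

        double-0 : ∀ t → value t ≈ʳ 0ʳ → value (double t) ≈ʳ 0ʳ
        double-0 t t≈0 = ≤ʳ-trans (≤ʳ⁺ proj₂) (≤ʳ-trans (+ʳ-mono (proj₁ t≈0) (proj₁ t≈0))
          (proj₁ (ℝ⁺.identityˡ 0ʳ))) , UnitPoint.0≤ (double t)

      homotopy-zigzag : Homotopy f g
      homotopy-zigzag = record
        { H   = record { to       = glued
                       ; to-cong  = λ {(x , s)} {(y , t)} (p , q) → glued-cong x y s t p q
                       ; preimage = λ oU → open-×⁺ {X = X} {𝕀} (near-glued oU) }
        ; at0 = λ x → Y.trans (left x 0ᴵ 0+0≤1) (Y.trans
            (Continuous.to-cong F.H {x , double 0ᴵ} {x , 0ᴵ} (X.refl , double-0 0ᴵ ℝ⁺.refl))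
            (F.at0 x))
        ; at1 = λ x → Y.trans (right x 1ᴵ 1≤1+1) (Y.trans
            (Continuous.to-cong G.H {x , double (flip 1ᴵ)} {x , 0ᴵ}
              (X.refl , double-0 (flip 1ᴵ) flip-1))
            (G.at0 x))
        }

-- Weighted chains in a prism

mass : ∀ {m} → (Fin m → Bool) → (Fin m → ℝ) → ℝ
mass D f = Σʳ.sum λ i → if D i then f i else 0ʳ

if-0 : ∀ b → (if b then 0ʳ else 0ʳ) ≡ 0ʳ
if-0 true  = refl
if-0 false = refl

sum-mono : ∀ {m} {f g : Fin m → ℝ} → (∀ i → f i ≤ʳ g i) → Σʳ.sum f ≤ʳ Σʳ.sum g
sum-mono {zero}  f≤g = ≤ʳ-refl
sum-mono {suc m} f≤g = +ʳ-mono (f≤g zero) (sum-mono (f≤g ∘ suc))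

module _ {m} (f : Fin m → ℝ) where

  mass-mono : (∀ i → 0ʳ ≤ʳ f i) → ∀ {D E} → (∀ i → T (D i) → T (E i)) → mass D f ≤ʳ mass E f
  mass-mono f≥0 {D} {E} D⊆E = sum-mono λ i → step i (D i) (E i) (D⊆E i)
    where
    step : ∀ i d e → (T d → T e) → (if d then f i else 0ʳ) ≤ʳ (if e then f i else 0ʳ)
    step i true  true  _   = ≤ʳ-refl
    step i true  false d⇒e = ⊥-elim (d⇒e _)
    step i false true  _   = f≥0 i
    step i false false _   = ≤ʳ-refl

  mass-cong : ∀ {g} → (∀ i → f i ≈ʳ g i) → ∀ D → mass D f ≈ʳ mass D g
  mass-cong f≈g D = Σʳ.sum-cong-≋ λ i → step i (D i)
    where
    step : ∀ i d → (if d then f i else 0ʳ) ≈ʳ (if d then _ else 0ʳ)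
    step i true  = f≈g i
    step i false = ℝ⁺.refl

  mass-≗ : ∀ {D E} → D ≗ E → mass D f ≈ʳ mass E f
  mass-≗ D≗E = ℝ⁺.reflexive (Σʳ.sum-cong-≗ λ i → cong (if_then f i else 0ʳ) (D≗E i))

if-sum : ∀ {m} b (g : Fin m → ℝ) → (if b then Σʳ.sum g else 0ʳ) ≈ʳ Σʳ.sum λ i → if b then g i else 0ʳ
if-sum true  g = ℝ⁺.refl
if-sum {m} false g = ℝ⁺.sym (Σʳ.sum-ε {m} (λ _ → 0ʳ) λ _ → ℝ⁺.refl)

-- `push θ w` is the image measure of w: after exchanging the sums, only j = `app θ i` contributes
-- for each i.
mass-push : ∀ {m n} (θ : m →Δ n) (w : SimplexPoint m) E →
            mass E (coord (push θ w)) ≈ʳ mass (E ∘ app θ) (coord w)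
mass-push θ w E = ℝ⁺.trans
  (Σʳ.sum-cong-≋ λ j → if-sum (E j) λ i → if does (app θ i Finₚ.≟ j) then coord w i else 0ʳ)
  (ℝ⁺.trans (Σʳ.∑-comm λ j i → if E j then (if does (app θ i Finₚ.≟ j) then coord w i else 0ʳ) else 0ʳ)
  (Σʳ.sum-cong-≋ λ i → ℝ⁺.trans
    (Σʳ.sum-single _ (app θ i) λ j j≢ → ℝ⁺.reflexive (trans
      (cong (λ x → if E j then x else 0ʳ) (Σʳ.↦-≢ {i = app θ i} {j} {coord w i} (j≢ ∘ sym))) (if-0 (E j))))
    (ℝ⁺.reflexive (cong (λ x → if E (app θ i) then x else 0ʳ) (Σʳ.↦-≡ {i = app θ i} {x = coord w i} refl)))))

-- A coordinate of a pushed point is by definition the mass of a fibre, so this is an instance of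
-- `mass-push`.
push-∘ : ∀ {l m n} (ψ : m →Δ n) (φ : l →Δ m) w {χ : l →Δ n} → app ψ ∘ app φ ≗ app χ →
         Space._≈_ (Δᵗ n) (push ψ (push φ w)) (push χ w)
push-∘ ψ φ w eq j = ℝ⁺.trans (mass-push φ w λ i → does (app ψ i Finₚ.≟ j))
  (mass-≗ (coord w) λ i → cong (λ k → does (k Finₚ.≟ j)) (eq i))

push-cong : ∀ {m n} (θ : m →Δ n) {v w} → Space._≈_ (Δᵗ m) v w →
            Space._≈_ (Δᵗ n) (push θ v) (push θ w)
push-cong θ {v} {w} v≈w j = mass-cong (coord v) v≈w λ i → does (app θ i Finₚ.≟ j)

push-id : ∀ {n} {θ : n →Δ n} → app θ ≗ id → ∀ w → Space._≈_ (Δᵗ n) (push θ w) w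
push-id {θ = θ} θ≗id w j = ℝ⁺.trans
  (Σʳ.sum-single (λ i → if does (app θ i Finₚ.≟ j) then coord w i else 0ʳ) j
    λ i i≢j → ℝ⁺.reflexive (Σʳ.↦-≢ {i = app θ i} {j} (i≢j ∘ trans (sym (θ≗id i)))))
  (ℝ⁺.reflexive (Σʳ.↦-≡ {x = coord w j} (θ≗id j)))

-- Tail sums and staircase chains

up : ∀ {m} → ℕ → Fin m → Bool
up j i = j ℕ.≤ᵇ toℕ i

-- In these coordinates a point of a simplex is a nonincreasing sequence and each weight is the
-- difference of two neighbours, so weights can be compared by inequalities alone.
tail : ∀ {m} → ℕ → (Fin m → ℝ) → ℝ
tail j f = mass (up j) f

<ᵇ-suc : ∀ j k → (j ℕ.<ᵇ suc k) ≡ (j ℕ.≤ᵇ k)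
<ᵇ-suc zero    k = refl
<ᵇ-suc (suc j) k = refl

tail-suc : ∀ {m} j (f : Fin (suc m) → ℝ) → tail (suc j) f ≈ʳ tail j (f ∘ suc)
tail-suc j f = ℝ⁺.trans (ℝ⁺.identityˡ _) (mass-≗ (f ∘ suc) λ i → <ᵇ-suc j (toℕ i))

tail-step : ∀ {m} (i : Fin m) f → f i +ʳ tail (suc (toℕ i)) f ≈ʳ tail (toℕ i) f
tail-step zero    f = ℝ⁺.∙-congˡ (ℝ⁺.identityˡ _)
tail-step (suc i) f = ℝ⁺.trans
  (ℝ⁺.trans (ℝ⁺.∙-congˡ (tail-suc (suc (toℕ i)) f)) (tail-step i (f ∘ suc)))
  (ℝ⁺.sym (tail-suc (toℕ i) f))

pinch≤ : ∀ {n} (k : Fin (suc n)) i → toℕ (pinch k i) ℕ.≤ toℕ i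
pinch≤ k       zero    = z≤n
pinch≤ zero    (suc i) = ℕₚ.n≤1+n _
pinch≤ {suc n} (suc k) (suc i) = s≤s (pinch≤ k i)

≤suc-pinch : ∀ {n} (k : Fin (suc n)) i → toℕ i ℕ.≤ suc (toℕ (pinch k i))
≤suc-pinch k       zero    = z≤n
≤suc-pinch zero    (suc i) = ℕₚ.≤-refl
≤suc-pinch {suc n} (suc k) (suc i) = s≤s (≤suc-pinch k i)

pinch-low : ∀ {n} (k : Fin (suc n)) i → i ≤ᶠ k → toℕ (pinch k i) ≡ toℕ i
pinch-low k       zero    _         = refl
pinch-low {suc n} (suc k) (suc i) (s≤s i≤k) = cong suc (pinch-low k i i≤k)

pinch-high : ∀ {n} (k : Fin (suc n)) i → toℕ k ℕ.< toℕ i → suc (toℕ (pinch k i)) ≡ toℕ i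
pinch-high zero    (suc i) _         = refl
pinch-high {suc n} (suc k) (suc i) (s≤s k<i) = cong suc (pinch-high k i k<i)

-- The jump from 0 to 1 falls between the two positions that the degeneracy `pinch k` sends to k.
bit : ∀ {n} → Fin (suc n) → Fin (suc (suc n)) → Fin 2
bit k       zero    = zero
bit zero    (suc i) = suc zero
bit {suc n} (suc k) (suc i) = bit k i

bit-low : ∀ {n} (k : Fin (suc n)) i → i ≤ᶠ k → bit k i ≡ zero
bit-low k       zero    _         = refl
bit-low {suc n} (suc k) (suc i) (s≤s i≤k) = bit-low k i i≤k

bit-high : ∀ {n} (k : Fin (suc n)) i → toℕ k ℕ.< toℕ i → bit k i ≡ suc zero
bit-high zero    (suc i) _         = refl
bit-high {suc n} (suc k) (suc i) (s≤s k<i) = bit-high k i k<i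

bit-mono : ∀ {n} (k : Fin (suc n)) {i j} → i ≤ᶠ j → bit k i ≤ᶠ bit k j
bit-mono k       {zero}  _ = z≤n
bit-mono zero    {suc i} {suc j} _ = ℕₚ.≤-refl
bit-mono {suc n} (suc k) {suc i} {suc j} (s≤s i≤j) = bit-mono k i≤j

pinchΔ : ∀ {n} → Fin (suc n) → suc n →Δ n
pinchΔ k = record { app = pinch k ; mono = Finₚ.pinch-mono-≤ k }

bitΔ : ∀ {n} → Fin (suc n) → suc n →Δ 1
bitΔ k = record { app = bit k ; mono = bit-mono k }

isOne : Fin 2 → Bool
isOne b = does (b Finₚ.≟ suc zero)

one≢zero : ∀ {b} → T (isOne b) → b ≢ zero
one≢zero () refl

enum-mono : ∀ {n} (S : Subset n) {i j} → i ≤ᶠ j → enum S i ≤ᶠ enum S j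
enum-mono (true  ∷ S) {zero}  {j}     _         = z≤n
enum-mono (true  ∷ S) {suc i} {suc j} (s≤s i≤j) = s≤s (enum-mono S i≤j)
enum-mono (false ∷ S) i≤j = s≤s (enum-mono S i≤j)

-- The product with the simplicial interval Δ¹, whose n-simplices are the monotone maps to {0 < 1}.
_⊠𝟚 : SimplicialSet → SimplicialSet
X ⊠𝟚 = record
  { simplices = λ n → record
    { Carrier       = S.Carrier n × (n →Δ 1)
    ; _≈_           = λ (x , β) (y , γ) → S._≈_ n x y × app β ≗ app γ
    ; isEquivalence = record
      { refl  = S.refl _ , λ _ → refl
      ; sym   = λ (p , q) → S.sym _ p , λ i → sym (q i)
      ; trans = λ (p , q) (p′ , q′) → S.trans _ p p′ , λ i → trans (q i) (q′ i)
      }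
    }
  ; act      = λ θ (x , β) → act θ x , β ∘Δ θ
  ; act-cong = λ {_} {_} {θ} {θ′} {(_ , β)} {(_ , γ)} θ≗θ′ (x≈y , β≗γ) →
      act-cong θ≗θ′ x≈y , (λ i → trans (cong (app β) (θ≗θ′ i)) (β≗γ (app θ′ i)))
  ; act-id   = λ (x , β) → act-id x , λ _ → refl
  ; act-∘    = λ ψ φ (x , β) → act-∘ ψ φ x , λ _ → refl
  }
  where open SimplicialSet X

-- A point of |X| × 𝕀 over (s , t) ∈ Δⁿ × 𝕀 as a point of |X × Δ¹|: the weights
-- of a chain in {0 < ⋯ < n} × {0 < 1} with marginals s and (1 - t , t).
record Coupling {n} (s : Fin (suc n) → ℝ) (t : ℝ) : Set₁ where
  field
    dim     : ℕ
    base    : dim →Δ n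
    bits    : dim →Δ 1
    weights : SimplexPoint dim
    over    : ∀ j → coord (push base weights) j ≈ʳ s j
    height  : coord (push bits weights) (suc zero) ≈ʳ t

-- The chain (0 , 0) < ⋯ < (k , 0) < (k , 1) < ⋯ < (n , 1).
record Normal {n} (s : Fin (suc n) → ℝ) (t : ℝ) (k : Fin (suc n))
              (w : SimplexPoint (suc n)) : Set₁ where
  field
    over   : ∀ j → coord (push (pinchΔ k) w) j ≈ʳ s j
    height : coord (push (bitΔ k) w) (suc zero) ≈ʳ t

  coupling : Coupling s t
  coupling = record { base = pinchΔ k ; bits = bitΔ k ; weights = w ; over = over ; height = height }

  private
    R S : ℕ → ℝ
    R j = tail j (coord w)
    S j = tail j s

    S≈ : ∀ j → S j ≈ʳ mass (up j ∘ pinch k) (coord w)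
    S≈ j = ℝ⁺.trans (ℝ⁺.sym (mass-cong (coord (push (pinchΔ k) w)) over (up j)))
                    (mass-push (pinchΔ k) w (up j))

    mono-w : ∀ {D E : Fin (suc (suc n)) → Bool} → (∀ i → T (D i) → T (E i)) →
             mass D (coord w) ≤ʳ mass E (coord w)
    mono-w = mass-mono (coord w) (SimplexPoint.coord≥0 w)

    split-≤ : ∀ i → i ≤ᶠ k ⊎ toℕ k ℕ.< toℕ i
    split-≤ i = ℕₚ.≤-<-connex (toℕ i) (toℕ k)

  -- S j is the mass of the positions that `pinch k` sends to j or beyond, and t the mass of those
  -- after k, so each comparison below is an inclusion of sets of positions. Together: R j = S j for
  -- j ≤ k, R (k + 1) = t, and R (j + 1) = S j for j > k.
  R-suc≤S : ∀ j → R (suc j) ≤ʳ S j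
  R-suc≤S j = ≤ʳ-trans (mono-w λ i j<i → ℕₚ.≤⇒≤ᵇ (ℕ.s≤s⁻¹
    (ℕₚ.≤-trans (ℕₚ.≤ᵇ⇒≤ (suc j) (toℕ i) j<i) (≤suc-pinch k i)))) (proj₂ (S≈ j))

  S≤R : ∀ j → S j ≤ʳ R j
  S≤R j = ≤ʳ-trans (proj₁ (S≈ j)) (mono-w λ i j≤ → ℕₚ.≤⇒≤ᵇ
    (ℕₚ.≤-trans (ℕₚ.≤ᵇ⇒≤ j _ j≤) (pinch≤ k i)))

  R≤S : ∀ {j} → j ℕ.≤ toℕ k → R j ≤ʳ S j
  R≤S {j} j≤k = ≤ʳ-trans (mono-w λ i j≤i → ℕₚ.≤⇒≤ᵇ (case i (ℕₚ.≤ᵇ⇒≤ j _ j≤i) (split-≤ i)))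
                         (proj₂ (S≈ j))
    where
    case : ∀ i → j ℕ.≤ toℕ i → i ≤ᶠ k ⊎ toℕ k ℕ.< toℕ i → j ℕ.≤ toℕ (pinch k i)
    case i j≤i (inj₁ i≤k) = subst (j ℕ.≤_) (sym (pinch-low k i i≤k)) j≤i
    case i j≤i (inj₂ k<i) = ℕₚ.≤-trans j≤k
      (ℕ.s≤s⁻¹ (subst (toℕ k ℕ.<_) (sym (pinch-high k i k<i)) k<i))

  S≤R-suc : ∀ {j} → toℕ k ℕ.< j → S j ≤ʳ R (suc j)
  S≤R-suc {j} k<j = ≤ʳ-trans (proj₁ (S≈ j))
    (mono-w λ i j≤ → ℕₚ.≤⇒≤ᵇ {suc j} (case i (ℕₚ.≤ᵇ⇒≤ j _ j≤) (split-≤ i)))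
    where
    case : ∀ i → j ℕ.≤ toℕ (pinch k i) → i ≤ᶠ k ⊎ toℕ k ℕ.< toℕ i → suc j ℕ.≤ toℕ i
    case i j≤ (inj₁ i≤k) = contradiction
      (ℕₚ.<-≤-trans k<j (ℕₚ.≤-trans (subst (j ℕ.≤_) (pinch-low k i i≤k) j≤) i≤k)) (ℕₚ.<-irrefl refl)
    case i j≤ (inj₂ k<i) = subst (suc j ℕ.≤_) (pinch-high k i k<i) (s≤s j≤)

  t≤R : ∀ {j} → j ℕ.≤ suc (toℕ k) → t ≤ʳ R j
  t≤R {j} j≤ = ≤ʳ-trans (proj₂ height) (mono-w λ i one → ℕₚ.≤⇒≤ᵇ (case i one (split-≤ i)))
    where
    case : ∀ i → T (isOne (bit k i)) → i ≤ᶠ k ⊎ toℕ k ℕ.< toℕ i → j ℕ.≤ toℕ i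
    case i one (inj₁ i≤k) = contradiction (bit-low k i i≤k) (one≢zero one)
    case i one (inj₂ k<i) = ℕₚ.≤-trans j≤ k<i

  R≤t : ∀ {j} → toℕ k ℕ.< j → R j ≤ʳ t
  R≤t {j} k<j = ≤ʳ-trans
    (mono-w λ i j≤i → subst (T ∘ isOne) (sym (bit-high k i (ℕₚ.<-≤-trans k<j (ℕₚ.≤ᵇ⇒≤ j _ j≤i)))) _)
    (proj₁ height)

open Normal using (R-suc≤S; S≤R; R≤S; S≤R-suc; t≤R; R≤t)

module _ {n} {s : Fin (suc n) → ℝ} {t : ℝ} {k l : Fin (suc n)} {v w : SimplexPoint (suc n)}
         (N : Normal s t k v) (M : Normal s t l w) where

  -- Whatever k is, the tail sums of the weights are those of s with t inserted
  -- at its place in the order.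
  tails-≤ : ∀ j → tail j (coord v) ≤ʳ tail j (coord w)
  tails-≤ j with ℕₚ.≤-<-connex j (toℕ k)
  ... | inj₁ j≤k = ≤ʳ-trans (R≤S N j≤k) (S≤R M j)
  ... | inj₂ k<j with ℕₚ.≤-<-connex j (suc (toℕ l))
  ...   | inj₁ j≤l = ≤ʳ-trans (R≤t N k<j) (t≤R M j≤l)
  ...   | inj₂ l<j = beyond j l<j
    where
    beyond : ∀ j → suc (toℕ l) ℕ.< j → tail j (coord v) ≤ʳ tail j (coord w)
    beyond (suc j) (s≤s l<j) = ≤ʳ-trans (R-suc≤S N j) (S≤R-suc M l<j)

module Prism (em : ∀ {ℓ} → ExcludedMiddle ℓ) where
  open Reals em
  open Topology em

  module _ {n} {s : Fin (suc n) → ℝ} {t : ℝ} {k l : Fin (suc n)} {v w : SimplexPoint (suc n)}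
           (N : Normal s t k v) (M : Normal s t l w) where

    normal-weights : Space._≈_ (Δᵗ (suc n)) v w
    normal-weights i = +-cancelˡ (tail (suc (toℕ i)) (coord w)) (ℝ⁺.trans
      (ℝ⁺.trans (ℝ⁺.comm _ (coord v i)) (ℝ⁺.trans (ℝ⁺.∙-congˡ (ℝ⁺.sym (tails (suc (toℕ i)))))
        (ℝ⁺.trans (tail-step i (coord v)) (tails (toℕ i)))))
      (ℝ⁺.trans (ℝ⁺.sym (tail-step i (coord w))) (ℝ⁺.comm (coord w i) _)))
      where
      tails : ∀ j → tail j (coord v) ≈ʳ tail j (coord w)
      tails j = tails-≤ N M j , tails-≤ M N j

    -- The tail at i is at most t by the chain of l, and the next tail at least t by the chain of k,
    -- so no weight is left at i.
    normal-support : ∀ {i} → i ≤ᶠ k → toℕ l ℕ.< toℕ i → coord v i ≈ʳ 0ʳ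
    normal-support {i} i≤k l<i = +-cancelˡ-≤ (tail (suc (toℕ i)) (coord v))
      (≤ʳ-trans (proj₁ (ℝ⁺.comm _ (coord v i))) (≤ʳ-trans (proj₁ (tail-step i (coord v)))
      (≤ʳ-trans (tails-≤ N M (toℕ i)) (≤ʳ-trans (R≤t M l<i)
      (≤ʳ-trans (t≤R N (s≤s i≤k)) (proj₂ (ℝ⁺.identityʳ _)))))))
      , SimplexPoint.coord≥0 v i

  1≰0 : ¬ 1ʳ ≤ʳ 0ʳ
  1≰0 le = ℚₚ.<-irrefl refl (≤ʳ⁻ le (ℚₚ.positive⁻¹ 1ℚ))

  module _ (Y : SimplicialSet) where
    open SimplicialSet Y
    open Realization Y using (same; glue)
    open Space ∣ Y ∣ˢ using () renaming (_≈_ to _~_; sym to ∼-sym; trans to ∼-trans)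

    same~ : ∀ {m x y} {v w : SimplexPoint m} → S._≈_ m x y → Space._≈_ (Δᵗ m) v w →
            (m , x , v) ~ (m , y , w)
    same~ {v = v} {w} x≈y v≈w = EqC.return (same {s = v} {w} x≈y v≈w)

    glue~ : ∀ {m n} (θ : m →Δ n) x w → (m , act θ x , w) ~ (n , x , push θ w)
    glue~ θ x w = EqC.return (glue θ x w)

    module _ {m} (D : Fin (suc m) → Bool) {w : SimplexPoint m}
             (off : ∀ i → D i ≡ false → coord w i ≈ʳ 0ʳ)
             {x y} (agree : ∀ {l} (θ : l →Δ m) → (∀ i → D (app θ i) ≡ true) →
                            S._≈_ l (act θ x) (act θ y)) where

      private
        -- Stated for an abstract enumeration with N entries: a face with N vertices has dimension N
        -- - 1, so N must be matched against a successor.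
        reduce : ∀ N (e : Fin N → Fin (suc m)) → (∀ i → D (e i) ≡ true) →
                 (∀ {i j} → i ≤ᶠ j → e i ≤ᶠ e j) →
                 (∀ h → (∀ i → D i ≡ false → h i ≈ʳ 0ʳ) → Σʳ.sum (h ∘ e) ≈ʳ Σʳ.sum h) →
                 (m , x , w) ~ (m , y , w)
        -- An empty face would carry total weight 0 instead of 1.
        reduce zero    e _ _ sum-e = ⊥-elim (1≰0 (proj₂
          (ℝ⁺.trans (sum-e (coord w) off) (SimplexPoint.coord-∑ w))))
        reduce (suc N) e De e-mono sum-e =
          ∼-trans (∼-sym (∼-trans (glue~ θ x v) (same~ (S.refl m) pushed)))
          (∼-trans (same~ (agree θ De) (λ _ → ℝ⁺.refl))
          (∼-trans (glue~ θ y v) (same~ (S.refl m) pushed)))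
          where
          θ : N →Δ m
          θ = record { app = e ; mono = e-mono }
          v : SimplexPoint N
          v = record
            { coord   = coord w ∘ e
            ; coord≥0 = SimplexPoint.coord≥0 w ∘ e
            ; coord-∑ = ℝ⁺.trans (sum-e (coord w) off) (SimplexPoint.coord-∑ w) }
          pushed : Space._≈_ (Δᵗ m) (push θ v) w
          pushed j = ℝ⁺.trans
            (sum-e (λ i → if does (i Finₚ.≟ j) then coord w i else 0ʳ) off′)
            (ℝ⁺.trans (Σʳ.sum-single _ j λ i i≢j → ℝ⁺.reflexive (Σʳ.↦-≢ {x = coord w i} i≢j))
                      (ℝ⁺.reflexive (Σʳ.↦-≡ {i = j} {x = coord w j} refl)))
            where
            off′ : ∀ i → D i ≡ false → (if does (i Finₚ.≟ j) then coord w i else 0ʳ) ≈ʳ 0ʳ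
            off′ i eq with does (i Finₚ.≟ j)
            ... | true  = off i eq
            ... | false = ℝ⁺.refl

      -- All the weight of w sits on the vertices in D, so w is pushed forward from the face they
      -- span, and gluing sees only the restrictions of x and y to that face.
      ~-on-support : (m , x , w) ~ (m , y , w)
      ~-on-support = reduce ∣ tabulate D ∣ (enum (tabulate D))
        (λ i → trans (sym (Vecₚ.lookup∘tabulate D _)) (Vecₚ.[]=⇒lookup (enum-∈ (tabulate D) i)))
        (enum-mono (tabulate D))
        (λ h off → enum-sum +ʳ-commutativeMonoid (tabulate D) h λ i i∉ → off i (outside i i∉))
        where
        outside : ∀ i → i ∉ tabulate D → D i ≡ false
        outside i i∉ with D i in eq
        ... | false = refl
        ... | true  = contradiction
          (Vecₚ.lookup⇒[]= i (tabulate D) (trans (Vecₚ.lookup∘tabulate D i) eq)) i∉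

-- The position of the vertex (a , b) in every staircase that contains it; it does not depend on k.
chain : ∀ {n} → Fin 2 → Fin (suc n) → Fin (suc (suc n))
chain zero       a = inject₁ a
chain (suc zero) a = suc a

chain-mono : ∀ {n} b c {a a′ : Fin (suc n)} → b ≤ᶠ c → a ≤ᶠ a′ → chain b a ≤ᶠ chain c a′
chain-mono zero zero {a} {a′} _ a≤a′
  rewrite Finₚ.toℕ-inject₁ a | Finₚ.toℕ-inject₁ a′ = a≤a′
chain-mono zero (suc zero) {a} _ a≤a′
  rewrite Finₚ.toℕ-inject₁ a = ℕₚ.m≤n⇒m≤1+n a≤a′
chain-mono (suc zero) (suc zero) _ a≤a′ = s≤s a≤a′

module _ {n} (k : Fin (suc n)) where

  pinch-chain : ∀ b a → (b ≡ zero → a ≤ᶠ k) → (b ≡ suc zero → k ≤ᶠ a) → pinch k (chain b a) ≡ a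
  pinch-chain zero a low _ = Finₚ.toℕ-injective (trans
    (pinch-low k (inject₁ a) (subst (ℕ._≤ toℕ k) (sym (Finₚ.toℕ-inject₁ a)) (low refl)))
    (Finₚ.toℕ-inject₁ a))
  pinch-chain (suc zero) a _ high = Finₚ.toℕ-injective
    (ℕₚ.suc-injective (pinch-high k (suc a) (s≤s (high refl))))

  bit-chain : ∀ b a → (b ≡ zero → a ≤ᶠ k) → (b ≡ suc zero → k ≤ᶠ a) → bit k (chain b a) ≡ b
  bit-chain zero a low _ =
    bit-low k (inject₁ a) (subst (ℕ._≤ toℕ k) (sym (Finₚ.toℕ-inject₁ a)) (low refl))
  bit-chain (suc zero) a _ high = bit-high k (suc a) (s≤s (high refl))

-- In a chain the vertices with bit 0 precede those with bit 1, so some k separates their first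
-- coordinates, and the staircase of k contains the chain.
pivot : ∀ {m n} (c : Fin m → Fin (suc n)) (b : Fin m → Fin 2) →
        (∀ {i j} → i ≤ᶠ j → c i ≤ᶠ c j) → (∀ {i j} → i ≤ᶠ j → b i ≤ᶠ b j) →
        Σ (Fin (suc n)) λ k → (∀ i → b i ≡ zero → c i ≤ᶠ k) × (∀ i → b i ≡ suc zero → k ≤ᶠ c i)
pivot {zero}  c b _ _ = zero , (λ ()) , λ ()
pivot {suc m} {n} c b c-mono b-mono = by-first (b zero) refl
  where
  rest : Σ (Fin (suc n)) λ k → (∀ i → b (suc i) ≡ zero → c (suc i) ≤ᶠ k) ×
                 (∀ i → b (suc i) ≡ suc zero → k ≤ᶠ c (suc i))
  rest = pivot (c ∘ suc) (b ∘ suc) (c-mono ∘ s≤s) (b-mono ∘ s≤s)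
  by-first : ∀ b₀ → b zero ≡ b₀ →
             Σ (Fin (suc n)) λ k → (∀ i → b i ≡ zero → c i ≤ᶠ k) × (∀ i → b i ≡ suc zero → k ≤ᶠ c i)
  by-first (suc zero) eq = zero
    , (λ i bi≡0 → contradiction
        (subst (λ z → toℕ z ℕ.≤ 0) eq (subst (λ z → b zero ≤ᶠ z) bi≡0 (b-mono {zero} {i} z≤n))) λ ())
    , λ _ _ → z≤n
  -- The larger of `c zero` and the pivot of the rest; if it is `c zero`, monotonicity keeps it
  -- below all later values.
  by-first zero eq = let (k , low , high) = rest in Sum.[
      (λ c₀≤k → k
        , (λ { zero _ → c₀≤k ; (suc i) → low i })
        , λ { zero b₀≡1 → contradiction (trans (sym eq) b₀≡1) λ () ; (suc i) → high i })
    , (λ k≤c₀ → c zero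
        , (λ { zero _ → ℕₚ.≤-refl ; (suc i) bi≡0 → ℕₚ.≤-trans (low i bi≡0) k≤c₀ })
        , λ i _ → c-mono {zero} {i} z≤n)
    ]′ (ℕₚ.≤-total (toℕ (c zero)) (toℕ k))

-- Existence, uniqueness and continuity of couplings

push-sum : ∀ {m n} (θ : Fin m → Fin n) (f : Fin m → ℝ) →
           Σʳ.sum (λ j → mass (λ i → does (θ i Finₚ.≟ j)) f) ≈ʳ Σʳ.sum f
push-sum θ f = ℝ⁺.trans
  (ℝ⁺.sym (Σʳ.∑-comm λ i j → if does (θ i Finₚ.≟ j) then f i else 0ʳ))
  (Σʳ.sum-cong-≋ λ i → Σʳ.sum-↦ (θ i) (f i))

sum-0 : ∀ m → Σʳ.sum {m} (λ _ → 0ʳ) ≈ʳ 0ʳ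
sum-0 m = Σʳ.sum-ε {m} (λ _ → 0ʳ) λ _ → ℝ⁺.refl

mass-point : ∀ {m} (f : Fin m → ℝ) j → mass (λ i → does (i Finₚ.≟ j)) f ≈ʳ f j
mass-point f j = ℝ⁺.trans
  (Σʳ.sum-single (λ i → if does (i Finₚ.≟ j) then f i else 0ʳ) j
    λ i i≢j → ℝ⁺.reflexive (Σʳ.↦-≢ {x = f i} i≢j))
  (ℝ⁺.reflexive (Σʳ.↦-≡ {i = j} {x = f j} refl))

-- The weight `f k` is divided at height t: tail k - t stays at bit 0 and t - tail (k + 1) goes to
-- bit 1. The recursion drops entries until these two tails are the sum of all entries and of all
-- but the first.
split : ∀ {n} → (Fin (suc n) → ℝ) → ℝ → Fin (suc n) → Fin (suc (suc n)) → ℝ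
split f t zero    zero          = Σʳ.sum f -ʳ t
split f t zero    (suc zero)    = t -ʳ Σʳ.sum (f ∘ suc)
split f t zero    (suc (suc i)) = f (suc i)
split {suc n} f t (suc k) zero    = f zero
split {suc n} f t (suc k) (suc i) = split (f ∘ suc) t k i

module PrismMap (em : ∀ {ℓ} → ExcludedMiddle ℓ) where
  open Reals em
  open Topology em
  open Prism em

  abstract
    split-≥0 : ∀ {n} f t (k : Fin (suc n)) → (∀ i → 0ʳ ≤ʳ f i) →
               t ≤ʳ tail (toℕ k) f → tail (suc (toℕ k)) f ≤ʳ t → ∀ i → 0ʳ ≤ʳ split f t k i
    split-≥0 f t zero f≥0 t≤ ≤t zero          = minus-≥0 t≤
    split-≥0 f t zero f≥0 t≤ ≤t (suc zero)    =
      minus-≥0 (≤ʳ-trans (proj₂ (ℝ⁺.identityˡ _)) ≤t)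
    split-≥0 f t zero f≥0 t≤ ≤t (suc (suc i)) = f≥0 (suc i)
    split-≥0 {suc n} f t (suc k) f≥0 t≤ ≤t zero    = f≥0 zero
    split-≥0 {suc n} f t (suc k) f≥0 t≤ ≤t (suc i) = split-≥0 (f ∘ suc) t k (f≥0 ∘ suc)
      (≤ʳ-trans t≤ (proj₁ (tail-suc (toℕ k) f))) (≤ʳ-trans (proj₂ (tail-suc (suc (toℕ k)) f)) ≤t) i

    split-over : ∀ {n} f t (k : Fin (suc n)) j →
                 mass (λ i → does (pinch k i Finₚ.≟ j)) (split f t k) ≈ʳ f j
    -- Adding the remaining tail lets `+-minus` undo both differences: one lifts the tail to t, the
    -- other lifts t to the total.
    split-over {n} f t zero zero = +-cancelˡ (Σʳ.sum (f ∘ suc)) (ℝ⁺.trans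
      (ℝ⁺.∙-congˡ (ℝ⁺.trans (ℝ⁺.∙-congˡ (ℝ⁺.trans (ℝ⁺.∙-congˡ (sum-0 n)) (ℝ⁺.identityʳ y)))
                            (ℝ⁺.comm x y)))
      (ℝ⁺.trans (ℝ⁺.sym (ℝ⁺.assoc (Σʳ.sum (f ∘ suc)) y x))
      (ℝ⁺.trans (ℝ⁺.∙-congʳ (+-minus t (Σʳ.sum (f ∘ suc))))
      (ℝ⁺.trans (+-minus (Σʳ.sum f) t) (ℝ⁺.comm (f zero) (Σʳ.sum (f ∘ suc)))))))
      where
      x y : ℝ
      x = Σʳ.sum f -ʳ t
      y = t -ʳ Σʳ.sum (f ∘ suc)
    split-over f t zero (suc j) = ℝ⁺.trans (ℝ⁺.identityˡ _)
      (ℝ⁺.trans (ℝ⁺.identityˡ _) (mass-point (f ∘ suc) j))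
    split-over {suc n} f t (suc k) zero = ℝ⁺.trans (ℝ⁺.∙-congˡ (sum-0 (suc (suc n)))) (ℝ⁺.identityʳ (f zero))
    split-over {suc n} f t (suc k) (suc j) = ℝ⁺.trans (ℝ⁺.identityˡ _) (split-over (f ∘ suc) t k j)

    split-height : ∀ {n} f t (k : Fin (suc n)) → mass (isOne ∘ bit k) (split f t k) ≈ʳ t
    split-height f t zero = ℝ⁺.trans (ℝ⁺.identityˡ _)
      (ℝ⁺.trans (ℝ⁺.comm (t -ʳ Σʳ.sum (f ∘ suc)) _) (+-minus t (Σʳ.sum (f ∘ suc))))
    split-height {suc n} f t (suc k) = ℝ⁺.trans (ℝ⁺.identityˡ _) (split-height (f ∘ suc) t k)

    -- The tails begin above t and end at 0, so scanning from the left meets one that is at most t;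
    -- k is the position just before it.
    find-split : ∀ {n} (f : Fin (suc n) → ℝ) t → 0ʳ ≤ʳ t → t ≤ʳ Σʳ.sum f →
                 Σ (Fin (suc n)) λ k → t ≤ʳ tail (toℕ k) f × tail (suc (toℕ k)) f ≤ʳ t
    find-split {zero}  f t 0≤t t≤ = zero , t≤ , ≤ʳ-trans (proj₁ (ℝ⁺.identityˡ 0ʳ)) 0≤t
    find-split {suc n} f t 0≤t t≤ = Sum.[ (λ ≤t → zero , t≤ , ≤t) , later ]′ (≤ʳ⊎<ʳ (tail 1 f) t)
      where
      later : t <ʳ tail 1 f → Σ (Fin (suc (suc n))) λ k → t ≤ʳ tail (toℕ k) f × tail (suc (toℕ k)) f ≤ʳ t
      later t< =
        let (k , t≤ , ≤t) = find-split (f ∘ suc) t 0≤t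
              (≤ʳ-trans (<ʳ⇒≤ʳ t<) (proj₁ (ℝ⁺.identityˡ _)))
        in  suc k , ≤ʳ-trans t≤ (proj₂ (tail-suc (toℕ k) f))
            , ≤ʳ-trans (proj₁ (tail-suc (suc (toℕ k)) f)) ≤t

  module _ {n} (s : SimplexPoint n) (t : UnitPoint) where

    normal : ∀ k → value t ≤ʳ tail (toℕ k) (coord s) → tail (suc (toℕ k)) (coord s) ≤ʳ value t →
             ∃ (Normal (coord s) (value t) k)
    normal k t≤ ≤t = w , record
      { over = split-over (coord s) (value t) k ; height = split-height (coord s) (value t) k }
      where
      w : SimplexPoint (suc n)
      w = record
        { coord   = split (coord s) (value t) k
        ; coord≥0 = split-≥0 (coord s) (value t) k (SimplexPoint.coord≥0 s) t≤ ≤t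
        ; coord-∑ = ℝ⁺.trans (ℝ⁺.sym (push-sum (pinch k) (split (coord s) (value t) k)))
            (ℝ⁺.trans (Σʳ.sum-cong-≋ (split-over (coord s) (value t) k)) (SimplexPoint.coord-∑ s))
        }

    abstract
      -- The chosen k may jump where t meets a tail. It is abstract because nothing is used of it
      -- except that it has a normal form.
      some-normal : ∃ λ k → ∃ (Normal (coord s) (value t) k)
      some-normal =
        let (k , t≤ , ≤t) = find-split (coord s) (value t) (UnitPoint.0≤ t)
              (≤ʳ-trans (UnitPoint.≤1 t) (proj₂ (SimplexPoint.coord-∑ s)))
        in  k , normal k t≤ ≤t

  module _ (X : SimplicialSet) where
    open SimplicialSet X
    open Space ∣ X ⊠𝟚 ∣ˢ using () renaming (_≈_ to _~_; sym to ∼-sym; trans to ∼-trans)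
    private
      module X² = SimplicialSet (X ⊠𝟚)

    point : ∀ {n} {s : Fin (suc n) → ℝ} {t} → S.Carrier n → Coupling s t → Space.Point ∣ X ⊠𝟚 ∣ˢ
    point x L = L.dim , (act L.base x , L.bits) , L.weights
      where module L = Coupling L

    module _ {n} {s : Fin (suc n) → ℝ} {t : ℝ} (x : S.Carrier n) where

      -- The staircases of k and l differ only at positions between k and l, and by `normal-support`
      -- no weight sits there.
      normal-~ : ∀ {k l v w} (N : Normal s t k v) (M : Normal s t l w) →
                 point x (Normal.coupling N) ~ point x (Normal.coupling M)
      normal-~ {k} {l} {v} {w} N M = ∼-trans
        (~-on-support (X ⊠𝟚) D {v} off {act (pinchΔ k) x , bitΔ k} {act (pinchΔ l) x , bitΔ l} agree)
        (same~ (X ⊠𝟚) (X².S.refl (suc n) {act (pinchΔ l) x , bitΔ l}) (normal-weights N M))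
        where
        D : Fin (suc (suc n)) → Bool
        D i = does (pinch k i Finₚ.≟ pinch l i) ∧ does (bit k i Finₚ.≟ bit l i)
        D-true : ∀ i → pinch k i ≡ pinch l i → bit k i ≡ bit l i → D i ≡ true
        D-true i p q = cong₂ _∧_ (dec-true (_ Finₚ.≟ _) p) (dec-true (_ Finₚ.≟ _) q)
        off : ∀ i → D i ≡ false → coord v i ≈ʳ 0ʳ
        off i eq with ℕₚ.≤-<-connex (toℕ i) (toℕ k) | ℕₚ.≤-<-connex (toℕ i) (toℕ l)
        ... | inj₁ i≤k | inj₂ l<i = normal-support N M i≤k l<i
        ... | inj₂ k<i | inj₁ i≤l = ℝ⁺.trans (normal-weights N M i) (normal-support M N i≤l k<i)
        ... | inj₁ i≤k | inj₁ i≤l = contradiction (trans (sym eq) (D-true i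
              (Finₚ.toℕ-injective (trans (pinch-low k i i≤k) (sym (pinch-low l i i≤l))))
              (trans (bit-low k i i≤k) (sym (bit-low l i i≤l))))) λ ()
        ... | inj₂ k<i | inj₂ l<i = contradiction (trans (sym eq) (D-true i
              (Finₚ.toℕ-injective (ℕₚ.suc-injective
                (trans (pinch-high k i k<i) (sym (pinch-high l i l<i)))))
              (trans (bit-high k i k<i) (sym (bit-high l i l<i))))) λ ()
        agree : ∀ {m} (θ : m →Δ suc n) → (∀ i → D (app θ i) ≡ true) →
                X².S._≈_ m (act θ (act (pinchΔ k) x) , bitΔ k ∘Δ θ)
                           (act θ (act (pinchΔ l) x) , bitΔ l ∘Δ θ)
        agree {m} θ Dθ =
          S.trans m (S.sym m (act-∘ (pinchΔ k) θ x)) (S.trans m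
            (act-cong {θ = pinchΔ k ∘Δ θ} {pinchΔ l ∘Δ θ} (λ i → proj₁ (D⁻ (app θ i) (Dθ i))) (S.refl n))
            (act-∘ (pinchΔ l) θ x))
          , λ i → proj₂ (D⁻ (app θ i) (Dθ i))
          where
          D⁻ : ∀ i → D i ≡ true → pinch k i ≡ pinch l i × bit k i ≡ bit l i
          D⁻ i eq with pinch k i Finₚ.≟ pinch l i | bit k i Finₚ.≟ bit l i
          D⁻ i eq | yes p | yes q = p , q
          D⁻ i () | yes p | no  _
          D⁻ i () | no  _ | _

      -- The staircase of the pivot contains the chain of L; the inclusion φ pushes the weights
      -- forward, which gluing does not notice.
      normalise : ∀ L → ∃ λ k → ∃ λ w → Σ (Normal s t k w) λ N →
                  point x L ~ point x (Normal.coupling N)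
      normalise L = k , push φ L.weights , N
        , ∼-trans (same~ (X ⊠𝟚) (base≈ , sym ∘ bits≈) (λ _ → ℝ⁺.refl))
                  (glue~ (X ⊠𝟚) φ (act (pinchΔ k) x , bitΔ k) L.weights)
        where
        module L = Coupling L
        found : Σ (Fin (suc n)) λ k → (∀ i → app L.bits i ≡ zero → app L.base i ≤ᶠ k) ×
                        (∀ i → app L.bits i ≡ suc zero → k ≤ᶠ app L.base i)
        found = pivot (app L.base) (app L.bits) (mono L.base) (mono L.bits)
        k = proj₁ found
        φ : L.dim →Δ suc n
        φ = record
          { app  = λ i → chain (app L.bits i) (app L.base i)
          ; mono = λ {i} {j} i≤j → chain-mono (app L.bits i) (app L.bits j)
                                     (mono L.bits i≤j) (mono L.base i≤j)
          }
        base-eq : ∀ i → pinch k (app φ i) ≡ app L.base i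
        base-eq i = pinch-chain k _ _ (proj₁ (proj₂ found) i) (proj₂ (proj₂ found) i)
        bits≈ : ∀ i → bit k (app φ i) ≡ app L.bits i
        bits≈ i = bit-chain k _ _ (proj₁ (proj₂ found) i) (proj₂ (proj₂ found) i)
        base≈ : S._≈_ L.dim (act L.base x) (act φ (act (pinchΔ k) x))
        base≈ = S.trans L.dim (act-cong {θ = L.base} {pinchΔ k ∘Δ φ} (sym ∘ base-eq) (S.refl n))
                              (act-∘ (pinchΔ k) φ x)
        N : Normal s t k (push φ L.weights)
        N = record
          { over   = λ j → ℝ⁺.trans (push-∘ (pinchΔ k) φ L.weights {L.base} base-eq j) (L.over j)
          ; height = ℝ⁺.trans (push-∘ (bitΔ k) φ L.weights {L.bits} bits≈ (suc zero)) L.height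
          }

      coupling-unique : ∀ L M → point x L ~ point x M
      coupling-unique L M =
        let (_ , _ , N , L~N) = normalise L
            (_ , _ , O , M~O) = normalise M
        in  ∼-trans L~N (∼-trans (normal-~ N O) (∼-sym M~O))

    module _ {n : ℕ} where
      open Continuity em (Δᵗ n ×ₜ 𝕀)

      continuous-sum : ∀ {m} (f : Fin m → Space.Point (Δᵗ n ×ₜ 𝕀) → ℝ) {p} →
                       (∀ i → ContinuousAt (Δᵗ n ×ₜ 𝕀) (f i) p) →
                       ContinuousAt (Δᵗ n ×ₜ 𝕀) (λ q → Σʳ.sum λ i → f i q) p
      continuous-sum {zero}  f {p} c = continuous-const 0ʳ p
      continuous-sum {suc m} f {p} c = continuous-+ (c zero) (continuous-sum (f ∘ suc) (c ∘ suc))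

      continuous-tail : ∀ j p → ContinuousAt (Δᵗ n ×ₜ 𝕀) (λ (s , t) → tail j (coord s)) p
      continuous-tail j p@(s , t) = continuous-sum (λ i (s , t) → if up j i then coord s i else 0ʳ)
        λ i → summand i (up j i)
        where
        summand : ∀ i b → ContinuousAt (Δᵗ n ×ₜ 𝕀) (λ (s , t) → if b then coord s i else 0ʳ) p
        summand i true  = continuous-proj₁ {X = Δᵗ n} {𝕀}
          (coord-continuous {A = Space.setoid (Δᵗ n)} {coords = coord} {coords-cong = id} i s)
        summand i false = continuous-const 0ʳ p

      continuous-height : ∀ p → ContinuousAt (Δᵗ n ×ₜ 𝕀) (λ (s , t) → value t) p
      continuous-height (s , t) = continuous-proj₂ {X = Δᵗ n} {𝕀} (continuous-value t)

      -- For fixed k every tail of the weights is t or a tail of s, hence continuous in (s , t),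
      -- even though w is given only by a predicate.
      tail-formula : ∀ (k : Fin (suc n)) j → ∃ λ (φ : Space.Point (Δᵗ n ×ₜ 𝕀) → ℝ) →
        (∀ p → ContinuousAt (Δᵗ n ×ₜ 𝕀) φ p) ×
        (∀ {s t w} → Normal (coord s) (value t) k w → tail j (coord w) ≈ʳ φ (s , t))
      tail-formula k j = cases j (ℕₚ.<-cmp j (suc (toℕ k)))
        where
        cases : ∀ j → RB.Tri (j ℕ.< suc (toℕ k)) (j ≡ suc (toℕ k)) (suc (toℕ k) ℕ.< j) →
                ∃ λ (φ : Space.Point (Δᵗ n ×ₜ 𝕀) → ℝ) →
                (∀ p → ContinuousAt (Δᵗ n ×ₜ 𝕀) φ p) ×
                (∀ {s t w} → Normal (coord s) (value t) k w → tail j (coord w) ≈ʳ φ (s , t))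
        cases j (RB.tri< j≤k _ _) = (λ (s , t) → tail j (coord s)) , continuous-tail j
          , λ N → Normal.R≤S N (ℕ.s≤s⁻¹ j≤k) , Normal.S≤R N j
        cases j (RB.tri≈ _ refl _) = (λ (s , t) → value t) , continuous-height
          , λ N → Normal.R≤t N ℕₚ.≤-refl , Normal.t≤R N ℕₚ.≤-refl
        cases (suc j) (RB.tri> _ _ k<j) = (λ (s , t) → tail j (coord s)) , continuous-tail j
          , λ N → Normal.R-suc≤S N j , Normal.S≤R-suc N (ℕ.s≤s⁻¹ k<j)

      -- Each weight solves w i + tail (i + 1) = tail i with both tails continuous. So
      -- `near-summand` controls every normal form at nearby points, without asserting that one
      -- exists there.
      near-normal : ∀ {U s t k w} → Space.Open (Δᵗ (suc n)) U → U w → Normal (coord s) (value t) k w →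
        Near (Δᵗ n ×ₜ 𝕀) (s , t) λ (s , t) → ∀ w → Normal (coord s) (value t) k w → U w
      near-normal {U} {s} {t} {k} {w} oU w∈U N =
        let (β , w∈β , β⊆U) = oU w w∈U in
        near-map (λ f w′ N′ → β⊆U w′ λ i → Below⇒<ʳ (proj₁ (f i) N′) , proj₂ (f i) N′)
          (near-∀ λ i → coordinate i (<ʳ⇒Below (proj₁ (w∈β i))) (proj₂ (w∈β i)))
        where
        coordinate : ∀ i {l u} → Below (coord w i) l → coord w i <ʳ fromℚ u →
          Near (Δᵗ n ×ₜ 𝕀) (s , t) λ (s , t) →
            (∀ {w} → Normal (coord s) (value t) k w → Below (coord w i) l) ×
            (∀ {w} → Normal (coord s) (value t) k w → coord w i <ʳ fromℚ u)
        coordinate i {l} {u} below above =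
          let (φ  , φ-cont  , φ-eq ) = tail-formula k (toℕ i)
              (φ⁺ , φ⁺-cont , φ⁺-eq) = tail-formula k (suc (toℕ i))
              step : ∀ {s t w} → Normal (coord s) (value t) k w → coord w i +ʳ φ⁺ (s , t) ≈ʳ φ (s , t)
              step {w = w} N = ℝ⁺.trans (ℝ⁺.∙-congˡ (ℝ⁺.sym (φ⁺-eq N)))
                (ℝ⁺.trans (tail-step i (coord w)) (φ-eq N))
              (lo , hi) = near-summand (φ⁺-cont (s , t)) (φ-cont (s , t)) (step N)
          in  near-map (λ (f , g) → (λ N → f (step N)) , (λ N → g (step N)))
                (near-∩ (lo {l} below) (hi {u} above))

    prism : Continuous (∣ X ∣ˢ ×ₜ 𝕀) ∣ X ⊠𝟚 ∣ˢ
    prism = record { to = to′ ; to-cong = to-cong′ ; preimage = preimage′ }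
      where
      open Realization X using (Cell; Glue; glue; same)

      chosen : ∀ {n} (s : SimplexPoint n) t → Coupling (coord s) (value t)
      chosen s t = Normal.coupling (proj₂ (proj₂ (some-normal s t)))

      to′ : Space.Point (∣ X ∣ˢ ×ₜ 𝕀) → Space.Point ∣ X ⊠𝟚 ∣ˢ
      to′ ((n , x , s) , t) = point x (chosen s t)

      move : ∀ {n} {s s′ : Fin (suc n) → ℝ} {t t′} → (∀ i → s i ≈ʳ s′ i) → t ≈ʳ t′ →
             Coupling s t → Coupling s′ t′
      move s≈s′ t≈t′ L = record
        { base = L.base ; bits = L.bits ; weights = L.weights
        ; over = λ i → ℝ⁺.trans (L.over i) (s≈s′ i) ; height = ℝ⁺.trans L.height t≈t′ }
        where module L = Coupling L

      -- The same weights serve after moving the base along θ, so the prism map respects the gluing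
      -- of |X|.
      along : ∀ {m n} (θ : m →Δ n) s t → Coupling (coord s) (value t) →
              Coupling (coord (push θ s)) (value t)
      along θ s t L = record
        { base = θ ∘Δ L.base ; bits = L.bits ; weights = L.weights
        ; over = λ i → ℝ⁺.trans (ℝ⁺.sym (push-∘ θ L.base L.weights {θ ∘Δ L.base} (λ _ → refl) i))
                                (push-cong θ {push L.base L.weights} {s} L.over i)
        ; height = L.height }
        where module L = Coupling L

      glue-cong : ∀ t {c d} → Glue c d → to′ (c , t) ~ to′ (d , t)
      glue-cong t (glue θ x s) = ∼-trans
        (same~ (X ⊠𝟚) (S.sym L.dim (act-∘ θ L.base x) , λ _ → refl) λ _ → ℝ⁺.refl)
        (coupling-unique x (along θ s t (chosen s t)) (chosen (push θ s) t))
        where module L = Coupling (chosen s t)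
      glue-cong t (same {x = x} {y} {s} {s′} x≈y s≈s′) = ∼-trans
        (same~ (X ⊠𝟚) (act-cong {θ = L.base} {L.base} (λ _ → refl) x≈y , λ _ → refl) λ _ → ℝ⁺.refl)
        (coupling-unique y (move s≈s′ ℝ⁺.refl (chosen s t)) (chosen s′ t))
        where module L = Coupling (chosen s t)

      to-cong′ : ∀ {p q} → Space._≈_ (∣ X ∣ˢ ×ₜ 𝕀) p q → to′ p ~ to′ q
      to-cong′ {c , t} {d@(n , x , s) , t′} (c≈d , t≈t′) = ∼-trans
        (EqC.gfold (Setoid.isEquivalence (Space.setoid ∣ X ⊠𝟚 ∣ˢ)) (λ c → to′ (c , t)) (glue-cong t) c≈d)
        (coupling-unique x (move (λ _ → ℝ⁺.refl) t≈t′ (chosen s t)) (chosen s t′))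

      preimage′ : ∀ {U} → Space.Open ∣ X ⊠𝟚 ∣ˢ U → Space.Open (∣ X ∣ˢ ×ₜ 𝕀) (U ∘ to′)
      preimage′ {U} (resp , oU) = open-|X|×𝕀 X (λ p≈q → resp (to-cong′ p≈q))
        λ {n} x → open-×⁺ {X = Δᵗ n} {𝕀} λ s t u → near-map
          (λ { {s , t} f → let (k , w , N) = some-normal s t in f k w N })
          (near-∀ λ k → piece x s t u k)
        where
        -- The points with a normal form of a given k form a closed set, and
        -- finitely many of these cover Δⁿ × 𝕀.
        module _ {n} (x : S.Carrier n) s t (u : U (to′ ((n , x , s) , t))) (k : Fin (suc n)) where
          open Continuity em (Δᵗ n ×ₜ 𝕀)

          Piece : Set _
          Piece = Near (Δᵗ n ×ₜ 𝕀) (s , t) λ (s , t) → ∀ w → Normal (coord s) (value t) k w →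
                  U (suc n , (act (pinchΔ k) x , bitΔ k) , w)

          within : value t ≤ʳ tail (toℕ k) (coord s) → tail (suc (toℕ k)) (coord s) ≤ʳ value t → Piece
          within t≤ ≤t = let (w , N) = normal s t k t≤ ≤t in
            near-normal (oU _) (resp (coupling-unique x (chosen s t) (Normal.coupling N)) u) N

          -- Off the closed piece one of its two defining inequalities fails strictly. This persists
          -- nearby and excludes normal forms for k, so the claim is vacuous there.
          above : tail (toℕ k) (coord s) <ʳ value t → Piece
          above <t = near-map
            (λ lt w N → ⊥-elim (<ʳ-irrefl lt (≤ʳ-trans (Normal.t≤R N (ℕₚ.n≤1+n _))
                                                       (Normal.R≤S N ℕₚ.≤-refl))))
            (near-< (continuous-tail (toℕ k) (s , t)) (continuous-height (s , t)) <t)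

          below : value t <ʳ tail (suc (toℕ k)) (coord s) → Piece
          below t< = near-map
            (λ lt w N → ⊥-elim (<ʳ-irrefl lt (≤ʳ-trans (Normal.S≤R-suc N ℕₚ.≤-refl)
                                                       (Normal.R≤t N (ℕₚ.m≤n⇒m≤1+n ℕₚ.≤-refl)))))
            (near-< (continuous-height (s , t)) (continuous-tail (suc (toℕ k)) (s , t)) t<)

          piece : Piece
          piece = Sum.[ (λ t≤ → Sum.[ within t≤ , below ]′ (≤ʳ⊎<ʳ (tail (suc (toℕ k)) (coord s)) (value t)))
                      , above ]′ (≤ʳ⊎<ʳ (value t) (tail (toℕ k) (coord s)))

    constΔ : ∀ {m} → Fin 2 → m →Δ 1
    constΔ b = record { app = λ _ → b ; mono = λ _ → ℕₚ.≤-refl }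

    end : ∀ {n} (s : SimplexPoint n) (t : UnitPoint) b →
          coord (push (constΔ b) s) (suc zero) ≈ʳ value t → Coupling (coord s) (value t)
    end s t b height = record
      { base = idΔ ; bits = constΔ b ; weights = s
      ; over = push-id {θ = idΔ} (λ _ → refl) s ; height = height }

    -- When t is an end of the interval, the simplex itself with constant bits is a coupling, and
    -- uniqueness identifies it with the chosen one.
    prism-at : ∀ {n} (x : S.Carrier n) s t b → coord (push (constΔ b) s) (suc zero) ≈ʳ value t →
               to prism ((n , x , s) , t) ~ (n , (x , constΔ b) , s)
    prism-at {n} x s t b height = ∼-trans
      (coupling-unique x (Normal.coupling (proj₂ (proj₂ (some-normal s t)))) (end s t b height))
      (same~ (X ⊠𝟚) (act-id x , λ _ → refl) λ _ → ℝ⁺.refl)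

    prism-0 : ∀ {n} (x : S.Carrier n) s → to prism ((n , x , s) , 0ᴵ) ~ (n , (x , constΔ zero) , s)
    prism-0 {n} x s = prism-at x s 0ᴵ zero (sum-0 (suc n))

    prism-1 : ∀ {n} (x : S.Carrier n) s → to prism ((n , x , s) , 1ᴵ) ~ (n , (x , constΔ (suc zero)) , s)
    prism-1 x s = prism-at x s 1ᴵ (suc zero) (SimplexPoint.coord-∑ s)

-- Homotopies from natural transformations

record NaturalTransformation {C D : Category 1ℓ 0ℓ 0ℓ} (F G : Functor C D) : Set 1ℓ where
  private
    module C = Category C
    module D = Category D
    module F = Functor F
    module G = Functor G
  field
    η       : ∀ A → D.Hom (F.F₀ A) (G.F₀ A)
    natural : ∀ {A B} (f : C.Hom A B) → η B D.∙ F.F₁ f D.≈ G.F₁ f D.∙ η A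

idF : ∀ {C : Category 1ℓ 0ℓ 0ℓ} → Functor C C
idF {C} = record
  { F₀ = id ; F₁ = id ; F-cong = id ; F-id = C.≈.refl ; F-∙ = λ _ _ → C.≈.refl }
  where module C = Category C

idN : ∀ {C : Category 1ℓ 0ℓ 0ℓ} → NaturalTransformation (idF {C}) idF
idN {C} = record
  { η = λ _ → C.idₕ ; natural = λ f → C.≈.trans (C.identityˡ f) (C.≈.sym (C.identityʳ f)) }
  where module C = Category C

module _ {C D : Category 1ℓ 0ℓ 0ℓ} {F G : Functor C D} (α : NaturalTransformation F G) where
  private
    module C = Category C
    module D = Category D
    module F = Functor F
    module G = Functor G
    open NaturalTransformation α

    -- With `arr` this is α read as a functor from C × {0 < 1} to D: over 0 < 1 an arrow goes to the
    -- diagonal of its naturality square.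
    obj : Fin 2 → C.Obj → D.Obj
    obj zero       = F.F₀
    obj (suc zero) = G.F₀

    arr : ∀ b c {A B} → b ≤ᶠ c → C.Hom A B → D.Hom (obj b A) (obj c B)
    arr zero       zero           _ f = F.F₁ f
    arr zero       (suc zero) {A} _ f = G.F₁ f D.∙ η A
    arr (suc zero) (suc zero)     _ f = G.F₁ f

    arr-cong : ∀ b c {A B} (p q : b ≤ᶠ c) {f g : C.Hom A B} → f C.≈ g → arr b c p f D.≈ arr b c q g
    arr-cong zero       zero       _ _ f≈g = F.F-cong f≈g
    arr-cong zero       (suc zero) _ _ f≈g = D.∙-cong (G.F-cong f≈g) D.≈.refl
    arr-cong (suc zero) (suc zero) _ _ f≈g = G.F-cong f≈g

    arr-id : ∀ b {A} (p : b ≤ᶠ b) → arr b b p (C.idₕ {A}) D.≈ D.idₕ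
    arr-id zero       _ = F.F-id
    arr-id (suc zero) _ = G.F-id

    arr-∙ : ∀ b c d {X Y Z} (p : b ≤ᶠ c) (q : c ≤ᶠ d) (r : b ≤ᶠ d)
            (g : C.Hom Y Z) (f : C.Hom X Y) →
            arr b d r (g C.∙ f) D.≈ arr c d q g D.∙ arr b c p f
    arr-∙ zero zero zero _ _ _ g f = F.F-∙ g f
    arr-∙ zero zero (suc zero) _ _ _ g f = D.≈.trans (D.∙-cong (G.F-∙ g f) D.≈.refl)
      (D.≈.trans (D.assoc _ _ _) (D.≈.trans (D.∙-cong D.≈.refl (D.≈.sym (natural f)))
      (D.≈.sym (D.assoc _ _ _))))
    arr-∙ zero (suc zero) (suc zero) _ _ _ g f =
      D.≈.trans (D.∙-cong (G.F-∙ g f) D.≈.refl) (D.assoc _ _ _)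
    arr-∙ (suc zero) (suc zero) (suc zero) _ _ _ g f = G.F-∙ g f

    arr-≋ : ∀ {b b′ c c′} (p : b ≤ᶠ c) (p′ : b′ ≤ᶠ c′) → b ≡ b′ → c ≡ c′ →
            ∀ {A B A′ B′} {f : C.Hom A B} {f′ : C.Hom A′ B′} → f C.≋ f′ →
            arr b c p f D.≋ arr b′ c′ p′ f′
    arr-≋ {b} {_} {c} p p′ refl refl (C.≈⇒≋ f≈f′) = D.≈⇒≋ (arr-cong b c p p′ f≈f′)

    mixed : ∀ {n} → Functor (Ordinal n) C → n →Δ 1 → Functor (Ordinal n) D
    mixed σ β = record
      { F₀     = λ i → obj (app β i) (σ.F₀ i)
      ; F₁     = λ {i} {j} p → arr (app β i) (app β j) (mono β p) (σ.F₁ p)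
      ; F-cong = λ {i} {j} {p} {q} _ → arr-cong (app β i) (app β j) (mono β p) (mono β q) (σ.F-cong _)
      ; F-id   = λ {i} → D.≈.trans
          (arr-cong (app β i) (app β i) (mono β Finₚ.≤-refl) (mono β Finₚ.≤-refl) σ.F-id)
          (arr-id (app β i) (mono β Finₚ.≤-refl))
      ; F-∙    = λ {i} {j} {k} q p → D.≈.trans
          (arr-cong (app β i) (app β k) (mono β (Finₚ.≤-trans p q)) (mono β (Finₚ.≤-trans p q)) (σ.F-∙ q p))
          (arr-∙ (app β i) (app β j) (app β k) (mono β p) (mono β q) (mono β (Finₚ.≤-trans p q))
                 (σ.F₁ q) (σ.F₁ p))
      }
      where module σ = Functor σ

  cylinder : SimplicialMap (Nerve C ⊠𝟚) (Nerve D)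
  cylinder = record
    { map      = λ (σ , β) → mixed σ β
    ; map-cong = λ {_} {(σ , β)} {(τ , γ)} (σ≈τ , β≗γ) {i} {j} p →
        arr-≋ (mono β p) (mono γ p) (β≗γ i) (β≗γ j) (σ≈τ p)
    ; natural  = λ _ _ _ → D.≋-refl
    }

  module _ (em : ∀ {ℓ} → ExcludedMiddle ℓ) where
    open Topology em
    open Prism em
    open PrismMap em

    nat⇒homotopy : Homotopy (B₁ F) (B₁ G)
    nat⇒homotopy = record
      { H   = realize cylinder ∘ᶜ prism (Nerve C)
      ; at0 = λ (n , σ , s) → B.trans (to-cong (prism-0 (Nerve C) σ s))
          (same~ (Nerve D) (λ _ → D.≋-refl) λ _ → ∑ʳ.refl)
      ; at1 = λ (n , σ , s) → B.trans (to-cong (prism-1 (Nerve C) σ s))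
          (same~ (Nerve D) (λ _ → D.≋-refl) λ _ → ∑ʳ.refl)
      }
      where
      module B = Space (B D)
      open Continuous (realize cylinder) using (to-cong)

module _ (em : ∀ {ℓ} → ExcludedMiddle ℓ) {C D : Category 1ℓ 0ℓ 0ℓ} where
  open Topology em
  open Prism em

  -- On C both transformations point to T, so the two homotopies meet at time 1, as
  -- `homotopy-zigzag` expects. Taking T to be the identity covers a direct transformation from G F
  -- to the identity.
  B₁-equivalence : (F : Functor C D) (G : Functor D C) {T : Functor C C} →
    NaturalTransformation (G ∘F F) T → NaturalTransformation idF T →
    NaturalTransformation (F ∘F G) idF → IsHomotopyEquivalence (B₁ F)
  B₁-equivalence F G {T} α β γ = record
    { g   = B₁ G
    ; g∘f = homotopy-resp {X = B C} {B C} {B₁ (G ∘F F)} {B₁ G ∘ᶜ B₁ F} {B₁ idF} {idᶜ}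
        (λ _ → same~ (Nerve C) (λ _ → C.≋-refl) λ _ → ∑ʳ.refl)
        (λ _ → same~ (Nerve C) (λ _ → C.≋-refl) λ _ → ∑ʳ.refl)
        (homotopy-zigzag {X = B C} {B C} {B₁ (G ∘F F)} {B₁ idF} {B₁ T}
          (nat⇒homotopy {C} {C} {G ∘F F} {T} α em) (nat⇒homotopy {C} {C} {idF} {T} β em))
    ; f∘g = homotopy-resp {X = B D} {B D} {B₁ (F ∘F G)} {B₁ F ∘ᶜ B₁ G} {B₁ idF} {idᶜ}
        (λ _ → same~ (Nerve D) (λ _ → D.≋-refl) λ _ → ∑ʳ.refl)
        (λ _ → same~ (Nerve D) (λ _ → D.≋-refl) λ _ → ∑ʳ.refl)
        (nat⇒homotopy {D} {D} {F ∘F G} {idF} γ em)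
    }
    where
    module C = Category C
    module D = Category D

-- Matroids of vectors

private
  fromBool : Bool → Fin 2
  fromBool = Inverse.from Finₚ.2↔Bool

  toBool : Fin 2 → Bool
  toBool = Inverse.to Finₚ.2↔Bool

  toBool-fromBool : ∀ b → toBool (fromBool b) ≡ b
  toBool-fromBool = Inverse.strictlyInverseˡ Finₚ.2↔Bool

  fromBool-toBool : ∀ i → fromBool (toBool i) ≡ i
  fromBool-toBool = Inverse.strictlyInverseʳ Finₚ.2↔Bool

  funToFin-cong : ∀ {m n} {f g : Fin m → Fin n} → f ≗ g → funToFin f ≡ funToFin g
  funToFin-cong {zero}  f≗g = refl
  funToFin-cong {suc m} f≗g = cong₂ combine (f≗g zero) (funToFin-cong (f≗g ∘ suc))

-- Ground sets are of the form `Fin n` and vectors are equal only pointwise, so the vectors are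
-- numbered.
vector : ∀ r → Fin (2 ℕ.^ r) → Fin r → Bool
vector r k i = toBool (finToFun {2} {r} k i)

index : ∀ {r} → (Fin r → Bool) → Fin (2 ℕ.^ r)
index v = funToFin (fromBool ∘ v)

vector-index : ∀ {r} (v : Fin r → Bool) → vector r (index v) ≗ v
vector-index v i = trans (cong toBool (Finₚ.finToFun-funToFin (fromBool ∘ v) i)) (toBool-fromBool (v i))

index-cong : ∀ {r} {v w : Fin r → Bool} → v ≗ w → index v ≡ index w
index-cong v≗w = funToFin-cong λ i → cong fromBool (v≗w i)

index-vector : ∀ r (k : Fin (2 ℕ.^ r)) → index (vector r k) ≡ k
index-vector r k = trans
  (funToFin-cong {g = finToFun {2} {r} k} λ i → fromBool-toBool (finToFun {2} {r} k i))
  (Finₚ.funToFin-finToFin {r} k)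

index-injective : ∀ {r} {v w : Fin r → Bool} → index v ≡ index w → v ≗ w
index-injective {r} {v} {w} eq i =
  trans (sym (vector-index v i)) (trans (cong (λ k → vector r k i) eq) (vector-index w i))

-- Over 𝔽₂ dimensions can be compared by counting vectors.
injective⇒dim-≤ : ∀ {a b} (φ : (Fin a → Bool) → Fin b → Bool) →
                  (∀ {v w} → φ v ≗ φ w → v ≗ w) → a ℕ.≤ b
injective⇒dim-≤ {a} {b} φ inj = ℕₚ.≮⇒≥ λ b<a → ℕₚ.<⇒≱ (ℕₚ.^-monoʳ-< 2 (s≤s (s≤s z≤n)) b<a)
  (Finₚ.injective⇒≤ {f = λ k → index (φ (vector a k))} λ {k} {l} eq →
    trans (sym (index-vector a k)) (trans (index-cong (inj (index-injective eq))) (index-vector a l)))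

xor-false⇒≡ : ∀ {a b} → a xor b ≡ false → a ≡ b
xor-false⇒≡ {true}  {true}  _ = refl
xor-false⇒≡ {false} {false} _ = refl

-- Free families over 𝔽₂

module _ {V : VectorSpace} where
  open Lin V
  open Combinations V

  private
    comb-diff : ∀ {n} {c d : Fin n → Bool} {v} → comb c v ≈ᴹ comb d v →
                comb (λ i → c i xor d i) v ≈ᴹ 0ᴹ
    comb-diff {c = c} {d} {v} eq =
      ≈ᴹ-trans (comb-+ c d v) (≈ᴹ-trans (+ᴹ-congʳ eq) (x+x (comb d v)))

  module _ {n} {ρ : Fin n → Carrierᴹ} where

    free-injective : ∀ {S} → Free ρ S → ∀ {c d : Fin ∣ S ∣ → Bool} →
                     comb c (ρ ∘ enum S) ≈ᴹ comb d (ρ ∘ enum S) → c ≗ d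
    free-injective {S} free {c} {d} eq i = xor-false⇒≡ (trans
      (sym (pushforward-at (enum S) b (enum-injective S) i))
      (free (pushforward (enum S) b)
        (λ e e∉S → pushforward-off (enum S) b e λ j j≡e →
          contradiction (subst (_∈ S) j≡e (enum-∈ S j)) e∉S)
        (≈ᴹ-trans (comb-push (enum S) b ρ) (comb-diff {c = c} {d} eq)) (enum S i)))
      where
      b : Fin ∣ S ∣ → Bool
      b i = c i xor d i

    -- Reading off coefficients over S embeds the 2^a vectors `vs c` into 𝔽₂^∣ S ∣. The exchange
    -- axiom and the existence of a basis both come down to this count.
    span-coefficients : ∀ {a} S (vs : (Fin a → Bool) → Carrierᴹ) →
                        (∀ {c d} → vs c ≈ᴹ vs d → c ≗ d) → (∀ c → InSpan ρ S (vs c)) → a ℕ.≤ ∣ S ∣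
    span-coefficients {a} S vs inj inS = injective⇒dim-≤
      (λ c → proj₁ (inS c) ∘ enum S)
      (λ {c} {d} eq → inj (≈ᴹ-trans (coefficients c)
        (≈ᴹ-trans (comb-cong (ρ ∘ enum S) eq) (≈ᴹ-sym (coefficients d)))))
      where
      coefficients : ∀ c → vs c ≈ᴹ comb (proj₁ (inS c) ∘ enum S) (ρ ∘ enum S)
      coefficients c = let (d , sd , eq) = inS c in ≈ᴹ-sym (≈ᴹ-trans (restrict S d ρ sd) eq)

    -- A relation on S with e added either has coefficient 0 at e and lives on S, or expresses ρ e
    -- through S, signs being irrelevant over 𝔽₂.
    free-extend : ∀ {S e} → Free ρ S → ¬ InSpan ρ S (ρ e) → Free ρ (S ∪ ⁅ e ⁆)
    free-extend {S} {e} free e∉span c sc eq with c e in ce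
    ... | false = free c off eq
      where
      off : ∀ j → j ∉ S → c j ≡ false
      off j j∉S with e Finₚ.≟ j
      ... | yes refl = ce
      ... | no  e≢j  = sc j λ j∈ → Sum.[ j∉S , (λ j∈e → e≢j (sym (Subₚ.x∈⁅y⁆⇒x≡y e j∈e))) ]′
                                         (Subₚ.x∈p∪q⁻ S ⁅ e ⁆ j∈)
    ... | true  = contradiction
      ((λ j → c j xor ⟦ e ⟧ j) , off
      , ≈ᴹ-trans (comb-+ c ⟦ e ⟧ ρ) (≈ᴹ-trans (+ᴹ-cong eq (comb-⟦⟧ e ρ)) (+ᴹ-identityˡ _)))
      e∉span
      where
      off : ∀ j → j ∉ S → c j xor ⟦ e ⟧ j ≡ false
      off j j∉S with e Finₚ.≟ j
      ... | yes refl = cong (_xor true) ce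
      ... | no  e≢j  = trans (Boolₚ.xor-identityʳ (c j)) (sc j λ j∈ →
            Sum.[ j∉S , (λ j∈e → e≢j (sym (Subₚ.x∈⁅y⁆⇒x≡y e j∈e))) ]′ (Subₚ.x∈p∪q⁻ S ⁅ e ⁆ j∈))

    InjectiveOn : Subset n → Set
    InjectiveOn S = ∀ {e e′} → e ∈ S → e′ ∈ S → ρ e ≈ᴹ ρ e′ → e ≡ e′

    Image : Subset n → Carrierᴹ → Set
    Image S v = ∃ λ e → e ∈ S × ρ e ≈ᴹ v

    free⇒injectiveOn : ∀ {S} → Free ρ S → InjectiveOn S
    free⇒injectiveOn {S} free {e} {e′} e∈S e′∈S eq = decidable-stable (e Finₚ.≟ e′) λ e≢e′ →
      contradiction (trans (sym (cong₂ _xor_ (⟦⟧-same e) (⟦⟧-diff {i = e′} {e} (e≢e′ ∘ sym))))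
        (free (λ j → ⟦ e ⟧ j xor ⟦ e′ ⟧ j)
          (λ j j∉S → cong₂ _xor_ (⟦⟧-diff {i = e} {j} λ { refl → j∉S e∈S })
                                 (⟦⟧-diff {i = e′} {j} λ { refl → j∉S e′∈S }))
          (comb-diff {c = ⟦ e ⟧} {⟦ e′ ⟧}
            (≈ᴹ-trans (comb-⟦⟧ e ρ) (≈ᴹ-trans eq (≈ᴹ-sym (comb-⟦⟧ e′ ρ)))))
          e)) λ ()

    free⇒independent : ∀ {S} → Free ρ S → LinearlyIndependent (Image S)
    free⇒independent {S} free {k} v v∈ inj c eq i = trans (sym (pushforward-at g c g-inj i))
      (free (pushforward g c)
        (λ e e∉S → pushforward-off g c e λ j gj≡e →
          contradiction (subst (_∈ S) gj≡e (proj₁ (proj₂ (v∈ j)))) e∉S)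
        (≈ᴹ-trans (comb-push g c ρ) (≈ᴹ-trans (comb-congʳ c λ j → proj₂ (proj₂ (v∈ j))) eq))
        (g i))
      where
      g : Fin k → Fin n
      g j = proj₁ (v∈ j)
      g-inj : Injective _≡_ _≡_ g
      g-inj {a} {b} ga≡gb = inj (≈ᴹ-trans (≈ᴹ-sym (proj₂ (proj₂ (v∈ a))))
        (≈ᴹ-trans (≈ᴹ-reflexive (cong ρ ga≡gb)) (proj₂ (proj₂ (v∈ b)))))

    independent⇒free : ∀ {S} → InjectiveOn S → LinearlyIndependent (Image S) → Free ρ S
    independent⇒free {S} inj li c sc eq e = decide (e Subₚ.∈? S)
      where
      decide : Dec (e ∈ S) → c e ≡ false
      decide (no  e∉S) = sc e e∉S
      decide (yes e∈S) = let (i , enum-i) = enum-onto S e∈S in trans (cong c (sym enum-i))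
        (li (ρ ∘ enum S) (λ j → enum S j , enum-∈ S j , ≈ᴹ-refl)
          (λ eq → enum-injective S (inj (enum-∈ S _) (enum-∈ S _) eq))
          (c ∘ enum S) (≈ᴹ-trans (restrict S c ρ sc) eq) i)

    -- For a family, two labels with the same vector already give a relation. A condition on the set
    -- of vectors cannot see this, so injectivity appears beside it.
    free⇔independent : ∀ S → Free ρ S ⇔ (InjectiveOn S × LinearlyIndependent (Image S))
    free⇔independent S = mk⇔ forth back
      where
      forth : Free ρ S → InjectiveOn S × LinearlyIndependent (Image S)
      forth free = free⇒injectiveOn free , free⇒independent free
      back : InjectiveOn S × LinearlyIndependent (Image S) → Free ρ S
      back p = independent⇒free {S} (proj₁ p) (proj₂ p)

  free-⊆ : ∀ {n} {ρ : Fin n → Carrierᴹ} {S T} → T ⊆ S → Free ρ S → Free ρ T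
  free-⊆ T⊆S free c sc = free c λ e e∉S → sc e (e∉S ∘ T⊆S)

  module _ {m n} {g : Fin m → Fin n} (inj : Injective _≡_ _≡_ g) {σ : Fin n → Carrierᴹ} where

    free-image : ∀ S → Free (σ ∘ g) S ⇔ Free σ (g [ S ])
    free-image S = mk⇔ pushed pulled
      where
      pushed : Free (σ ∘ g) S → Free σ (g [ S ])
      pushed free d sd eq j = decide (j Subₚ.∈? g [ S ])
        where
        spread : pushforward g (d ∘ g) ≗ d
        spread j with j Subₚ.∈? g [ S ]
        ... | yes j∈ = let (i , _ , gi≡j) = ∈-image⁻ g S j∈ in
              subst (λ j → pushforward g (d ∘ g) j ≡ d j) gi≡j (pushforward-at g (d ∘ g) inj i)
        ... | no  j∉ = trans (pushforward-off g (d ∘ g) j λ i gi≡j → trans (cong d gi≡j) (sd j j∉))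
                             (sym (sd j j∉))
        decide : Dec (j ∈ g [ S ]) → d j ≡ false
        decide (no  j∉) = sd j j∉
        decide (yes j∈) = let (i , _ , gi≡j) = ∈-image⁻ g S j∈ in trans (cong d (sym gi≡j))
          (free (d ∘ g)
            (λ k k∉S → sd (g k) λ gk∈ → let (k′ , k′∈S , eq) = ∈-image⁻ g S gk∈ in
              k∉S (subst (_∈ S) (inj eq) k′∈S))
            (≈ᴹ-trans (≈ᴹ-sym (comb-push g (d ∘ g) σ)) (≈ᴹ-trans (comb-cong σ spread) eq)) i)
      pulled : Free σ (g [ S ]) → Free (σ ∘ g) S
      pulled free c sc eq i = trans (sym (pushforward-at g c inj i))
        (free (pushforward g c)
          (λ j j∉ → pushforward-off g c j λ k gk≡j → sc k λ k∈S →
            j∉ (subst (_∈ g [ S ]) gk≡j (∈-image⁺ g k∈S)))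
          (≈ᴹ-trans (comb-push g c σ) eq) (g i))

module _ {V W : VectorSpace} (A : V ≅ W) where
  private
    module V = Lin V
    module W = Lin W
    module A = _≅_ A
    module CV = Combinations V
    module CW = Combinations W

  ≅-comb : ∀ {n} c (v : Fin n → V.Carrierᴹ) → A.to (V.comb c v) W.≈ᴹ W.comb c (A.to ∘ v)
  ≅-comb {zero}  c v = A.0ᴹ-homo
  ≅-comb {suc n} c v = W.≈ᴹ-trans (A.+ᴹ-homo _ _)
    (W.+ᴹ-cong (A.*ₗ-homo (c zero) (v zero)) (≅-comb (c ∘ suc) (v ∘ suc)))

  ≅-inverseʳ : ∀ y → A.to (_≅_.to (≅-sym A) y) W.≈ᴹ y
  ≅-inverseʳ y = proj₂ (A.surjective y) V.≈ᴹ-refl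

  ≅-inverseˡ : ∀ x → _≅_.to (≅-sym A) (A.to x) V.≈ᴹ x
  ≅-inverseˡ x = A.injective (≅-inverseʳ (A.to x))

  module _ {n} {ρ : Fin n → V.Carrierᴹ} {σ : Fin n → W.Carrierᴹ}
           (σ≈Aρ : ∀ e → σ e W.≈ᴹ A.to (ρ e)) where
    private
      comb-σ : ∀ c → A.to (V.comb c ρ) W.≈ᴹ W.comb c σ
      comb-σ c = W.≈ᴹ-trans (≅-comb c ρ) (CW.comb-congʳ c λ e → W.≈ᴹ-sym (σ≈Aρ e))

    free-≅ : ∀ S → CV.Free ρ S ⇔ CW.Free σ S
    free-≅ S = mk⇔
      (λ free c sc eq → free c sc (A.injective
        (W.≈ᴹ-trans (comb-σ c) (W.≈ᴹ-trans eq (W.≈ᴹ-sym A.0ᴹ-homo)))))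
      (λ free c sc eq → free c sc
        (W.≈ᴹ-trans (W.≈ᴹ-sym (comb-σ c)) (W.≈ᴹ-trans (A.⟦⟧-cong eq) A.0ᴹ-homo)))

    transport : ∀ {M : Matroid n} → FamilyRepresentation M V ρ → FamilyRepresentation M W σ
    transport F = record
      { _≟ᴹ_  = λ x y → map′
          (λ eq → W.≈ᴹ-trans (W.≈ᴹ-sym (≅-inverseʳ x)) (W.≈ᴹ-trans (A.⟦⟧-cong eq) (≅-inverseʳ y)))
          (λ eq → _≅_.⟦⟧-cong (≅-sym A) eq)
          (F._≟ᴹ_ (_≅_.to (≅-sym A) x) (_≅_.to (≅-sym A) y))
      ; free⇔ = λ S → ⇔-trans (F.free⇔ S) (free-≅ S)
      ; spans = λ w → let (c , eq) = F.spans (_≅_.to (≅-sym A) w) in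
          c , W.≈ᴹ-trans (W.≈ᴹ-sym (comb-σ c)) (W.≈ᴹ-trans (A.⟦⟧-cong eq) (≅-inverseʳ w))
      }
      where module F = FamilyRepresentation F

module _ {m n} {M : Matroid m} {N : Matroid n} {V : VectorSpace}
         {ρ : Fin m → Module.Carrierᴹ V} {σ : Fin n → Module.Carrierᴹ V}
         (F : FamilyRepresentation M V ρ) (G : FamilyRepresentation N V σ) where

  -- Independence on both sides is freeness of the labelling vectors, which A preserves and
  -- reflects. Injectivity is asked of labels only, so loops and parallel elements do no harm.
  embed : (A : V ≅ V) (g : Fin m → Fin n) → Injective _≡_ _≡_ g →
          (∀ e → Module._≈ᴹ_ V (σ (g e)) (_≅_.to A (ρ e))) → M ↪ N
  embed A g inj eq = record
    { fun       = g
    ; injective = inj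
    ; indep⇔    = λ S → ⇔-trans (FamilyRepresentation.free⇔ F S)
        (⇔-trans (free-≅ A {ρ = ρ} {σ ∘ g} eq S)
        (⇔-trans (free-image {V} inj {σ} S) (⇔-sym (FamilyRepresentation.free⇔ G (g [ S ])))))
    }

-- A labelled family, so vectors may repeat and 0 may occur; `onto` is what makes the rank r and the
-- representation spanning.
module Vectors (em : ∀ {ℓ} → ExcludedMiddle ℓ) {n r} (ρ : Fin n → Fin r → Bool)
               (onto : ∀ v → ∃ λ e → ρ e ≗ v) where
  open Lin (𝔽₂^ r)
  open Combinations (𝔽₂^ r)

  free-≤ : ∀ {S} → Free ρ S → ∣ S ∣ ℕ.≤ r
  free-≤ {S} free = injective⇒dim-≤ (λ c → comb c (ρ ∘ enum S)) (free-injective {𝔽₂^ r} {ρ = ρ} free)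

  matroid : Matroid n
  matroid = record
    { Indep      = Free ρ
    ; indep?     = λ _ → em
    ; ∅-indep    = λ c sc _ e → sc e Subₚ.∉⊥
    ; hereditary = free-⊆ {𝔽₂^ r} {ρ = ρ}
    ; augment    = augment
    }
    where
    augment : ∀ {S T} → Free ρ S → Free ρ T → ∣ S ∣ ℕ.< ∣ T ∣ →
              ∃ λ e → e ∈ T × e ∉ S × Free ρ (S ∪ ⁅ e ⁆)
    -- If no element of T extended S, S would span every vector of T, and the combinations over T
    -- would be too many for its span.
    augment {S} {T} freeS freeT S<T = decidable-stable em λ none → ℕₚ.<⇒≱ S<T
      (span-coefficients {𝔽₂^ r} {ρ = ρ} S (λ c → comb c (ρ ∘ enum T))
        (free-injective {𝔽₂^ r} {ρ = ρ} freeT)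
        λ c → span-comb ρ c (ρ ∘ enum T) λ i → decidable-stable em λ i∉span →
          none (enum T i , enum-∈ T i , (λ i∈S → i∉span (span-∈ ρ i∈S))
               , free-extend {𝔽₂^ r} {ρ = ρ} freeS i∉span))

  hasRank : Matroid.HasRank matroid r
  hasRank = (let (S , free , r≤) = large r ℕₚ.≤-refl in
    S , free , ℕₚ.≤-antisym (free-≤ free) r≤) , free-≤
    where
    large : ∀ k → k ℕ.≤ r → ∃ λ S → Free ρ S × k ℕ.≤ ∣ S ∣
    large zero    _   = ∅ , (λ c sc _ e → sc e Subₚ.∉⊥) , z≤n
    large (suc k) k<r =
      let (S , free , k≤S) = large k (ℕₚ.<⇒≤ k<r) in
      -- If no free set had more than k elements, S could not be extended and would span 𝔽₂^r, so r
      -- ≤ ∣ S ∣ ≤ k.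
      decidable-stable em λ none → ℕₚ.<⇒≱ k<r (ℕₚ.≤-trans
        (span-coefficients {𝔽₂^ r} {ρ = ρ} S id id λ v → let (e , ρe≈v) = onto v in
          span-≈ ρ ρe≈v (decidable-stable em λ e∉span →
            none (S ∪ ⁅ e ⁆ , free-extend {𝔽₂^ r} {ρ = ρ} free e∉span
                 , ℕₚ.≤-<-trans k≤S (Subₚ.p⊂q⇒∣p∣<∣q∣ {p = S} {S ∪ ⁅ e ⁆}
                     ( Subₚ.p⊆p∪q ⁅ e ⁆ , e , Subₚ.q⊆p∪q S ⁅ e ⁆ (Subₚ.x∈⁅x⁆ e)
                     , λ e∈S → e∉span (span-∈ ρ e∈S) )))))
        (ℕₚ.≮⇒≥ λ k<S → none (S , free , k<S)))

  binaryMatroid : BinaryMatroid r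
  binaryMatroid = record
    { matroid = matroid
    ; binary  = record
      { V      = 𝔽₂^ r
      ; _≟ᴹ_   = λ v w → Finₚ.all? λ i → v i Boolₚ.≟ w i
      ; ρ      = ρ
      ; indep⇔ = free⇔independent {𝔽₂^ r} {ρ = ρ}
      ; spans  = λ v → 1 , (λ _ → v) , (λ _ → true) , (λ _ → onto v)
                     , λ i → Boolₚ.xor-identityʳ (v i)
      }
    ; rank    = hasRank
    }

  vectors : FamilyRepresentation matroid (𝔽₂^ r) ρ
  vectors = record
    { _≟ᴹ_  = λ v w → Finₚ.all? λ i → v i Boolₚ.≟ w i
    ; free⇔ = λ S → mk⇔ id id
    ; spans = λ v → let (e , ρe≈v) = onto v in ⟦ e ⟧ , λ i → trans (comb-⟦⟧ e ρ i) (ρe≈v i)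
    }

-- Coordinates, cubes and thickenings

module _ {m n k l : ℕ} where

  infixr 6 _⊕_
  _⊕_ : (Fin m → Fin k) → (Fin n → Fin l) → Fin (m ℕ.+ n) → Fin (k ℕ.+ l)
  f ⊕ g = join k l ∘ Sum.map f g ∘ splitAt m

  ⊕-cong : ∀ {f f′ g g′} → f ≗ f′ → g ≗ g′ → f ⊕ g ≗ f′ ⊕ g′
  ⊕-cong f≗f′ g≗g′ i = cong (join k l) (Sumₚ.map-cong f≗f′ g≗g′ (splitAt m i))

  ⊕-injective : ∀ {f g} → Injective _≡_ _≡_ f → Injective _≡_ _≡_ g → Injective _≡_ _≡_ (f ⊕ g)
  ⊕-injective {f} {g} f-inj g-inj {i} {j} eq = trans (sym (Finₚ.join-splitAt m n i))
    (trans (cong (join m n) (cases (splitAt m i) (splitAt m j)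
      (trans (sym (Finₚ.splitAt-join k l _)) (trans (cong (splitAt k) eq) (Finₚ.splitAt-join k l _)))))
    (Finₚ.join-splitAt m n j))
    where
    cases : ∀ u v → Sum.map f g u ≡ Sum.map f g v → u ≡ v
    cases (inj₁ a) (inj₁ b) eq = cong inj₁ (f-inj (Sumₚ.inj₁-injective eq))
    cases (inj₂ a) (inj₂ b) eq = cong inj₂ (g-inj (Sumₚ.inj₂-injective eq))
    cases (inj₁ a) (inj₂ b) ()
    cases (inj₂ a) (inj₁ b) ()

  ⊕-↑ˡ : ∀ f g i → (f ⊕ g) (i ↑ˡ n) ≡ f i ↑ˡ l
  ⊕-↑ˡ f g i = cong (join k l ∘ Sum.map f g) (Finₚ.splitAt-↑ˡ m i n)

  ⊕-↑ʳ : ∀ f g i → (f ⊕ g) (m ↑ʳ i) ≡ k ↑ʳ g i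
  ⊕-↑ʳ f g i = cong (join k l ∘ Sum.map f g) (Finₚ.splitAt-↑ʳ m n i)

⊕-id : ∀ {m n} {g : Fin n → Fin n} → g ≗ id → id ⊕ g ≗ id {A = Fin (m ℕ.+ n)}
⊕-id {m} {n} g≗id i = trans
  (cong (join m n) (trans (Sumₚ.map-cong (λ _ → refl) g≗id (splitAt m i)) (Sumₚ.map-id (splitAt m i))))
  (Finₚ.join-splitAt m n i)

⊕-∘ : ∀ {m n k l p q} (f′ : Fin k → Fin p) (g′ : Fin l → Fin q) (f : Fin m → Fin k) (g : Fin n → Fin l) →
      (f′ ∘ f) ⊕ (g′ ∘ g) ≗ (f′ ⊕ g′) ∘ (f ⊕ g)
⊕-∘ {m} {n} {k} {l} {p} {q} f′ g′ f g i = cong (join p q) (trans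
  (sym (Sumₚ.map-map (splitAt m i)))
  (cong (Sum.map f′ g′) (sym (Finₚ.splitAt-join k l (Sum.map f g (splitAt m i))))))

module _ (em : ∀ {ℓ} → ExcludedMiddle ℓ) (r : ℕ) where
  open BinaryMatroid
  private
    module 𝔽 = Module (𝔽₂^ r)
    module F = Functor (mod2Homology r)

  -- Objects of `𝒢ℓ r` come with an isomorphism from 𝔽₂^r, so conjugating by it involves no choice
  -- of bases.
  coordinatize : Functor (𝒢ℓ r) (oneObject (GL r))
  coordinatize = record
    { F₀     = λ _ → tt
    ; F₁     = λ {(V , c)} {(W , d)} f → ≅-sym d ∘≅ f ∘≅ c
    ; F-cong = λ {(V , c)} {(W , d)} f≈g v → _≅_.⟦⟧-cong (≅-sym d) (f≈g (_≅_.to c v))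
    ; F-id   = λ {(V , c)} v → ≅-inverseˡ c v
    ; F-∙    = λ {(U , b)} {(V , c)} {(W , d)} g f v → _≅_.⟦⟧-cong (≅-sym d) (_≅_.⟦⟧-cong g
        (Module.≈ᴹ-sym V (≅-inverseʳ c (_≅_.to f (_≅_.to b v)))))
    }
  private
    module K = Functor coordinatize

  vector-onto : ∀ v → ∃ λ k → vector r k ≗ v
  vector-onto v = index v , vector-index v

  module Cube = Vectors em (vector r) vector-onto

  permute : 𝔽₂^ r ≅ 𝔽₂^ r → Fin (2 ℕ.^ r) → Fin (2 ℕ.^ r)
  permute A k = index (_≅_.to A (vector r k))

  permute-injective : ∀ A → Injective _≡_ _≡_ (permute A)
  permute-injective A {i} {j} eq = trans (sym (index-vector r i))
    (trans (index-cong (_≅_.injective A (index-injective eq))) (index-vector r j))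

  permute-cong : ∀ {A B} → A ≈ˡ B → permute A ≗ permute B
  permute-cong A≈B k = index-cong (A≈B (vector r k))

  permute-id : ∀ {A} → A ≈ˡ ≅-refl → permute A ≗ id
  permute-id A≈1 k = trans (index-cong (A≈1 (vector r k))) (index-vector r k)

  permute-∘ : ∀ A B → permute (A ∘≅ B) ≗ permute A ∘ permute B
  permute-∘ A B k = index-cong (_≅_.⟦⟧-cong A λ i → sym (vector-index (_≅_.to B (vector r k)) i))

  cube : Functor (oneObject (GL r)) (ℳ r)
  cube = record
    { F₀     = λ _ → Cube.binaryMatroid
    ; F₁     = λ A → embed Cube.vectors Cube.vectors A (permute A) (permute-injective A)
                       (λ k → vector-index (_≅_.to A (vector r k)))
    ; F-cong = λ {_} {_} {A} {B} → permute-cong {A} {B}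
    ; F-id   = permute-id {≅-refl} λ _ _ → refl
    ; F-∙    = permute-∘
    }

  module _ (M : BinaryMatroid r) where
    private
      H≅V : H₁𝔽₂ (matroid M) ≅ Representation.V (binary M)
      H≅V = H₁𝔽₂≅V (family (binary M))
      c : 𝔽₂^ r ≅ H₁𝔽₂ (matroid M)
      c = proj₂ (F.F₀ M)

    -- The class of e ⊗ 1 in coordinates. Unlike the vector of e in the given representation, it is
    -- compatible with morphisms.
    homologyClass : Fin (size M) → Fin r → Bool
    homologyClass e = _≅_.to (≅-sym c) (gen (gen e , true))

    -- The isomorphism `H≅V` sends the class of e to 1 times its given vector, so the classes
    -- represent M because those vectors do.
    classes : FamilyRepresentation (matroid M) (𝔽₂^ r) homologyClass
    classes = transport (≅-sym c ∘≅ ≅-sym H≅V) {σ = homologyClass}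
      (λ e → _≅_.⟦⟧-cong (≅-sym c) (H.≈ᴹ-sym (H.≈ᴹ-trans
        (_≅_.⟦⟧-cong (≅-sym H≅V) (V.≈ᴹ-sym (V.*ₗ-identityˡ (Representation.ρ (binary M) e))))
        (≅-inverseˡ H≅V (gen (gen e , true))))))
      (family (binary M))
      where
      module H = Module (H₁𝔽₂ (matroid M))
      module V = Module (Representation.V (binary M))

    withVectors : Fin (size M ℕ.+ 2 ℕ.^ r) → Fin r → Bool
    withVectors = Sum.[ homologyClass , vector r ]′ ∘ splitAt (size M)

    withVectors-↑ˡ : ∀ e → withVectors (e ↑ˡ (2 ℕ.^ r)) ≡ homologyClass e
    withVectors-↑ˡ e = cong Sum.[ homologyClass , vector r ]′ (Finₚ.splitAt-↑ˡ (size M) e (2 ℕ.^ r))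

    withVectors-↑ʳ : ∀ k → withVectors (size M ↑ʳ k) ≡ vector r k
    withVectors-↑ʳ k = cong Sum.[ homologyClass , vector r ]′ (Finₚ.splitAt-↑ʳ (size M) (2 ℕ.^ r) k)

    withVectors-onto : ∀ v → ∃ λ e → withVectors e ≗ v
    withVectors-onto v = size M ↑ʳ index v
      , λ i → trans (cong (λ w → w i) (withVectors-↑ʳ (index v))) (vector-index v i)

    module Thick = Vectors em withVectors withVectors-onto

  matrix : ∀ {M N : BinaryMatroid r} → matroid M ↪ matroid N → 𝔽₂^ r ≅ 𝔽₂^ r
  matrix {M} {N} f = K.F₁ {F.F₀ M} {F.F₀ N} (F.F₁ {M} {N} f)

  module _ {M N : BinaryMatroid r} (f : matroid M ↪ matroid N) where
    private
      A : 𝔽₂^ r ≅ 𝔽₂^ r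
      A = matrix {M} {N} f

    -- The induced map sends the generator e to the generator f e by definition; it remains to
    -- cancel the coordinates of M against their inverse.
    homologyClass-natural : ∀ e → homologyClass N (fun f e) ≗ _≅_.to A (homologyClass M e)
    homologyClass-natural e = 𝔽.≈ᴹ-sym {_≅_.to A (homologyClass M e)} {homologyClass N (fun f e)}
      (_≅_.⟦⟧-cong (≅-sym (proj₂ (F.F₀ N))) (H₁𝔽₂-map-cong f
        (≅-inverseʳ (proj₂ (F.F₀ M)) (gen (gen e , true)))))

    -- Acting by f on old elements and by its matrix on added vectors covers a single linear map, by
    -- `homologyClass-natural`, so `embed` applies to the whole.
    thicken : Thick.matroid M ↪ Thick.matroid N
    thicken = embed (Thick.vectors M) (Thick.vectors N) A (fun f ⊕ permute A)
      (⊕-injective (_↪_.injective f) (permute-injective A))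
      λ i → subst (λ s → Sum.[ homologyClass N , vector r ]′ s
                           ≗ _≅_.to A (Sum.[ homologyClass M , vector r ]′ (splitAt (size M) i)))
        (sym (Finₚ.splitAt-join (size N) (2 ℕ.^ r) (Sum.map (fun f) (permute A) (splitAt (size M) i))))
        (cases (splitAt (size M) i))
      where
      cases : ∀ s → Sum.[ homologyClass N , vector r ]′ (Sum.map (fun f) (permute A) s)
                  ≗ _≅_.to A (Sum.[ homologyClass M , vector r ]′ s)
      cases (inj₁ e) = homologyClass-natural e
      cases (inj₂ k) = vector-index (_≅_.to A (vector r k))

  matrix-cong : ∀ {M N : BinaryMatroid r} (f g : matroid M ↪ matroid N) → fun f ≗ fun g →
                matrix {M} {N} f ≈ˡ matrix {M} {N} g
  matrix-cong {M} {N} f g f≗g = K.F-cong {F.F₀ M} {F.F₀ N} {F.F₁ {M} {N} f} {F.F₁ {M} {N} g}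
    (F.F-cong {M} {N} {f} {g} f≗g)

  thickening : Functor (ℳ r) (ℳ r)
  thickening = record
    { F₀     = Thick.binaryMatroid
    ; F₁     = λ {M} {N} f → thicken {M} {N} f
    ; F-cong = λ {M} {N} {f} {g} f≗g → ⊕-cong f≗g
        (permute-cong {matrix {M} {N} f} {matrix {M} {N} g} (matrix-cong {M} {N} f g f≗g))
    ; F-id   = λ {M} → ⊕-id (permute-id {matrix {M} {M} ↪-id}
        (Functor.F-id (coordinatize ∘F mod2Homology r) {M}))
    ; F-∙    = λ {L} {M} {N} g f i → trans
        (⊕-cong (λ _ → refl) (λ k → trans
          (permute-cong {matrix {L} {N} (g ∘↪ f)} {matrix {M} {N} g ∘≅ matrix {L} {M} f}
            (Functor.F-∙ (coordinatize ∘F mod2Homology r) {L} {M} {N} g f) k)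
          (permute-∘ (matrix {M} {N} g) (matrix {L} {M} f) k)) i)
        (⊕-∘ (fun g) (permute (matrix {M} {N} g)) (fun f) (permute (matrix {L} {M} f)) i)
    }

  original⇒thickening : NaturalTransformation idF thickening
  original⇒thickening = record
    { η       = λ M → embed (classes M) (Thick.vectors M) ≅-refl (_↑ˡ (2 ℕ.^ r))
        (Finₚ.↑ˡ-injective (2 ℕ.^ r) _ _) λ e i → cong (λ v → v i) (withVectors-↑ˡ M e)
    ; natural = λ {M} {N} f e → sym (⊕-↑ˡ (fun f) (permute (matrix {M} {N} f)) e)
    }

  cube⇒thickening : NaturalTransformation ((cube ∘F coordinatize) ∘F mod2Homology r) thickening
  cube⇒thickening = record
    { η       = λ M → embed Cube.vectors (Thick.vectors M) ≅-refl (size M ↑ʳ_)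
        (Finₚ.↑ʳ-injective (size M) _ _) λ k i → cong (λ v → v i) (withVectors-↑ʳ M k)
    ; natural = λ {M} {N} f k → sym (⊕-↑ʳ (fun f) (permute (matrix {M} {N} f)) k)
    }

  private
    H≅𝔽 : H₁𝔽₂ Cube.matroid ≅ 𝔽₂^ r
    H≅𝔽 = H₁𝔽₂≅V Cube.vectors

  module _ (A : 𝔽₂^ r ≅ 𝔽₂^ r) where
    private
      module A = _≅_ A
      P : Cube.matroid ↪ Cube.matroid
      P = Functor.F₁ cube A

    open Extend 𝔽.+ᴹ-abelianGroup (vector r) using (extend)

    extend-natural : ∀ h → extend (H₁-map P h) ≗ A.to (extend h)
    extend-natural (gen k) = vector-index (A.to (vector r k))
    extend-natural (u ⊞ v) i = trans (cong₂ _xor_ (extend-natural u i) (extend-natural v i))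
                                     (sym (A.+ᴹ-homo (extend u) (extend v) i))
    extend-natural 𝟘       i = sym (A.0ᴹ-homo i)
    extend-natural (⊟ u)   i = trans (extend-natural u i) (sym (A.-ᴹ-homo (extend u) i))

    -- `H≅𝔽` evaluates words in vectors, and P renames the generator k to the label of A applied to
    -- vector k; linearity of A carries this through all words.
    homology-cube : ∀ w → _≅_.to H≅𝔽 (H₁𝔽₂-map P w) ≗ A.to (_≅_.to H≅𝔽 w)
    homology-cube (gen (h , b)) i = trans (cong (b ∧_) (extend-natural h i))
                                          (sym (A.*ₗ-homo b (extend h) i))
    homology-cube (u ⊞ v) i = trans (cong₂ _xor_ (homology-cube u i) (homology-cube v i))
                                    (sym (A.+ᴹ-homo (_≅_.to H≅𝔽 u) (_≅_.to H≅𝔽 v) i))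
    homology-cube 𝟘       i = sym (A.0ᴹ-homo i)
    homology-cube (⊟ u)   i = trans (homology-cube u i) (sym (A.-ᴹ-homo (_≅_.to H≅𝔽 u) i))

  cube-homology : NaturalTransformation (mod2Homology r ∘F (cube ∘F coordinatize)) idF
  cube-homology = record
    { η       = λ (V , c) → c ∘≅ H≅𝔽
    ; natural = λ {(V , c)} {(W , d)} f w → Module.≈ᴹ-trans W
        (_≅_.⟦⟧-cong d (homology-cube (≅-sym d ∘≅ f ∘≅ c) w))
        (≅-inverseʳ d (_≅_.to f (_≅_.to c (_≅_.to H≅𝔽 w))))
    }

  coordinatize-GL : NaturalTransformation (coordinatize ∘F GL↪𝒢ℓ r) idF
  coordinatize-GL = record
    { η       = λ _ → ≅-refl
    ; natural = λ A v → ≅-inverseʳ (≅-refl {𝔽₂^ r}) (_≅_.to A v)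
    }

  GL-coordinatize : NaturalTransformation (GL↪𝒢ℓ r ∘F coordinatize) idF
  GL-coordinatize = record
    { η       = λ (V , c) → c
    ; natural = λ {(V , c)} {(W , d)} f v → ≅-inverseʳ d (_≅_.to f (_≅_.to c v))
    }

theorem2p5 : (∀ {ℓ} → ExcludedMiddle ℓ) →
    (r : ℕ) →
    IsHomotopyEquivalence (B₁ (mod2Homology r)) ×
    IsHomotopyEquivalence (B₁ (GL↪𝒢ℓ r))
theorem2p5 em r =
    B₁-equivalence em {ℳ r} {𝒢ℓ r} (mod2Homology r) (cube em r ∘F coordinatize em r) {thickening em r}
      (cube⇒thickening em r) (original⇒thickening em r) (cube-homology em r)
  -- Here the composite on the one-object category is already naturally isomorphic to the identity,
  -- so no thickening intervenes and T is the identity.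
  , B₁-equivalence em {oneObject (GL r)} {𝒢ℓ r} (GL↪𝒢ℓ r) (coordinatize em r) {idF}
      (coordinatize-GL em r) idN (GL-coordinatize em r)
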